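{- Let $p$ be an odd prime and $D_{2p}=\langle \tau,\sigma\mid \tau^p=\sigma^2=e,\ \sigma\tau\sigma=\tau^{ -1}\rangle$ the dihedral group of order $2p$. The number of Cayley digraphs on $D_{2p}$ up to isomorphism (i.e. the number of isomorphism classes of digraphs $\mathrm{Cay}(D_{2p},S)$ with $S\subseteq D_{2p}\setminus\{e\}$) is $$\mathcal{N}=\frac{1}{p}2^{p}(1-2^{p-1})+\frac{2}{p-1}\sum_{d\mid(p-1)}\Phi(d)\,2^{\frac{2(p-1)}{d}},$$ where $\Phi$ is Euler's totient function.
   Context: For a finite group $G$ and $S\subseteq G$ with $e\notin S$, the Cayley digraph $\mathrm{Cay}(G,S)$ has vertex set $G$ and an arc from $g$ to $h$ whenever $hg^{ -1}\in S$. -}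

module Defs where

open import Data.Nat using (ℕ; zero; suc; _+_; _*_; _∸_; _^_; _%_; _/_; NonZero)
open import Data.Nat.DivMod using (m%n<n)
open import Data.Nat.Divisibility using (_∣?_)
open import Data.Nat.Coprimality using (coprime?)
open import Data.Fin using (Fin; toℕ; fromℕ<)
open import Data.Bool using (Bool; true; false; if_then_else_; _xor_)
open import Data.Product using (Σ; _×_; _,_; ∃)
open import Data.List using (List; map; upTo; filter; length)
open import Data.Nat.ListAction using (sum)
open import Relation.Nullary using (does; ¬_)
open import Relation.Binary.PropositionalEquality using (_≡_)
open import Function.Bundles using (_↔_; Inverse)

totient : ℕ → ℕ
totient n = length (filter (λ k → coprime? (suc k) n) (upTo n))

divisorTerm : ℕ → ℕ
divisorTerm p = sum (map (λ k → if does (suc k ∣? (p ∸ 1))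
                                  then totient (suc k) * 2 ^ ((2 * (p ∸ 1)) / suc k)
                                  else 0)
                         (upTo (p ∸ 1)))

-- The dihedral group D_{2p}: the pair (i , b) stands for τ^i σ^b,
-- i ∈ ℤ/p, b ∈ {0,1} (false = 0, true = 1).
module _ (p : ℕ) .{{_ : NonZero p}} where

  D : Set
  D = Fin p × Bool

  private
    modp : ℕ → Fin p
    modp n = fromℕ< (m%n<n n p)

  e : D
  e = modp 0 , false

  -- (τ^i σ^a)(τ^j σ^b) = τ^(i + (-1)^a j) σ^(a+b)
  _·_ : D → D → D
  (i , a) · (j , b) =
    modp (toℕ i + (if a then p ∸ toℕ j else toℕ j)) , (a xor b)

  inv : D → D
  inv (i , false) = modp (p ∸ toℕ i) , false
  inv (i , true)  = i , true

  ConnSet : Set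
  ConnSet = Σ (D → Bool) λ S → S e ≡ false

  Arc : ConnSet → D → D → Bool
  Arc (S , _) g h = S (h · inv g)

  CayIso : ConnSet → ConnSet → Set
  CayIso S T = Σ (D ↔ D) λ f →
    ∀ g h → Arc S g h ≡ Arc T (Inverse.to f g) (Inverse.to f h)

  NumCayleyDigraphClasses : ℕ → Set
  NumCayleyDigraphClasses N =
    Σ (Fin N → ConnSet) λ R →
      (∀ i j → CayIso (R i) (R j) → i ≡ j) ×
      (∀ S → ∃ λ i → CayIso S (R i))

{-# OPTIONS --safe #-}
module Submission where

-- Write a connection set as S = (A, B) with A ⊆ ℤ/p \ {0} the exponents of its rotations and B ⊆ ℤ/p those
-- of its reflections.  Automorphisms of the dihedral group act by (A, B) ↦ (uA, uB + c).
--
-- Isomorphic Cayley digraphs have equivalent connection sets.  Call an isomorphism layered if it maps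
-- the two cosets of ⟨τ⟩ to cosets by affine maps; a layered isomorphism yields (u, c).  On the other
-- isomorphisms S → T, rotations of T and S act freely, so their number is divisible by p², and even by p³
-- if B is ∅ or ℤ/p, when S admits independent rotations of the two cosets.  If no isomorphism S → T were
-- layered, comparing with the automorphisms of S would make p² (resp. p³) divide the number of layered
-- automorphisms of S, which is 2pk (resp. 2p²k²) for some 0 < k < p.
--
-- The classes are thus the orbits of the affine group, counted by Burnside's lemma; the number of cycles of
-- (u, c) depends only on the order of u when u ≠ 1, and there are Φ(d) units of order d because a field has
-- at most d roots of X^d − 1 while the reduced fractions with denominator dividing p − 1 number at most p − 1.

open import Algebra.Bundles using (CommutativeRing; Group)
import Algebra.Properties.Group
open import Algebra.Structures using (IsGroup)
open import Data.Bool using (Bool; true; false; T; not; if_then_else_)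
import Data.Bool.Properties as Bool
open import Data.Bool.Properties using (T-irrelevant)
open import Data.Empty using (⊥; ⊥-elim)
open import Data.Fin using (Fin; zero; suc; toℕ; fromℕ<; splitAt; join)
import Data.Fin.Properties as Fin
import Data.Integer as ℤ
open import Data.Integer using (ℤ)
import Data.Integer.Properties as ℤ
import Data.Integer.Tactic.RingSolver as ℤSolver
open import Data.List using (map; applyUpTo; upTo; filter; length)
open import Data.Maybe using (Maybe; just; nothing)
import Data.Nat as ℕ
open import Data.Nat using (ℕ; zero; suc; _+_; _*_; _∸_; _^_; _≤_; _<_; z≤n; s≤s; NonZero; _%_; _/_)
open import Data.Nat.Coprimality using (Coprime; coprime?; coprime-divisor)
import Data.Nat.Coprimality as Coprimality
open import Data.Nat.DivMod using (m%n<n; %-distribˡ-+; %-distribˡ-*; m<n⇒m%n≡m; n%n≡0; m≡m%n+[m/n]*n; m*n/n≡m; n/1≡n; /-congʳ)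
open import Data.Nat.Divisibility using (_∣_; divides; quotient; _∣?_; m%n≡0⇒n∣m; n∣m⇒m%n≡0; ∣⇒≤; ∣1⇒≡1; ∣-antisym; *-cancelˡ-∣; *-cancelʳ-∣; ∣m+n∣m⇒∣n)
import Data.Nat.ListAction as List
open import Data.Nat.Primality using (Prime; euclidsLemma; prime⇒nonTrivial)
import Data.Nat.Properties as ℕ
open import Data.Nat.Properties using (+-*-semiring)
import Data.Nat.Tactic.RingSolver as ℕSolver
open import Algebra.Properties.Semiring.Sum +-*-semiring using (sum; sum-cong-≗; ∑-distrib-+; *-distribˡ-sum)
open import Data.Product using (Σ; _×_; _,_; ∃; ∃₂; proj₁; proj₂)
open import Data.Sum using (_⊎_; inj₁; inj₂; [_,_]′)
open import Data.Sum.Properties using (inj₁-injective; inj₂-injective)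
open import Data.Unit using (⊤; tt)
open import Data.Vec using (Vec; []; _∷_; lookup; tabulate)
open import Data.Vec.Properties using (lookup∘tabulate; tabulate∘lookup; tabulate-cong)
open import Function using (_∘_; id; _↔_; Inverse; mk↔ₛ′)
open import Level using (0ℓ)
open import Relation.Binary.PropositionalEquality using (_≡_; _≢_; refl; sym; trans; cong; cong₂; subst; isEquivalence; module ≡-Reasoning)
open import Relation.Nullary using (Dec; yes; no; ¬_; ¬?; does; _×-dec_; _→-dec_; contradiction)
open import Relation.Nullary.Decidable using (True; toWitness; fromWitness; map′; ⌊_⌋)

import Defs
open import Defs using (totient; divisorTerm)

-- Finite types

-- That isomorphic Cayley digraphs of this group come from equivalent connection sets is usually
-- derived from the conjugacy of Sylow p-subgroups. Here counting replaces conjugacy: an isomorphism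
-- fixed by a nontrivial pair (rotation after it, translation of the layers before it) intertwines
-- the two, and since nonzero translations generate ℤ/p, it is affine on each layer. Other
-- isomorphisms do occur (for S empty every permutation is one), so they are controlled only modulo
-- powers of p. For B constant the layered automorphisms already include p² translations, so p²
-- would yield no contradiction; precisely then a second independent translation supplies a third
-- factor p. The first summand of the formula is a correction term. A map with u ≠ 1 of order d
-- fixes 2 · 2^(2(p - 1)/d) sets. Using this for u = 1 as well completes the divisor sum, but claims
-- p · 2 · 2^(2(p - 1)) where the truth is (p - 1) 2^p + 2^(2p - 1). Truth minus claim is (p - 1)
-- 2^p (1 - 2^(p - 1)), to be divided by p(p - 1).

private variable
  A B : Set

record Finite (A : Set) : Set where
  field
    size        : ℕ
    index       : A → Fin size
    elem        : Fin size → A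
    elem-index  : ∀ a → elem (index a) ≡ a
    index-elem  : ∀ i → index (elem i) ≡ i

  index-injective : ∀ {a b} → index a ≡ index b → a ≡ b
  index-injective {a} {b} eq = trans (sym (elem-index a)) (trans (cong elem eq) (elem-index b))

open Finite public

module _ (fA : Finite A) where

  abstract
    equal? : (a b : A) → Dec (a ≡ b)
    equal? a b = map′ (index-injective fA) (cong (index fA)) (index fA a Fin.≟ index fA b)

    exists? : {P : A → Set} → (∀ a → Dec (P a)) → Dec (∃ P)
    exists? {P} P? = map′ (λ (i , Pi) → elem fA i , Pi)
                          (λ (a , Pa) → index fA a , subst P (sym (elem-index fA a)) Pa)
                          (Fin.any? (P? ∘ elem fA))

    forall? : {P : A → Set} → (∀ a → Dec (P a)) → Dec (∀ a → P a)
    forall? {P} P? = map′ (λ h a → subst P (elem-index fA a) (h (index fA a)))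
                          (λ h i → h (elem fA i))
                          (Fin.all? (P? ∘ elem fA))

  ∑ : (A → ℕ) → ℕ
  ∑ f = sum (f ∘ elem fA)

∑-cong : (fA : Finite A) {f g : A → ℕ} → (∀ a → f a ≡ g a) → ∑ fA f ≡ ∑ fA g
∑-cong fA h = sum-cong-≗ (h ∘ elem fA)

∑-+ : (fA : Finite A) (f g : A → ℕ) → ∑ fA (λ a → f a + g a) ≡ ∑ fA f + ∑ fA g
∑-+ fA f g = ∑-distrib-+ (f ∘ elem fA) (g ∘ elem fA)

∑-*ˡ : (fA : Finite A) (c : ℕ) (f : A → ℕ) → ∑ fA (λ a → c * f a) ≡ c * ∑ fA f
∑-*ˡ fA c f = sym (*-distribˡ-sum c (f ∘ elem fA))

sum-const : ∀ n (c : ℕ) → sum {n} (λ _ → c) ≡ n * c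
sum-const zero    c = refl
sum-const (suc n) c = cong (c +_) (sum-const n c)

size-≤ : (fA : Finite A) (fB : Finite B) (f : A → B) → (∀ {x y} → f x ≡ f y → x ≡ y) → size fA ≤ size fB
size-≤ fA fB f inj = Fin.injective⇒≤ {f = index fB ∘ f ∘ elem fA}
  λ eq → trans (sym (index-elem fA _)) (trans (cong (index fA) (inj (index-injective fB eq))) (index-elem fA _))

size-≡ : (fA : Finite A) (fB : Finite B) (f : A → B) (g : B → A) →
         (∀ a → g (f a) ≡ a) → (∀ b → f (g b) ≡ b) → size fA ≡ size fB
size-≡ fA fB f g gf fg = ℕ.≤-antisym
  (size-≤ fA fB f (λ {x} {y} eq → trans (sym (gf x)) (trans (cong g eq) (gf y))))
  (size-≤ fB fA g (λ {x} {y} eq → trans (sym (fg x)) (trans (cong f eq) (fg y))))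

-- The size of the transported structure is that of the given one on the nose.
finite-via : Finite A → (f : A → B) (g : B → A) → (∀ a → g (f a) ≡ a) → (∀ b → f (g b) ≡ b) → Finite B
finite-via fA f g gf fg = record
  { size = size fA
  ; index = index fA ∘ g
  ; elem = f ∘ elem fA
  ; elem-index = λ b → trans (cong f (elem-index fA (g b))) (fg b)
  ; index-elem = λ i → trans (cong (index fA) (gf (elem fA i))) (index-elem fA i)
  }

finite-Fin : ∀ n → Finite (Fin n)
finite-Fin n = record
  { size = n ; index = id ; elem = id ; elem-index = λ _ → refl ; index-elem = λ _ → refl }

finite-⊤ : Finite ⊤
finite-⊤ = finite-via (finite-Fin 1) (λ _ → tt) (λ _ → zero) (λ { zero → refl }) (λ _ → refl)

finite-T : ∀ b → Finite (T b)
finite-T true  = finite-⊤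
finite-T false = finite-via (finite-Fin 0) (λ ()) (λ ()) (λ ()) (λ ())

abstract
  finite-⊎ : Finite A → Finite B → Finite (A ⊎ B)
  finite-⊎ {A} {B} fA fB = finite-via (finite-Fin (m + n)) (to ∘ splitAt m) (join m n ∘ from)
    (λ i → trans (cong (join m n) (from-to (splitAt m i))) (Fin.join-splitAt m n i))
    (λ x → trans (cong to (Fin.splitAt-join m n (from x))) (to-from x))
    where
    m n : ℕ
    m = size fA
    n = size fB
    to : Fin m ⊎ Fin n → A ⊎ B
    to (inj₁ i) = inj₁ (elem fA i)
    to (inj₂ i) = inj₂ (elem fB i)
    from : A ⊎ B → Fin m ⊎ Fin n
    from (inj₁ a) = inj₁ (index fA a)
    from (inj₂ b) = inj₂ (index fB b)
    from-to : ∀ x → from (to x) ≡ x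
    from-to (inj₁ i) = cong inj₁ (index-elem fA i)
    from-to (inj₂ i) = cong inj₂ (index-elem fB i)
    to-from : ∀ x → to (from x) ≡ x
    to-from (inj₁ a) = cong inj₁ (elem-index fA a)
    to-from (inj₂ b) = cong inj₂ (elem-index fB b)

  size-⊎ : (fA : Finite A) (fB : Finite B) → size (finite-⊎ fA fB) ≡ size fA + size fB
  size-⊎ fA fB = refl

  finite-ΣFin : ∀ n {P : Fin n → Set} → (∀ i → Finite (P i)) → Finite (Σ (Fin n) P)
  finite-ΣFin zero    fP = finite-via (finite-Fin 0) (λ ()) (λ ()) (λ ()) (λ ())
  finite-ΣFin (suc n) {P} fP = finite-via (finite-⊎ (fP zero) (finite-ΣFin n (fP ∘ suc)))
    (λ { (inj₁ x) → zero , x ; (inj₂ (i , x)) → suc i , x })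
    (λ { (zero , x) → inj₁ x ; (suc i , x) → inj₂ (i , x) })
    (λ { (inj₁ _) → refl ; (inj₂ _) → refl })
    (λ { (zero , _) → refl ; (suc _ , _) → refl })

  size-ΣFin : ∀ n {P : Fin n → Set} (fP : ∀ i → Finite (P i)) → size (finite-ΣFin n fP) ≡ sum (size ∘ fP)
  size-ΣFin zero    fP = refl
  size-ΣFin (suc n) fP = cong (size (fP zero) +_) (size-ΣFin n (fP ∘ suc))

  finite-Σ : {P : A → Set} (fA : Finite A) → (∀ a → Finite (P a)) → Finite (Σ A P)
  finite-Σ {A} {P} fA fP = finite-via (finite-ΣFin (size fA) (fP ∘ elem fA))
    (λ (i , x) → elem fA i , x)
    (λ (a , x) → index fA a , subst P (sym (elem-index fA a)) x)
    (λ (i , x) → lemma (index-elem fA i) (sym (elem-index fA (elem fA i))) x)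
    (λ (a , x) → lemma′ (elem-index fA a) x)
    where
    lemma : ∀ {i j} → i ≡ j → (eq : elem fA j ≡ elem fA i) (x : P (elem fA j)) →
            _≡_ {A = Σ (Fin (size fA)) (P ∘ elem fA)} (i , subst P eq x) (j , x)
    lemma refl refl x = refl
    lemma′ : ∀ {a b} (eq : b ≡ a) (x : P a) → _≡_ {A = Σ A P} (b , subst P (sym eq) x) (a , x)
    lemma′ refl x = refl

  size-Σ : {P : A → Set} (fA : Finite A) (fP : ∀ a → Finite (P a)) →
           size (finite-Σ fA fP) ≡ ∑ fA (size ∘ fP)
  size-Σ fA fP = size-ΣFin (size fA) (fP ∘ elem fA)

  finite-× : Finite A → Finite B → Finite (A × B)
  finite-× fA fB = finite-Σ fA (λ _ → fB)

  size-× : (fA : Finite A) (fB : Finite B) → size (finite-× fA fB) ≡ size fA * size fB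
  size-× fA fB = trans (size-Σ fA (λ _ → fB)) (sum-const (size fA) (size fB))

finite-Bool : Finite Bool
finite-Bool = finite-via (finite-Fin 2)
  (λ { zero → false ; (suc zero) → true }) (λ { false → zero ; true → suc zero })
  (λ { zero → refl ; (suc zero) → refl }) (λ { false → refl ; true → refl })

finite-Vec : Finite A → ∀ n → Finite (Vec A n)
finite-Vec fA zero    = finite-via finite-⊤ (λ _ → []) (λ _ → tt) (λ _ → refl) (λ { [] → refl })
finite-Vec fA (suc n) = finite-via (finite-× fA (finite-Vec fA n))
  (λ (x , xs) → x ∷ xs) (λ { (x ∷ xs) → x , xs }) (λ _ → refl) (λ { (x ∷ xs) → refl })

size-Vec : (fA : Finite A) (n : ℕ) → size (finite-Vec fA n) ≡ size fA ^ n
size-Vec fA zero    = refl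
size-Vec fA (suc n) = trans (size-× fA (finite-Vec fA n)) (cong (size fA *_) (size-Vec fA n))

-- `True (P? a)` has at most one inhabitant, unlike `P a`: equality in the subtype is equality of
-- `val`, and its size counts elements rather than proofs.
record Sub {A : Set} {P : A → Set} (P? : ∀ a → Dec (P a)) : Set where
  constructor _⊢_
  field
    val     : A
    witness : True (P? val)

  holds : P val
  holds = toWitness witness

open Sub public

module _ {P : A → Set} {P? : ∀ a → Dec (P a)} where

  sub : (a : A) → P a → Sub P?
  sub a Pa = a ⊢ fromWitness Pa

  Sub-≡ : {x y : Sub P?} → val x ≡ val y → x ≡ y
  Sub-≡ {a ⊢ s} {.a ⊢ t} refl = cong (a ⊢_) (T-irrelevant s t)

abstract
  finite-Sub : {P : A → Set} → Finite A → (P? : ∀ a → Dec (P a)) → Finite (Sub P?)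
  finite-Sub fA P? = finite-via (finite-Σ fA (λ a → finite-T ⌊ P? a ⌋))
    (λ (a , t) → a ⊢ t) (λ (a ⊢ t) → a , t) (λ _ → refl) (λ _ → refl)

  size-Sub : {P : A → Set} (fA : Finite A) (P? : ∀ a → Dec (P a)) →
             size (finite-Sub fA P?) ≡ ∑ fA (λ a → size (finite-T ⌊ P? a ⌋))
  size-Sub fA P? = size-Σ fA (λ a → finite-T ⌊ P? a ⌋)

-- Functions on a finite type stored as vectors, so that they have decidable and extensional equality.
record Tab {A : Set} (fA : Finite A) (B : Set) : Set where
  constructor ⟨_⟩
  field values : Vec B (size fA)

abstract
  finite-Tab : (fA : Finite A) → Finite B → Finite (Tab fA B)
  finite-Tab fA fB = finite-via (finite-Vec fB (size fA)) ⟨_⟩ Tab.values (λ _ → refl) (λ _ → refl)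

  size-Tab : (fA : Finite A) (fB : Finite B) → size (finite-Tab fA fB) ≡ size fB ^ size fA
  size-Tab fA fB = size-Vec fB (size fA)

module _ (fA : Finite A) where

  abstract
    app : Tab fA B → A → B
    app ⟨ t ⟩ a = lookup t (index fA a)

    tab : (A → B) → Tab fA B
    tab f = ⟨ tabulate (f ∘ elem fA) ⟩

    app-tab : (f : A → B) (a : A) → app (tab f) a ≡ f a
    app-tab f a = trans (lookup∘tabulate (f ∘ elem fA) (index fA a)) (cong f (elem-index fA a))

    tab-ext : {s t : Tab fA B} → (∀ a → app s a ≡ app t a) → s ≡ t
    tab-ext {s = ⟨ s ⟩} {⟨ t ⟩} h = cong ⟨_⟩ (trans (sym (tabulate∘lookup s)) (trans (tabulate-cong pointwise) (tabulate∘lookup t)))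
      where
      pointwise : ∀ i → lookup s i ≡ lookup t i
      pointwise i = subst (λ j → lookup s j ≡ lookup t j) (index-elem fA i) (h (elem fA i))

-- A missed `b` would extend `f` to an injection of `⊤ ⊎ A` into `B`, one element too many.
injective⇒surjective : (fA : Finite A) (fB : Finite B) (f : A → B) → (∀ {x y} → f x ≡ f y → x ≡ y) →
  size fB ≤ size fA → ∀ b → ∃ λ a → f a ≡ b
injective⇒surjective {A} {B} fA fB f inj B≤A b with exists? fA (λ a → equal? fB (f a) b)
... | yes ex = ex
... | no ¬ex = contradiction (ℕ.≤-trans (ℕ.≤-reflexive (sym (size-⊎ finite-⊤ fA)))
                 (ℕ.≤-trans (size-≤ (finite-⊎ finite-⊤ fA) fB g g-inj) B≤A)) ℕ.1+n≰n
  where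
  g : ⊤ ⊎ A → B
  g (inj₁ _) = b
  g (inj₂ a) = f a
  g-inj : ∀ {x y} → g x ≡ g y → x ≡ y
  g-inj {inj₁ _} {inj₁ _} _  = refl
  g-inj {inj₁ _} {inj₂ a} eq = ⊥-elim (¬ex (a , sym eq))
  g-inj {inj₂ a} {inj₁ _} eq = ⊥-elim (¬ex (a , eq))
  g-inj {inj₂ _} {inj₂ _} eq = cong inj₂ (inj eq)

-- Both sides count the pairs of an `a` and an element of `Fin (h (f a))`, the right one sorted by
-- `f a`. This will turn a sum over units into a sum over orders.
∑-fibres : ∀ {m} (fA : Finite A) (f : A → Fin m) (h : Fin m → ℕ) →
  ∑ fA (h ∘ f) ≡ sum (λ i → size (finite-Sub fA (λ a → f a Fin.≟ i)) * h i)
∑-fibres {A} {m} fA f h = begin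
  ∑ fA (h ∘ f)                                       ≡⟨ size-Σ fA (λ a → finite-Fin (h (f a))) ⟨
  size (finite-Σ fA (λ a → finite-Fin (h (f a))))    ≡⟨ size-≡ (finite-Σ fA _) (finite-Σ (finite-Fin m) finite-fibre) to from from-to to-from ⟩
  size (finite-Σ (finite-Fin m) finite-fibre)        ≡⟨ size-Σ (finite-Fin m) finite-fibre ⟩
  sum (size ∘ finite-fibre)                          ≡⟨ sum-cong-≗ (λ i → size-× _ (finite-Fin (h i))) ⟩
  sum (λ i → size (finite-Sub fA (λ a → f a Fin.≟ i)) * h i) ∎
  where
  open ≡-Reasoning
  Fibre : Fin m → Set
  Fibre i = Sub (λ a → f a Fin.≟ i) × Fin (h i)
  finite-fibre : ∀ i → Finite (Fibre i)
  finite-fibre i = finite-× (finite-Sub fA (λ a → f a Fin.≟ i)) (finite-Fin (h i))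
  to : Σ A (Fin ∘ h ∘ f) → Σ (Fin m) Fibre
  to (a , x) = f a , sub a refl , x
  from : Σ (Fin m) Fibre → Σ A (Fin ∘ h ∘ f)
  from (i , a , x) = val a , subst (Fin ∘ h) (sym (holds a)) x
  from-to′ : ∀ a (x : Fin (h (f a))) (eq : f a ≡ f a) → subst (Fin ∘ h) (sym eq) x ≡ x
  from-to′ a x refl = refl
  from-to : ∀ y → from (to y) ≡ y
  from-to (a , x) = cong (a ,_) (from-to′ a x (holds {P? = λ b → f b Fin.≟ f a} (sub a refl)))
  to-from′ : ∀ {i} a (t : True (f a Fin.≟ i)) (x : Fin (h i)) (eq : f a ≡ i) →
    _≡_ {A = Σ (Fin m) Fibre} (f a , sub a refl , subst (Fin ∘ h) (sym eq) x) (i , a ⊢ t , x)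
  to-from′ a t x refl = cong (λ s → _ , s , x) (Sub-≡ refl)
  to-from : ∀ y → to (from y) ≡ y
  to-from (i , a@(a′ ⊢ t) , x) = to-from′ a′ t x (holds a)

sum-mono-≤ : ∀ {n} {f g : Fin n → ℕ} → (∀ i → f i ≤ g i) → sum f ≤ sum g
sum-mono-≤ {zero}  f≤g = z≤n
sum-mono-≤ {suc n} f≤g = ℕ.+-mono-≤ (f≤g zero) (sum-mono-≤ (f≤g ∘ suc))

-- Serves to upgrade upper bounds on the number of units of each order to equalities, by comparing
-- totals.
sum-≤-antisym : ∀ {n} {f g : Fin n → ℕ} → (∀ i → f i ≤ g i) → sum g ≤ sum f → ∀ i → f i ≡ g i
sum-≤-antisym {f = f} {g} f≤g ∑g≤∑f zero = ℕ.≤-antisym (f≤g zero)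
  (ℕ.+-cancelʳ-≤ (sum (f ∘ suc)) (g zero) (f zero) (ℕ.≤-trans (ℕ.+-monoʳ-≤ (g zero) (sum-mono-≤ (f≤g ∘ suc))) ∑g≤∑f))
sum-≤-antisym {f = f} {g} f≤g ∑g≤∑f (suc i) = sum-≤-antisym (f≤g ∘ suc)
  (ℕ.+-cancelˡ-≤ (f zero) (sum (g ∘ suc)) (sum (f ∘ suc)) (ℕ.≤-trans (ℕ.+-monoˡ-≤ (sum (g ∘ suc)) (f≤g zero)) ∑g≤∑f)) i

-- Group actions on finite types

least : ∀ {n} {P : Fin n → Set} → (∀ i → Dec (P i)) → ∃ P → ∃ λ i → P i × (∀ j → toℕ j < toℕ i → ¬ P j)
least {suc n} {P} P? ex with P? zero
... | yes P0 = zero , P0 , λ _ ()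
... | no ¬P0 with least (P? ∘ suc) (shift ex)
  where
  shift : ∃ P → ∃ (P ∘ suc)
  shift (zero  , Pi) = ⊥-elim (¬P0 Pi)
  shift (suc i , Pi) = i , Pi
...   | i , Pi , below = suc i , Pi , λ { zero _ → ¬P0 ; (suc j) (s≤s j<i) → below j j<i }

least-unique : ∀ {n} {P : Fin n → Set} {i j : Fin n} →
  P i × (∀ k → toℕ k < toℕ i → ¬ P k) → P j × (∀ k → toℕ k < toℕ j → ¬ P k) → i ≡ j
least-unique {i = i} {j} (Pi , below-i) (Pj , below-j) =
  Fin.toℕ-injective (ℕ.≤-antisym (ℕ.≮⇒≥ λ j<i → below-i j j<i Pj) (ℕ.≮⇒≥ λ i<j → below-j i i<j Pi))

record FiniteGroup (G : Set) : Set where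
  infixl 7 _∙_
  field
    finite  : Finite G
    _∙_     : G → G → G
    ε       : G
    _⁻¹     : G → G
    isGroup : IsGroup _≡_ _∙_ ε _⁻¹

  open IsGroup isGroup public using (assoc; identityˡ; identityʳ; inverseˡ; inverseʳ)

  order : ℕ
  order = size finite

infixr 4 _×-group_

_×-group_ : ∀ {G H} → FiniteGroup G → FiniteGroup H → FiniteGroup (G × H)
𝓖 ×-group 𝓗 = record
  { finite  = finite-× G.finite H.finite
  ; _∙_     = λ (g , h) (g′ , h′) → g G.∙ g′ , h H.∙ h′
  ; ε       = G.ε , H.ε
  ; _⁻¹     = λ (g , h) → g G.⁻¹ , h H.⁻¹
  ; isGroup = record
    { isMonoid = record
      { isSemigroup = record
        { isMagma = record { isEquivalence = isEquivalence ; ∙-cong = cong₂ λ (g , h) (g′ , h′) → g G.∙ g′ , h H.∙ h′ }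
        ; assoc = λ (g , h) (g′ , h′) (g″ , h″) → cong₂ _,_ (G.assoc g g′ g″) (H.assoc h h′ h″)
        }
      ; identity = (λ (g , h) → cong₂ _,_ (G.identityˡ g) (H.identityˡ h))
                 , (λ (g , h) → cong₂ _,_ (G.identityʳ g) (H.identityʳ h))
      }
    ; inverse = (λ (g , h) → cong₂ _,_ (G.inverseˡ g) (H.inverseˡ h))
              , (λ (g , h) → cong₂ _,_ (G.inverseʳ g) (H.inverseʳ h))
    ; ⁻¹-cong = cong λ (g , h) → g G.⁻¹ , h H.⁻¹
    }
  }
  where
  module G = FiniteGroup 𝓖
  module H = FiniteGroup 𝓗

record Action {G : Set} (𝓖 : FiniteGroup G) (Y : Set) : Set where
  open FiniteGroup 𝓖
  field
    act   : G → Y → Y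
    act-ε : ∀ y → act ε y ≡ y
    act-∙ : ∀ g h y → act (g ∙ h) y ≡ act g (act h y)

module Orbits {G Y : Set} {𝓖 : FiniteGroup G} (fY : Finite Y) (𝓐 : Action 𝓖 Y) where
  open FiniteGroup 𝓖
  open Action 𝓐

  Related : Y → Y → Set
  Related y z = ∃ λ g → act g y ≡ z

  related? : ∀ y z → Dec (Related y z)
  related? y z = exists? finite (λ g → equal? fY (act g y) z)

  related-refl : ∀ {y} → Related y y
  related-refl = ε , act-ε _

  act-⁻¹ : ∀ g {y z} → act g y ≡ z → act (g ⁻¹) z ≡ y
  act-⁻¹ g {y} refl = trans (sym (act-∙ (g ⁻¹) g y)) (trans (cong (λ h → act h y) (inverseˡ g)) (act-ε y))

  related-sym : ∀ {y z} → Related y z → Related z y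
  related-sym (g , eq) = g ⁻¹ , act-⁻¹ g eq

  related-trans : ∀ {x y z} → Related x y → Related y z → Related x z
  related-trans (g , refl) (h , refl) = h ∙ g , act-∙ h g _

  private
    first : ∀ y → ∃ λ i → Related (elem fY i) y × (∀ j → toℕ j < toℕ i → ¬ Related (elem fY j) y)
    first y = least (λ i → related? (elem fY i) y)
      (index fY y , subst (λ x → Related x y) (sym (elem-index fY y)) related-refl)

  -- The first element of the orbit in the enumeration of `Y`. Orbits can then be encoded as the
  -- elements of `Y` that represent themselves, instead of as a quotient.
  rep : Y → Y
  rep y = elem fY (proj₁ (first y))

  rep-related : ∀ y → Related (rep y) y
  rep-related y = proj₁ (proj₂ (first y))

  rep-cong : ∀ {y z} → Related y z → rep y ≡ rep z
  rep-cong {y} {z} y~z with first y | first z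
  ... | i , i~y , below-i | j , j~z , below-j = cong (elem fY) (least-unique
    (i~y , below-i) (related-trans j~z (related-sym y~z) , λ k k<j k~y → below-j k k<j (related-trans k~y y~z)))

  Orbit : Set
  Orbit = Sub (λ y → equal? fY (rep y) y)

  finite-Orbit : Finite Orbit
  finite-Orbit = finite-Sub fY (λ y → equal? fY (rep y) y)

  orbit : Y → Orbit
  orbit y = sub (rep y) (rep-cong (rep-related y))

  orbit-cong : ∀ {y z} → Related y z → orbit y ≡ orbit z
  orbit-cong y~z = Sub-≡ (rep-cong y~z)

  orbit-rep : ∀ (o : Orbit) → orbit (val o) ≡ o
  orbit-rep o = Sub-≡ (holds o)

  Fix : G → Set
  Fix g = Sub (λ y → equal? fY (act g y) y)

  finite-Fix : ∀ g → Finite (Fix g)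
  finite-Fix g = finite-Sub fY (λ y → equal? fY (act g y) y)

  -- With t y a chosen element carrying rep y to y, the pairs (g , y) such that g fixes y
  -- correspond to the pairs (g ∙ t y , rep y).
  burnside : ∑ finite (λ g → size (finite-Fix g)) ≡ order * size finite-Orbit
  burnside = trans (sym (size-Σ finite finite-Fix)) (trans
    (size-≡ (finite-Σ finite finite-Fix) (finite-× finite finite-Orbit) to from from-to to-from)
    (size-× finite finite-Orbit))
    where
    t : Y → G
    t y = proj₁ (rep-related y)
    act-t : ∀ y → act (t y) (rep y) ≡ y
    act-t y = proj₂ (rep-related y)
    to : Σ G Fix → G × Orbit
    to (g , y ⊢ _) = g ∙ t y , orbit y
    from-fixed : ∀ k (r : Y) → rep r ≡ r → act (k ∙ t (act k r) ⁻¹) (act k r) ≡ act k r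
    from-fixed k r rep-r = trans (act-∙ k (t (act k r) ⁻¹) (act k r)) (cong (act k)
      (trans (act-⁻¹ (t (act k r)) (act-t (act k r))) (trans (sym (rep-cong (k , refl))) rep-r)))
    from : G × Orbit → Σ G Fix
    from (k , o@(r ⊢ _)) = k ∙ t (act k r) ⁻¹ , sub (act k r) (from-fixed k r (holds o))
    Fix-≡ : ∀ {g h} {x : Fix g} {y : Fix h} → g ≡ h → val x ≡ val y → _≡_ {A = Σ G Fix} (g , x) (h , y)
    Fix-≡ refl eq = cong (_ ,_) (Sub-≡ eq)
    from-to : ∀ x → from (to x) ≡ x
    from-to (g , x@(y ⊢ _)) = Fix-≡
      (trans (cong (λ z → g ∙ t y ∙ t z ⁻¹) moved)
        (trans (assoc g (t y) (t y ⁻¹)) (trans (cong (g ∙_) (inverseʳ (t y))) (identityʳ g))))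
      moved
      where
      moved : act (g ∙ t y) (rep y) ≡ y
      moved = trans (act-∙ g (t y) (rep y)) (trans (cong (act g) (act-t y)) (holds x))
    to-from : ∀ x → to (from x) ≡ x
    to-from (k , o@(r ⊢ _)) = cong₂ _,_
      (trans (assoc k (t y ⁻¹) (t y)) (trans (cong (k ∙_) (inverseˡ (t y))) (identityʳ k)))
      (trans (sym (orbit-cong (k , refl))) (orbit-rep o))
      where y = act k r

  -- In a free action only `ε` has fixed points, so the left side of `burnside` collapses to the
  -- size of `Y`. This is the source of all divisibility statements below.
  free-size : (∀ g y → act g y ≡ y → g ≡ ε) → size fY ≡ order * size finite-Orbit
  free-size free = trans (size-≡ fY (finite-Σ finite finite-Fix)
      (λ y → ε , sub y (act-ε y)) (λ (_ , y ⊢ _) → y) (λ _ → refl)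
      (λ (g , x@(y ⊢ _)) → from-to (free g y (holds x)) x))
    (trans (size-Σ finite finite-Fix) burnside)
    where
    from-to : ∀ {g} → g ≡ ε → (x : Fix g) → _≡_ {A = Σ G Fix} (ε , sub (val x) (act-ε (val x))) (g , x)
    from-to refl x = cong (_ ,_) (Sub-≡ refl)

  Invariant : Tab fY Bool → Set
  Invariant s = ∀ g y → app fY s (act g y) ≡ app fY s y

  invariant? : ∀ s → Dec (Invariant s)
  invariant? s = forall? finite λ g → forall? fY λ y → app fY s (act g y) Bool.≟ app fY s y

  -- An invariant subset is an arbitrary union of orbits: it is read off at the representatives and
  -- recovered by pulling back along `orbit`.
  size-Invariant : size (finite-Sub (finite-Tab fY finite-Bool) invariant?) ≡ 2 ^ size finite-Orbit
  size-Invariant = trans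
    (size-≡ (finite-Sub (finite-Tab fY finite-Bool) invariant?) (finite-Tab finite-Orbit finite-Bool) to from from-to to-from)
    (size-Tab finite-Orbit finite-Bool)
    where
    to : Sub invariant? → Tab finite-Orbit Bool
    to (s ⊢ _) = tab finite-Orbit (λ (r ⊢ _) → app fY s r)
    from : Tab finite-Orbit Bool → Sub invariant?
    from t = sub (tab fY (λ y → app finite-Orbit t (orbit y))) λ g y →
      trans (app-tab fY _ (act g y))
        (trans (cong (app finite-Orbit t) (sym (orbit-cong (g , refl)))) (sym (app-tab fY _ y)))
    from-to : ∀ x → from (to x) ≡ x
    from-to x@(s ⊢ _) = Sub-≡ (tab-ext fY λ y → trans (app-tab fY _ y) (trans (app-tab finite-Orbit _ (orbit y))
      (trans (sym (holds x (proj₁ (rep-related y)) (rep y))) (cong (app fY s) (proj₂ (rep-related y))))))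
    to-from : ∀ t → to (from t) ≡ t
    to-from t = tab-ext finite-Orbit λ o → trans (app-tab finite-Orbit _ o)
      (trans (app-tab fY _ (val o)) (cong (app finite-Orbit t) (orbit-rep o)))

-- The rings ℤ/m

-- A ring solver for `R` with coefficients in ℤ, mapped to `R` by the canonical homomorphism.
-- Coefficients are thus compared in ℤ, where they compute, even if the modulus of `R` is a
-- variable.
module IntegerCoefficients {c ℓ} (R : CommutativeRing c ℓ) where
  private
    module R = CommutativeRing R
    open import Algebra.Properties.Ring R.ring using (-0#≈0#; -‿+-comm; -‿involutive; -‿distribˡ-*; -‿distribʳ-*)
    open import Algebra.Properties.Semiring.Mult R.semiring renaming (_×_ to _·_) using (×-homo-+; ×1-homo-*)
    open import Algebra.Solver.Ring.AlmostCommutativeRing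
    open import Data.Integer using (+_; -[1+_]; _⊖_)
    open import Relation.Binary.Reasoning.Setoid R.setoid
    open R using (_≈_; 0#; 1#) renaming (_+_ to _⊕_; _*_ to _⊗_; -_ to ⊝_)

    ⟦_⟧ᶻ : ℤ → R.Carrier
    ⟦ + n ⟧ᶻ = n · 1#
    ⟦ -[1+ n ] ⟧ᶻ = ⊝ (suc n · 1#)

    neg-homo : ∀ i → ⟦ ℤ.- i ⟧ᶻ ≈ ⊝ ⟦ i ⟧ᶻ
    neg-homo (+ zero)  = R.sym -0#≈0#
    neg-homo (+ suc n) = R.refl
    neg-homo -[1+ n ]  = R.sym (-‿involutive _)

    ⊖-homo : ∀ m n → ⟦ m ⊖ n ⟧ᶻ ≈ m · 1# ⊕ ⊝ (n · 1#)
    ⊖-homo m zero = R.sym (R.trans (R.+-congˡ -0#≈0#) (R.+-identityʳ _))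
    ⊖-homo zero (suc n) = R.sym (R.+-identityˡ _)
    ⊖-homo (suc m) (suc n) = begin
      ⟦ suc m ⊖ suc n ⟧ᶻ                ≡⟨ cong ⟦_⟧ᶻ (ℤ.[1+m]⊖[1+n]≡m⊖n m n) ⟩
      ⟦ m ⊖ n ⟧ᶻ                        ≈⟨ ⊖-homo m n ⟩
      x ⊕ ⊝ y                           ≈⟨ R.+-congˡ (R.+-identityˡ _) ⟨
      x ⊕ (0# ⊕ ⊝ y)                    ≈⟨ R.+-congˡ (R.+-congʳ (R.-‿inverseʳ 1#)) ⟨
      x ⊕ ((1# ⊕ ⊝ 1#) ⊕ ⊝ y)           ≈⟨ R.+-congˡ (R.+-assoc _ _ _) ⟩
      x ⊕ (1# ⊕ (⊝ 1# ⊕ ⊝ y))           ≈⟨ R.+-assoc _ _ _ ⟨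
      (x ⊕ 1#) ⊕ (⊝ 1# ⊕ ⊝ y)           ≈⟨ R.+-cong (R.+-comm _ _) (-‿+-comm _ _) ⟩
      (1# ⊕ x) ⊕ ⊝ (1# ⊕ y)             ∎
      where
      x = m · 1#
      y = n · 1#

    +-homo : ∀ i j → ⟦ i ℤ.+ j ⟧ᶻ ≈ ⟦ i ⟧ᶻ ⊕ ⟦ j ⟧ᶻ
    +-homo (+ m) (+ n) = ×-homo-+ 1# m n
    +-homo (+ m) -[1+ n ] = ⊖-homo m (suc n)
    +-homo -[1+ m ] (+ n) = R.trans (⊖-homo n (suc m)) (R.+-comm _ _)
    +-homo -[1+ m ] -[1+ n ] = begin
      ⊝ (suc (suc (m + n)) · 1#)      ≡⟨ cong (λ k → ⊝ (suc k · 1#)) (ℕ.+-suc m n) ⟨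
      ⊝ ((suc m + suc n) · 1#)        ≈⟨ R.-‿cong (×-homo-+ 1# (suc m) (suc n)) ⟩
      ⊝ (suc m · 1# ⊕ suc n · 1#)       ≈⟨ -‿+-comm _ _ ⟨
      ⊝ (suc m · 1#) ⊕ ⊝ (suc n · 1#)   ∎

    pos-homo : ∀ m j → ⟦ + m ℤ.* j ⟧ᶻ ≈ ⟦ + m ⟧ᶻ ⊗ ⟦ j ⟧ᶻ
    pos-homo m (+ n) = R.trans (R.reflexive (cong ⟦_⟧ᶻ (sym (ℤ.pos-* m n)))) (×1-homo-* m n)
    pos-homo m -[1+ n ] = begin
      ⟦ + m ℤ.* ℤ.- (+ suc n) ⟧ᶻ        ≡⟨ cong ⟦_⟧ᶻ (ℤ.neg-distribʳ-* (+ m) (+ suc n)) ⟨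
      ⟦ ℤ.- (+ m ℤ.* + suc n) ⟧ᶻ        ≈⟨ neg-homo (+ m ℤ.* + suc n) ⟩
      ⊝ ⟦ + m ℤ.* + suc n ⟧ᶻ            ≈⟨ R.-‿cong (pos-homo m (+ suc n)) ⟩
      ⊝ (m · 1# ⊗ (suc n · 1#))         ≈⟨ -‿distribʳ-* _ _ ⟩
      m · 1# ⊗ ⊝ (suc n · 1#)           ∎

    *-homo : ∀ i j → ⟦ i ℤ.* j ⟧ᶻ ≈ ⟦ i ⟧ᶻ ⊗ ⟦ j ⟧ᶻ
    *-homo (+ m) j = pos-homo m j
    *-homo -[1+ m ] j = begin
      ⟦ ℤ.- (+ suc m) ℤ.* j ⟧ᶻ          ≡⟨ cong ⟦_⟧ᶻ (ℤ.neg-distribˡ-* (+ suc m) j) ⟨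
      ⟦ ℤ.- (+ suc m ℤ.* j) ⟧ᶻ          ≈⟨ neg-homo (+ suc m ℤ.* j) ⟩
      ⊝ ⟦ + suc m ℤ.* j ⟧ᶻ              ≈⟨ R.-‿cong (pos-homo (suc m) j) ⟩
      ⊝ (suc m · 1# ⊗ ⟦ j ⟧ᶻ)           ≈⟨ -‿distribˡ-* _ _ ⟩
      ⊝ (suc m · 1#) ⊗ ⟦ j ⟧ᶻ           ∎

    homomorphism : ℤ.+-*-rawRing -Raw-AlmostCommutative⟶ fromCommutativeRing R
    homomorphism = record
      { ⟦_⟧    = ⟦_⟧ᶻ
      ; +-homo = +-homo
      ; *-homo = *-homo
      ; -‿homo = neg-homo
      ; 0-homo = R.refl
      ; 1-homo = R.+-identityʳ 1#
      }

    coeff≟ : ∀ i j → Maybe (⟦ i ⟧ᶻ ≈ ⟦ j ⟧ᶻ)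
    coeff≟ i j with i ℤ.≟ j
    ... | yes eq = just (R.reflexive (cong ⟦_⟧ᶻ eq))
    ... | no  _  = nothing

  open import Algebra.Solver.Ring ℤ.+-*-rawRing (fromCommutativeRing R) homomorphism coeff≟ public
    using (solve; _:=_; _:+_; _:*_; :-_; con)

module ℤ/ (m : ℕ) .{{_ : NonZero m}} where

  infixl 6 _⊕_
  infixl 7 _⊗_
  infix  8 ⊝_

  [_] : ℕ → Fin m
  [ n ] = fromℕ< (m%n<n n m)

  toℕ-[] : ∀ n → toℕ [ n ] ≡ n % m
  toℕ-[] n = Fin.toℕ-fromℕ< (m%n<n n m)

  []-cong-% : ∀ {k n} → k % m ≡ n % m → [ k ] ≡ [ n ]
  []-cong-% {k} {n} eq = Fin.toℕ-injective (trans (toℕ-[] k) (trans eq (sym (toℕ-[] n))))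

  []-toℕ : ∀ i → [ toℕ i ] ≡ i
  []-toℕ i = Fin.toℕ-injective (trans (toℕ-[] (toℕ i)) (m<n⇒m%n≡m (Fin.toℕ<n i)))

  abstract
    _⊕_ _⊗_ : Fin m → Fin m → Fin m
    i ⊕ j = [ toℕ i + toℕ j ]
    i ⊗ j = [ toℕ i * toℕ j ]

    ⊝_ : Fin m → Fin m
    ⊝ i = [ m ∸ toℕ i ]

    +-def : ∀ i j → i ⊕ j ≡ [ toℕ i + toℕ j ]
    +-def i j = refl

    neg-def : ∀ i → ⊝ i ≡ [ m ∸ toℕ i ]
    neg-def i = refl

    []-+ : ∀ k n → [ k + n ] ≡ [ k ] ⊕ [ n ]
    []-+ k n = []-cong-% (trans (%-distribˡ-+ k n m)
      (cong₂ (λ x y → (x + y) % m) (sym (toℕ-[] k)) (sym (toℕ-[] n))))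

    []-* : ∀ k n → [ k * n ] ≡ [ k ] ⊗ [ n ]
    []-* k n = []-cong-% (trans (%-distribˡ-* k n m)
      (cong₂ (λ x y → (x * y) % m) (sym (toℕ-[] k)) (sym (toℕ-[] n))))

  [m]≡0 : [ m ] ≡ [ 0 ]
  [m]≡0 = []-cong-% (trans (n%n≡0 m) (sym (m<n⇒m%n≡m (ℕ.>-nonZero⁻¹ m))))

  private
    -- Every residue is the class of a natural number, so ring laws descend from ℕ.
    lift : ∀ {P : Fin m → Set} → (∀ n → P [ n ]) → ∀ i → P i
    lift {P} h i = subst P ([]-toℕ i) (h (toℕ i))

  ring : CommutativeRing 0ℓ 0ℓ
  ring = record
    { Carrier = Fin m ; _≈_ = _≡_ ; _+_ = _⊕_ ; _*_ = _⊗_ ; -_ = ⊝_ ; 0# = [ 0 ] ; 1# = [ 1 ]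
    ; isCommutativeRing = record
      { isRing = record
        { +-isAbelianGroup = record
          { isGroup = record
            { isMonoid = record
              { isSemigroup = record
                { isMagma = record { isEquivalence = isEquivalence ; ∙-cong = cong₂ _⊕_ }
                ; assoc = lift λ a → lift λ b → lift λ c →
                    trans (cong (_⊕ [ c ]) (sym ([]-+ a b))) (trans (sym ([]-+ (a + b) c)) (trans (cong [_] (ℕ.+-assoc a b c))
                    (trans ([]-+ a (b + c)) (cong (λ x → [ a ] ⊕ x) ([]-+ b c)))))
                }
              ; identity = (lift λ a → sym ([]-+ 0 a)) , (lift λ a → trans (sym ([]-+ a 0)) (cong [_] (ℕ.+-identityʳ a)))
              }
            ; inverse = (λ i → trans (+-comm (⊝ i) i) (inverseʳ i)) , inverseʳ
            ; ⁻¹-cong = cong ⊝_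
            }
          ; comm = +-comm
          }
        ; *-cong = cong₂ _⊗_
        ; *-assoc = lift λ a → lift λ b → lift λ c →
            trans (cong (_⊗ [ c ]) (sym ([]-* a b))) (trans (sym ([]-* (a * b) c)) (trans (cong [_] (ℕ.*-assoc a b c))
            (trans ([]-* a (b * c)) (cong ([ a ] ⊗_) ([]-* b c)))))
        ; *-identity = (lift λ a → trans (sym ([]-* 1 a)) (cong [_] (ℕ.*-identityˡ a)))
                     , (lift λ a → trans (sym ([]-* a 1)) (cong [_] (ℕ.*-identityʳ a)))
        ; distrib = distribˡ , λ i j k → trans (*-comm (j ⊕ k) i) (trans (distribˡ i j k) (cong₂ _⊕_ (*-comm i j) (*-comm i k)))
        }
      ; *-comm = *-comm
      }
    }
    where
    +-comm : ∀ i j → i ⊕ j ≡ j ⊕ i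
    +-comm = lift λ a → lift λ b → trans (sym ([]-+ a b)) (trans (cong [_] (ℕ.+-comm a b)) ([]-+ b a))
    *-comm : ∀ i j → i ⊗ j ≡ j ⊗ i
    *-comm = lift λ a → lift λ b → trans (sym ([]-* a b)) (trans (cong [_] (ℕ.*-comm a b)) ([]-* b a))
    distribˡ : ∀ i j k → i ⊗ (j ⊕ k) ≡ i ⊗ j ⊕ i ⊗ k
    distribˡ = lift λ a → lift λ b → lift λ c →
      trans (cong ([ a ] ⊗_) (sym ([]-+ b c))) (trans (sym ([]-* a (b + c))) (trans (cong [_] (ℕ.*-distribˡ-+ a b c))
      (trans ([]-+ (a * b) (a * c)) (cong₂ _⊕_ ([]-* a b) ([]-* a c)))))
    inverseʳ : ∀ i → i ⊕ ⊝ i ≡ [ 0 ]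
    inverseʳ i = begin
      i ⊕ ⊝ i                        ≡⟨ cong₂ _⊕_ (sym ([]-toℕ i)) (neg-def i) ⟩
      [ toℕ i ] ⊕ [ m ∸ toℕ i ]      ≡⟨ []-+ (toℕ i) (m ∸ toℕ i) ⟨
      [ toℕ i + (m ∸ toℕ i) ]      ≡⟨ cong [_] (ℕ.m+[n∸m]≡n (ℕ.<⇒≤ (Fin.toℕ<n i))) ⟩
      [ m ]                          ≡⟨ [m]≡0 ⟩
      [ 0 ]                          ∎
      where open ≡-Reasoning

  additive : FiniteGroup (Fin m)
  additive = record
    { finite = finite-Fin m ; _∙_ = _⊕_ ; ε = [ 0 ] ; _⁻¹ = ⊝_ ; isGroup = CommutativeRing.+-isGroup ring }

-- The field with p elements

iter : {Y : Set} → ℕ → (Y → Y) → Y → Y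
iter zero    f y = y
iter (suc k) f y = f (iter k f y)

iter-+ : ∀ {Y : Set} j k (f : Y → Y) y → iter (j + k) f y ≡ iter j f (iter k f y)
iter-+ zero    k f y = refl
iter-+ (suc j) k f y = cong f (iter-+ j k f y)

module _ {Y : Set} (d : ℕ) .{{_ : NonZero d}} (f : Y → Y) (periodic : ∀ y → iter d f y ≡ y) where

  private
    iter-multiple : ∀ k y → iter (k * d) f y ≡ y
    iter-multiple zero    y = refl
    iter-multiple (suc k) y = trans (iter-+ d (k * d) f y) (trans (periodic _) (iter-multiple k y))

  iter-% : ∀ k y → iter (k % d) f y ≡ iter k f y
  iter-% k y = sym (trans (cong (λ n → iter n f y) (m≡m%n+[m/n]*n k d))
    (trans (iter-+ (k % d) (k / d * d) f y) (cong (iter (k % d) f) (iter-multiple (k / d) y))))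

  open ℤ/ d

  -- A map with trivial d-th iterate is an action of ℤ/d. The construction serves twice: for
  -- multiplication by a unit of order d, and for the cycles of an affine map.
  cyclic-action : Action additive Y
  cyclic-action = record
    { act   = λ k → iter (toℕ k) f
    ; act-ε = λ y → trans (cong (λ n → iter n f y) (toℕ-[] 0)) (iter-% 0 y)
    ; act-∙ = λ j k y → trans (cong (λ n → iter n f y) (trans (cong toℕ (+-def j k)) (toℕ-[] (toℕ j + toℕ k))))
        (trans (iter-% (toℕ j + toℕ k) y) (iter-+ (toℕ j) (toℕ k) f y))
    }

-- The index `k` stands for the residue `suc k` among 1, ..., d, as in `totient`; in particular d =
-- 1 has one residue.
CoprimeResidue : ℕ → Set
CoprimeResidue d = Sub (λ (k : Fin d) → coprime? (suc (toℕ k)) d)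

finite-CoprimeResidue : ∀ d → Finite (CoprimeResidue d)
finite-CoprimeResidue d = finite-Sub (finite-Fin d) (λ k → coprime? (suc (toℕ k)) d)

module Field (p : ℕ) .{{p≢0 : NonZero p}} (p-prime : Prime p) where

  open ℤ/ p public
  open CommutativeRing ring public
    using (+-comm; +-assoc; *-comm; *-assoc; +-identityˡ; +-identityʳ; *-identityˡ; *-identityʳ; -‿inverseˡ; -‿inverseʳ; zeroˡ; zeroʳ; distribˡ; distribʳ)
  open IntegerCoefficients ring public

  F : Set
  F = Fin p

  0F 1F : F
  0F = [ 0 ]
  1F = [ 1 ]

  private
    []≡0⇒∣ : ∀ n → [ n ] ≡ 0F → p ∣ n
    []≡0⇒∣ n eq = m%n≡0⇒n∣m n p (trans (sym (toℕ-[] n)) (trans (cong toℕ eq)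
      (trans (toℕ-[] 0) (m<n⇒m%n≡m (ℕ.>-nonZero⁻¹ p)))))

    ∣⇒[]≡0 : ∀ n → p ∣ n → [ n ] ≡ 0F
    ∣⇒[]≡0 n p∣n = []-cong-% (trans (n∣m⇒m%n≡0 n p p∣n) (sym (m<n⇒m%n≡m (ℕ.>-nonZero⁻¹ p))))

  1≢0 : 1F ≢ 0F
  1≢0 eq = ℕ.n≮n 1 (subst (1 <_) (∣1⇒≡1 ([]≡0⇒∣ 1 eq)) (ℕ.nonTrivial⇒n>1 p {{prime⇒nonTrivial p-prime}}))

  integral : ∀ i j → i ⊗ j ≡ 0F → i ≡ 0F ⊎ j ≡ 0F
  integral i j eq with euclidsLemma (toℕ i) (toℕ j) p-prime ([]≡0⇒∣ _ (trans ([]-* _ _) (trans (cong₂ _⊗_ ([]-toℕ i) ([]-toℕ j)) eq)))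
  ... | inj₁ p∣i = inj₁ (trans (sym ([]-toℕ i)) (∣⇒[]≡0 _ p∣i))
  ... | inj₂ p∣j = inj₂ (trans (sym ([]-toℕ j)) (∣⇒[]≡0 _ p∣j))

  ⊗-cancelˡ : ∀ {u i j} → u ≢ 0F → u ⊗ i ≡ u ⊗ j → i ≡ j
  ⊗-cancelˡ {u} {i} {j} u≢0 eq = [ (λ u≡0 → ⊥-elim (u≢0 u≡0)) , difference≡0 ]′ (integral u (i ⊕ ⊝ j) product≡0)
    where
    product≡0 : u ⊗ (i ⊕ ⊝ j) ≡ 0F
    product≡0 = trans (solve 3 (λ u i j → u :* (i :+ :- j) := u :* i :+ :- (u :* j)) refl u i j)
      (trans (cong (λ x → x ⊕ ⊝ (u ⊗ j)) eq) (-‿inverseʳ (u ⊗ j)))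
    difference≡0 : i ⊕ ⊝ j ≡ 0F → i ≡ j
    difference≡0 h = trans (solve 2 (λ i j → i := (i :+ :- j) :+ j) refl i j) (trans (cong (_⊕ j) h) (+-identityˡ j))

  Unit : Set
  Unit = Sub (λ u → ¬? (u Fin.≟ 0F))

  finite-Unit : Finite Unit
  finite-Unit = finite-Sub (finite-Fin p) (λ u → ¬? (u Fin.≟ 0F))

  suc-size-Unit : suc (size finite-Unit) ≡ p
  suc-size-Unit = trans (sym (size-⊎ finite-⊤ finite-Unit))
    (size-≡ (finite-⊎ finite-⊤ finite-Unit) (finite-Fin p) to from from-to to-from)
    where
    to : ⊤ ⊎ Unit → F
    to (inj₁ _) = 0F
    to (inj₂ u) = val u
    from : F → ⊤ ⊎ Unit
    from u with u Fin.≟ 0F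
    ... | yes _   = inj₁ tt
    ... | no  u≢0 = inj₂ (sub u u≢0)
    from-to : ∀ x → from (to x) ≡ x
    from-to (inj₁ _) with 0F Fin.≟ 0F
    ... | yes _   = refl
    ... | no  0≢0 = ⊥-elim (0≢0 refl)
    from-to (inj₂ u) with val u Fin.≟ 0F
    ... | yes u≡0 = ⊥-elim (holds u u≡0)
    ... | no  _   = cong inj₂ (Sub-≡ refl)
    to-from : ∀ x → to (from x) ≡ x
    to-from x with x Fin.≟ 0F
    ... | yes x≡0 = sym x≡0
    ... | no  _   = refl

  private
    -- Multiplication by a unit is injective on a finite set, hence takes the value `1F`.
    inverse : ∀ (u : Unit) → ∃ λ j → val u ⊗ j ≡ 1F
    inverse u = injective⇒surjective (finite-Fin p) (finite-Fin p) (val u ⊗_) (⊗-cancelˡ (holds u)) ℕ.≤-refl 1F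

  infixl 7 _·_
  infix  8 _⁻¹

  _·_ : Unit → Unit → Unit
  u · w = sub (val u ⊗ val w) λ eq → [ holds u , holds w ]′ (integral (val u) (val w) eq)

  one : Unit
  one = sub 1F 1≢0

  _⁻¹ : Unit → Unit
  u ⁻¹ = sub (proj₁ (inverse u)) λ eq →
    1≢0 (trans (sym (proj₂ (inverse u))) (trans (cong (val u ⊗_) eq) (zeroʳ (val u))))

  ⊗-inverseʳ : ∀ u → val u ⊗ val (u ⁻¹) ≡ 1F
  ⊗-inverseʳ u = proj₂ (inverse u)

  ⊗-inverseˡ : ∀ u → val (u ⁻¹) ⊗ val u ≡ 1F
  ⊗-inverseˡ u = trans (*-comm _ _) (⊗-inverseʳ u)

  open import Algebra.Properties.CommutativeSemiring.Exp (CommutativeRing.commutativeSemiring ring) public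
    renaming (_^_ to _↑_) using (^-homo-*; ^-assocʳ)

  1^ : ∀ n → 1F ↑ n ≡ 1F
  1^ zero    = refl
  1^ (suc n) = trans (*-identityˡ _) (1^ n)

  -- The vector holds the coefficients below the leading one, which is 1, constant term first.
  eval : ∀ {d} → Vec F d → F → F
  eval []       x = 1F
  eval (c ∷ cs) x = c ⊕ x ⊗ eval cs x

  -- Synthetic division by X - r: the coefficients of the quotient are the values of the successive
  -- tails at `r`. The quotient is monic again, so the representation is closed under it.
  deflate : ∀ {d} → Vec F (suc d) → F → Vec F d
  deflate (c ∷ [])         r = []
  deflate (c ∷ cs@(_ ∷ _)) r = eval cs r ∷ deflate cs r

  eval-deflate : ∀ {d} (cs : Vec F (suc d)) r x → eval cs x ≡ (x ⊕ ⊝ r) ⊗ eval (deflate cs r) x ⊕ eval cs r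
  eval-deflate (c ∷ []) r x =
    solve 4 (λ c r x o → c :+ x :* o := (x :+ :- r) :* o :+ (c :+ r :* o)) refl c r x 1F
  eval-deflate (c ∷ cs@(_ ∷ _)) r x = trans (cong (λ y → c ⊕ x ⊗ y) (eval-deflate cs r x))
    (solve 5 (λ c r x q e → c :+ x :* ((x :+ :- r) :* q :+ e) := (x :+ :- r) :* (e :+ x :* q) :+ (c :+ r :* e)) refl
      c r x (eval (deflate cs r) x) (eval cs r))

  -- Divide off the root `ρ zero`: since `F` has no zero divisors, the other roots are roots of the
  -- quotient. In degree 0 the polynomial is 1 and has none.
  root-bound : ∀ {d k} (cs : Vec F d) (ρ : Fin k → F) → (∀ {i j} → ρ i ≡ ρ j → i ≡ j) →
    (∀ i → eval cs (ρ i) ≡ 0F) → k ≤ d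
  root-bound {k = zero} _ ρ inj root = z≤n
  root-bound {k = suc k} [] ρ inj root = ⊥-elim (1≢0 (root zero))
  root-bound {k = suc k} cs@(_ ∷ _) ρ inj root =
    s≤s (root-bound (deflate cs r) (ρ ∘ suc) (Fin.suc-injective ∘ inj) root′)
    where
    r = ρ zero
    root′ : ∀ i → eval (deflate cs r) (ρ (suc i)) ≡ 0F
    root′ i = [ (λ eq → ⊥-elim (Fin.0≢1+n (inj (sym (trans (solve 2 (λ x r → x := (x :+ :- r) :+ r) refl (ρ (suc i)) r)
                   (trans (cong (_⊕ r) eq) (+-identityˡ r))))))) , id ]′
      (integral _ _ (begin
        (x ⊕ ⊝ r) ⊗ q             ≡⟨ +-identityʳ _ ⟨
        (x ⊕ ⊝ r) ⊗ q ⊕ 0F        ≡⟨ cong (((x ⊕ ⊝ r) ⊗ q) ⊕_) (root zero) ⟨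
        (x ⊕ ⊝ r) ⊗ q ⊕ eval cs r ≡⟨ eval-deflate cs r x ⟨
        eval cs x                 ≡⟨ root (suc i) ⟩
        0F                        ∎))
      where
      open ≡-Reasoning
      x = ρ (suc i)
      q = eval (deflate cs r) x

  -- Roots of unity and orders of units.

  RootOfUnity : ℕ → Set
  RootOfUnity d = Sub (λ x → (x ↑ d) Fin.≟ 1F)

  finite-RootOfUnity : ∀ d → Finite (RootOfUnity d)
  finite-RootOfUnity d = finite-Sub (finite-Fin p) (λ x → (x ↑ d) Fin.≟ 1F)

  roots-of-unity-≤ : ∀ d → size (finite-RootOfUnity (suc d)) ≤ suc d
  -- With its implicit leading 1, this vector is the polynomial X^(d + 1) - 1.
  roots-of-unity-≤ d = root-bound (⊝ 1F ∷ zeros d) (val ∘ elem fR)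
    (λ eq → trans (sym (index-elem fR _)) (trans (cong (index fR) (Sub-≡ eq)) (index-elem fR _)))
    (λ i → trans (cong (λ y → ⊝ 1F ⊕ val (elem fR i) ⊗ y) (eval-zeros d (val (elem fR i))))
      (trans (cong (⊝ 1F ⊕_) (holds (elem fR i))) (-‿inverseˡ 1F)))
    where
    fR = finite-RootOfUnity (suc d)
    zeros : ∀ n → Vec F n
    zeros zero    = []
    zeros (suc n) = 0F ∷ zeros n
    eval-zeros : ∀ n x → eval (zeros n) x ≡ x ↑ n
    eval-zeros zero    x = refl
    eval-zeros (suc n) x = trans (+-identityˡ _) (cong (x ⊗_) (eval-zeros n x))

  ^-nonzero : ∀ (u : Unit) k → val u ↑ k ≢ 0F
  ^-nonzero u zero    = 1≢0
  ^-nonzero u (suc k) eq = [ holds u , ^-nonzero u k ]′ (integral _ _ eq)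

  ^-cancel : ∀ (u : Unit) {i j} → i ≤ j → val u ↑ i ≡ val u ↑ j → val u ↑ (j ∸ i) ≡ 1F
  ^-cancel u {i} {j} i≤j eq = ⊗-cancelˡ (^-nonzero u i) (begin
    val u ↑ i ⊗ val u ↑ (j ∸ i)    ≡⟨ ^-homo-* (val u) i (j ∸ i) ⟨
    val u ↑ (i + (j ∸ i))        ≡⟨ cong (val u ↑_) (ℕ.m+[n∸m]≡n i≤j) ⟩
    val u ↑ j                      ≡⟨ eq ⟨
    val u ↑ i                      ≡⟨ *-identityʳ _ ⟨
    val u ↑ i ⊗ 1F                 ∎)
    where open ≡-Reasoning

  private
    -- Two of the p + 1 powers with exponents 0, ..., p coincide; the difference of their exponents
    -- lies between 1 and p.
    some-order : ∀ u → ∃ λ (k : Fin p) → val u ↑ suc (toℕ k) ≡ 1F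
    some-order u with Fin.pigeonhole (ℕ.n<1+n p) (λ (k : Fin (suc p)) → val u ↑ toℕ k)
    ... | i , j , i<j , eq = fromℕ< k<p , trans (cong (λ n → val u ↑ suc n) (Fin.toℕ-fromℕ< k<p))
            (trans (cong (val u ↑_) 1+k) (^-cancel u (ℕ.<⇒≤ i<j) eq))
      where
      k = toℕ j ∸ suc (toℕ i)
      1+k : suc k ≡ toℕ j ∸ toℕ i
      1+k = sym (ℕ.+-∸-assoc 1 i<j)
      k<p : k < p
      k<p = subst (_≤ p) (sym 1+k) (ℕ.≤-trans (ℕ.m∸n≤m (toℕ j) (toℕ i)) (ℕ.s≤s⁻¹ (Fin.toℕ<n j)))

    least-order : ∀ u → _
    least-order u = least (λ k → val u ↑ suc (toℕ k) Fin.≟ 1F) (some-order u)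

  abstract
    pred-ord : Unit → ℕ
    pred-ord u = toℕ (proj₁ (least-order u))

    ord : Unit → ℕ
    ord u = suc (pred-ord u)

    ord-suc : ∀ u → ord u ≡ suc (pred-ord u)
    ord-suc u = refl

    ^-ord : ∀ u → val u ↑ ord u ≡ 1F
    ^-ord u = proj₁ (proj₂ (least-order u))

    ord-minimal : ∀ u k → suc k < ord u → val u ↑ suc k ≢ 1F
    ord-minimal u k (s≤s k<o) eq = proj₂ (proj₂ (least-order u)) (fromℕ< k<p)
      (subst (_< pred-ord u) (sym (Fin.toℕ-fromℕ< k<p)) k<o)
      (trans (cong (λ n → val u ↑ suc n) (Fin.toℕ-fromℕ< k<p)) eq)
      where
      k<p : k < p
      k<p = ℕ.<-trans k<o (Fin.toℕ<n (proj₁ (least-order u)))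

  instance
    ord-nonZero : ∀ {u} → NonZero (ord u)
    ord-nonZero {u} = subst NonZero (sym (ord-suc u)) _

  ord-minimal′ : ∀ u {k} → k < ord u → val u ↑ k ≡ 1F → k ≡ 0
  ord-minimal′ u {zero}  _   _  = refl
  ord-minimal′ u {suc k} k<o eq = ⊥-elim (ord-minimal u k k<o eq)

  ^-% : ∀ u k → val u ↑ (k % ord u) ≡ val u ↑ k
  ^-% u k = sym (begin
    x ↑ k                                  ≡⟨ cong (x ↑_) (m≡m%n+[m/n]*n k d) ⟩
    x ↑ (k % d + k / d * d)            ≡⟨ ^-homo-* x (k % d) (k / d * d) ⟩
    x ↑ (k % d) ⊗ x ↑ (k / d * d)        ≡⟨ cong (x ↑ (k % d) ⊗_) (trans (cong (x ↑_) (ℕ.*-comm (k / d) d)) (trans (sym (^-assocʳ x d (k / d))) (trans (cong (_↑ (k / d)) (^-ord u)) (1^ (k / d))))) ⟩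
    x ↑ (k % d) ⊗ 1F                       ≡⟨ *-identityʳ _ ⟩
    x ↑ (k % d)                            ∎)
    where
    open ≡-Reasoning
    x = val u
    d = ord u

  ord-divides : ∀ u {k} → val u ↑ k ≡ 1F → ord u ∣ k
  ord-divides u {k} eq = m%n≡0⇒n∣m k (ord u) (ord-minimal′ u (m%n<n k (ord u)) (trans (^-% u k) eq))

  ^-injective : ∀ u {i j} → i < ord u → j < ord u → val u ↑ i ≡ val u ↑ j → i ≡ j
  ^-injective u {i} {j} i<o j<o eq with ℕ.≤-total i j
  ... | inj₁ i≤j = ℕ.≤-antisym i≤j (ℕ.m∸n≡0⇒m≤n (ord-minimal′ u (ℕ.≤-<-trans (ℕ.m∸n≤m j i) j<o) (^-cancel u i≤j eq)))
  ... | inj₂ j≤i = ℕ.≤-antisym (ℕ.m∸n≡0⇒m≤n (ord-minimal′ u (ℕ.≤-<-trans (ℕ.m∸n≤m i j) i<o) (^-cancel u j≤i (sym eq)))) j≤i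

  -- Lagrange's theorem for the subgroup generated by `u`, which acts freely on the units by
  -- multiplication.
  ord∣size-Unit : ∀ u → ord u ∣ size finite-Unit
  ord∣size-Unit u = divides (size (Orbits.finite-Orbit finite-Unit multiplication)) (trans (Orbits.free-size finite-Unit multiplication free) (ℕ.*-comm (ord u) _))
    where
    iter-· : ∀ k w → val (iter k (u ·_) w) ≡ val u ↑ k ⊗ val w
    iter-· zero    w = sym (*-identityˡ (val w))
    iter-· (suc k) w = trans (cong (val u ⊗_) (iter-· k w)) (sym (*-assoc (val u) (val u ↑ k) (val w)))
    multiplication : Action (ℤ/.additive (ord u)) Unit
    multiplication = cyclic-action (ord u) (u ·_)
      λ w → Sub-≡ (trans (iter-· (ord u) w) (trans (cong (_⊗ val w) (^-ord u)) (*-identityˡ (val w))))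
    free : ∀ k w → iter (toℕ k) (u ·_) w ≡ w → k ≡ ℤ/.[_] (ord u) 0
    free k w eq = Fin.toℕ-injective (trans
      (ord-minimal′ u (Fin.toℕ<n k) (⊗-cancelˡ (holds w) (begin
        val w ⊗ val u ↑ toℕ k         ≡⟨ *-comm _ _ ⟩
        val u ↑ toℕ k ⊗ val w         ≡⟨ iter-· (toℕ k) w ⟨
        val (iter (toℕ k) (u ·_) w)   ≡⟨ cong val eq ⟩
        val w                         ≡⟨ *-identityʳ (val w) ⟨
        val w ⊗ 1F                    ∎)))
      (sym (trans (ℤ/.toℕ-[] (ord u) 0) (m<n⇒m%n≡m (ℕ.>-nonZero⁻¹ (ord u))))))
      where open ≡-Reasoning

  -- With d the order of `u`, the powers of `u` are d distinct roots of X^d - 1, which has at most d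
  -- of them.
  root⇒power : ∀ u x → x ↑ ord u ≡ 1F → ∃ λ (k : Fin (ord u)) → x ≡ val u ↑ suc (toℕ k)
  root⇒power u x x^d≡1 = proj₁ preimage , sym (cong val (proj₂ preimage))
    where
    power : Fin (ord u) → RootOfUnity (ord u)
    power k = sub (val u ↑ suc (toℕ k)) (begin
      (val u ↑ suc (toℕ k)) ↑ ord u      ≡⟨ ^-assocʳ (val u) (suc (toℕ k)) (ord u) ⟩
      val u ↑ (suc (toℕ k) * ord u)    ≡⟨ cong (val u ↑_) (ℕ.*-comm (suc (toℕ k)) (ord u)) ⟩
      val u ↑ (ord u * suc (toℕ k))    ≡⟨ ^-assocʳ (val u) (ord u) (suc (toℕ k)) ⟨
      (val u ↑ ord u) ↑ suc (toℕ k)      ≡⟨ cong (_↑ suc (toℕ k)) (^-ord u) ⟩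
      1F ↑ suc (toℕ k)                   ≡⟨ 1^ (suc (toℕ k)) ⟩
      1F                                 ∎)
      where open ≡-Reasoning
    power-inj : ∀ {i j} → power i ≡ power j → i ≡ j
    power-inj {i} {j} eq = Fin.toℕ-injective (^-injective u (Fin.toℕ<n i) (Fin.toℕ<n j) (⊗-cancelˡ (holds u) (cong val eq)))
    bound : size (finite-RootOfUnity (ord u)) ≤ ord u
    bound = subst (λ d → size (finite-RootOfUnity d) ≤ d) (sym (ord-suc u)) (roots-of-unity-≤ (pred-ord u))
    preimage : ∃ λ k → power k ≡ sub x x^d≡1
    preimage = injective⇒surjective (finite-Fin (ord u)) (finite-RootOfUnity (ord u)) power power-inj bound (sub x x^d≡1)

  OfOrder : ℕ → Set
  OfOrder d = Sub (λ u → ord u ℕ.≟ d)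

  finite-OfOrder : ∀ d → Finite (OfOrder d)
  finite-OfOrder d = finite-Sub finite-Unit (λ u → ord u ℕ.≟ d)

  -- Let d be the common order. If g divides `k` and d, then x^(d/g) is a power of u^d and so equals
  -- 1; hence d divides d/g, which forces g = 1.
  order-of-power⇒coprime : ∀ u x k → val x ≡ val u ↑ k → ord x ≡ ord u → Coprime k (ord u)
  order-of-power⇒coprime u x k x≡u^k same {g} (divides a k≡a*g , divides b d≡b*g) = ∣1⇒≡1 (*-cancelʳ-∣ b {{b≢0}} (subst (g * b ∣_) (sym (ℕ.*-identityˡ b)) g*b∣b))
    where
    open ≡-Reasoning
    b≢0 : NonZero b
    b≢0 = ℕ.m*n≢0⇒m≢0 b {{subst NonZero d≡b*g ord-nonZero}}
    x^b≡1 : val x ↑ b ≡ 1F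
    x^b≡1 = begin
      val x ↑ b                    ≡⟨ cong (_↑ b) x≡u^k ⟩
      (val u ↑ k) ↑ b              ≡⟨ ^-assocʳ (val u) k b ⟩
      val u ↑ (k * b)            ≡⟨ cong (val u ↑_) (trans (cong (_* b) k≡a*g) (trans (ℕ.*-assoc a g b) (trans (cong (a *_) (trans (ℕ.*-comm g b) (sym d≡b*g))) (ℕ.*-comm a (ord u))))) ⟩
      val u ↑ (ord u * a)        ≡⟨ ^-assocʳ (val u) (ord u) a ⟨
      (val u ↑ ord u) ↑ a          ≡⟨ cong (_↑ a) (^-ord u) ⟩
      1F ↑ a                       ≡⟨ 1^ a ⟩
      1F                           ∎
    g*b∣b : g * b ∣ b
    g*b∣b = subst (_∣ b) (trans same (trans d≡b*g (ℕ.*-comm b g))) (ord-divides x x^b≡1)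

  -- Once there is one unit of order `d`, all others are its powers, with exponents coprime to `d`.
  -- Whether there is one stays open here; summation over all `d` will decide it.
  ofOrder-≤-coprime : ∀ d → size (finite-OfOrder d) ≤ size (finite-CoprimeResidue d)
  ofOrder-≤-coprime d with exists? finite-Unit (λ u → ord u ℕ.≟ d)
  ... | no none = size-≤ (finite-OfOrder d) (finite-CoprimeResidue d) (λ x → ⊥-elim (none (val x , holds x))) (λ {x} → ⊥-elim (none (val x , holds x)))
  ... | yes (u , refl) = size-≤ (finite-OfOrder d) (finite-CoprimeResidue d)
    (λ x → sub (exponent x) (order-of-power⇒coprime u (val x) _ (is-power x) (holds x)))
    (λ {x} {y} eq → Sub-≡ (Sub-≡ (trans (is-power x) (trans (cong (λ k → val u ↑ suc (toℕ k)) (cong val eq)) (sym (is-power y))))))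
    where
    exponent : OfOrder d → Fin d
    exponent x = proj₁ (root⇒power u (val (val x)) (trans (cong (val (val x) ↑_) (sym (holds x))) (^-ord (val x))))
    is-power : ∀ x → val (val x) ≡ val u ↑ suc (toℕ (exponent x))
    is-power x = proj₂ (root⇒power u (val (val x)) (trans (cong (val (val x) ↑_) (sym (holds x))) (^-ord (val x))))

-- Elements of given order

sum-map-upTo : ∀ (f : ℕ → ℕ) g n → List.sum (map f (applyUpTo g n)) ≡ sum (λ (i : Fin n) → f (g (toℕ i)))
sum-map-upTo f g zero    = refl
sum-map-upTo f g (suc n) = cong (f (g 0) +_) (sum-map-upTo f (g ∘ suc) n)

length-filter-upTo : ∀ {P : ℕ → Set} (P? : ∀ k → Dec (P k)) g n →
  length (filter P? (applyUpTo g n)) ≡ sum (λ (i : Fin n) → size (finite-T ⌊ P? (g (toℕ i)) ⌋))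
length-filter-upTo P? g zero    = refl
length-filter-upTo P? g (suc n) with P? (g 0)
... | yes _ = cong suc (length-filter-upTo P? (g ∘ suc) n)
... | no  _ = length-filter-upTo P? (g ∘ suc) n

totient-size : ∀ d → totient d ≡ size (finite-CoprimeResidue d)
totient-size d = trans (length-filter-upTo (λ k → coprime? (suc k) d) id d)
  (sym (size-Sub (finite-Fin d) (λ k → coprime? (suc (toℕ k)) d)))

-- As q = n/d and q′ = n/d′, the last hypothesis says a/d = a′/d′. After cross multiplication,
-- coprimality makes each denominator divide the other.
reduced-fraction-unique : ∀ {a d q a′ d′ q′ n} .{{_ : NonZero n}} → n ≡ q * d → n ≡ q′ * d′ →
  Coprime a d → Coprime a′ d′ → a * q ≡ a′ * q′ → d ≡ d′
reduced-fraction-unique {a} {d} {q} {a′} {d′} {q′} {n} n≡qd n≡q′d′ a⊥d a′⊥d′ eq =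
  ∣-antisym (coprime-divisor (Coprimality.sym a⊥d) (divides a′ cross)) (coprime-divisor (Coprimality.sym a′⊥d′) (divides a (sym cross)))
  where
  open ≡-Reasoning
  cross : a * d′ ≡ a′ * d
  cross = ℕ.*-cancelʳ-≡ _ _ n (begin
    a * d′ * n            ≡⟨ cong (a * d′ *_) n≡qd ⟩
    a * d′ * (q * d)      ≡⟨ ℕ.[m*n]*[o*p]≡[m*o]*[n*p] a d′ q d ⟩
    a * q * (d′ * d)      ≡⟨ cong₂ _*_ eq (ℕ.*-comm d′ d) ⟩
    a′ * q′ * (d * d′)    ≡⟨ ℕ.[m*n]*[o*p]≡[m*o]*[n*p] a′ q′ d d′ ⟩
    a′ * d * (q′ * d′)    ≡⟨ cong (a′ * d *_) n≡q′d′ ⟨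
    a′ * d * n            ∎)

-- The indicator of divisibility, given as a size so that multiplying by it counts pairs.
dividing : ℕ → ℕ → ℕ
dividing n d = size (finite-T ⌊ d ∣? n ⌋)

-- Distinct pairs (d, a) with d ∣ n and a ⊥ d give distinct fractions a/d = (a n/d)/n in (0, 1].
sum-totient-≤ : ∀ n .{{_ : NonZero n}} → sum (λ (i : Fin n) → dividing n (suc (toℕ i)) * totient (suc (toℕ i))) ≤ n
sum-totient-≤ n {{n≢0}} = ℕ.≤-trans (ℕ.≤-reflexive (trans (sum-cong-≗ {n} {y = size ∘ finite-Fraction} λ i → trans
      (cong (dividing n (suc (toℕ i)) *_) (totient-size (suc (toℕ i))))
      (sym (size-× (finite-T ⌊ suc (toℕ i) ∣? n ⌋) (finite-CoprimeResidue (suc (toℕ i))))))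
    (sym (size-Σ (finite-Fin n) finite-Fraction))))
  (size-≤ (finite-Σ (finite-Fin n) finite-Fraction) (finite-Fin n) to to-inj)
  where
  Fraction : Fin n → Set
  Fraction i = True (suc (toℕ i) ∣? n) × CoprimeResidue (suc (toℕ i))
  finite-Fraction : ∀ i → Finite (Fraction i)
  finite-Fraction i = finite-× (finite-T ⌊ suc (toℕ i) ∣? n ⌋) (finite-CoprimeResidue (suc (toℕ i)))
  codivisor : ∀ {i} → Fraction i → ℕ
  codivisor (d∣n , _) = quotient (toWitness d∣n)
  codivisor-eq : ∀ {i} (x : Fraction i) → n ≡ codivisor x * suc (toℕ i)
  codivisor-eq (d∣n , _) = _∣_.equality (toWitness d∣n)
  numerator : ∀ {i} → Fraction i → ℕ
  numerator (_ , a) = suc (toℕ (val a))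
  instance
    codivisor-nonZero : ∀ {i} {x : Fraction i} → NonZero (codivisor x)
    codivisor-nonZero {i} {x} = ℕ.m*n≢0⇒m≢0 (codivisor x) {{subst NonZero (codivisor-eq x) n≢0}}
  product≢0 : ∀ {i} (x : Fraction i) → NonZero (numerator x * codivisor x)
  product≢0 x = ℕ.m*n≢0 (numerator x) (codivisor x) {{_}} {{codivisor-nonZero {x = x}}}
  -- Over the common denominator `n` the numerators lie in 1, ..., n; the predecessor moves them
  -- into `Fin n`.
  to<n : ∀ {i} (x : Fraction i) → ℕ.pred (numerator x * codivisor x) < n
  to<n {i} x = ℕ.≤-trans (ℕ.≤-reflexive (ℕ.suc-pred (numerator x * codivisor x) {{product≢0 x}}))
    (ℕ.≤-trans (ℕ.*-monoˡ-≤ (codivisor x) (Fin.toℕ<n (val (proj₂ x))))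
      (ℕ.≤-reflexive (trans (ℕ.*-comm (suc (toℕ i)) (codivisor x)) (sym (codivisor-eq x)))))
  to : Σ (Fin n) Fraction → Fin n
  to (i , x) = fromℕ< (to<n x)
  same-numerator : ∀ {i} (x y : Fraction i) → numerator x * codivisor x ≡ numerator y * codivisor y → x ≡ y
  same-numerator {i} x@(s , _) y@(t , _) eq = cong₂ _,_ (T-irrelevant s t)
    (Sub-≡ (Fin.toℕ-injective (ℕ.suc-injective (ℕ.*-cancelʳ-≡ (numerator x) (numerator y) (codivisor x) {{codivisor-nonZero {x = x}}}
      (trans eq (cong (numerator y *_) (sym same-codivisor)))))))
    where
    same-codivisor : codivisor x ≡ codivisor y
    same-codivisor = ℕ.*-cancelʳ-≡ (codivisor x) (codivisor y) (suc (toℕ i)) (trans (sym (codivisor-eq x)) (codivisor-eq y))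
  to-inj : ∀ {x y} → to x ≡ to y → x ≡ y
  to-inj {i , x} {j , y} eq = same-denominator (Fin.toℕ-injective (ℕ.suc-injective
      (reduced-fraction-unique (codivisor-eq x) (codivisor-eq y) (holds (proj₂ x)) (holds (proj₂ y)) same-value))) x y same-value
    where
    same-value : numerator x * codivisor x ≡ numerator y * codivisor y
    same-value = trans (sym (ℕ.suc-pred _ {{product≢0 x}})) (trans (cong suc (Fin.fromℕ<-injective _ _ (to<n x) (to<n y) eq)) (ℕ.suc-pred _ {{product≢0 y}}))
    same-denominator : ∀ {i j} → i ≡ j → (x : Fraction i) (y : Fraction j) →
      numerator x * codivisor x ≡ numerator y * codivisor y → _≡_ {A = Σ (Fin n) Fraction} (i , x) (j , y)
    same-denominator refl x y eq = cong (_ ,_) (same-numerator x y eq)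

module _ (p : ℕ) .{{p≢0 : NonZero p}} (p-prime : Prime p) where

  open Field p p-prime

  private
    n : ℕ
    n = size finite-Unit

    d : Fin n → ℕ
    d i = suc (toℕ i)

    instance
      n≢0 : NonZero n
      n≢0 = ℕ.>-nonZero (ℕ.≤-<-trans z≤n (Fin.toℕ<n (index finite-Unit one)))

    pred-ord<n : ∀ u → pred-ord u < n
    pred-ord<n u = subst (_≤ n) (ord-suc u) (∣⇒≤ (ord∣size-Unit u))

    class : Unit → Fin n
    class u = fromℕ< (pred-ord<n u)

    d-class : ∀ u → d (class u) ≡ ord u
    d-class u = trans (cong suc (Fin.toℕ-fromℕ< (pred-ord<n u))) (sym (ord-suc u))

    ψ : Fin n → ℕ
    ψ i = size (finite-Sub finite-Unit (λ u → class u Fin.≟ i))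

    ψ≤ : ∀ i → ψ i ≤ dividing n (d i) * totient (d i)
    ψ≤ i = by-cases (d i ∣? n)
      where
      Class : Set
      Class = Sub (λ u → class u Fin.≟ i)
      finite-Class : Finite Class
      finite-Class = finite-Sub finite-Unit (λ u → class u Fin.≟ i)
      ord≡d : (x : Class) → ord (val x) ≡ d i
      ord≡d x = trans (sym (d-class (val x))) (cong d (holds x))
      by-cases : (d∣n? : Dec (d i ∣ n)) → size finite-Class ≤ size (finite-T ⌊ d∣n? ⌋) * totient (d i)
      by-cases (yes _) = ℕ.≤-trans (size-≤ finite-Class (finite-OfOrder (d i)) (λ x → sub (val x) (ord≡d x)) (λ eq → Sub-≡ (cong val eq)))
        (ℕ.≤-trans (ofOrder-≤-coprime (d i)) (ℕ.≤-reflexive (trans (sym (totient-size (d i))) (sym (ℕ.+-identityʳ _)))))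
      by-cases (no d∤n) = size-≤ finite-Class (finite-Fin 0) (⊥-elim ∘ none) (λ {x} → ⊥-elim (none x))
        where
        none : ¬ Class
        none x = d∤n (subst (_∣ n) (ord≡d x) (ord∣size-Unit (val x)))

    sum-ψ : sum ψ ≡ n
    sum-ψ = trans (sum-cong-≗ {n} {y = λ i → ψ i * 1} λ i → sym (ℕ.*-identityʳ (ψ i))) (trans (sym (∑-fibres finite-Unit class (λ _ → 1)))
      (trans (sum-const n 1) (ℕ.*-identityʳ n)))

    -- The numbers `ψ i` add up to `n` and their upper bounds to at most `n`, so each bound is
    -- attained.
    ψ≡ : ∀ i → ψ i ≡ dividing n (d i) * totient (d i)
    ψ≡ = sum-≤-antisym ψ≤ (ℕ.≤-trans (sum-totient-≤ n) (ℕ.≤-reflexive (sym sum-ψ)))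

  -- Burnside's lemma yields a sum over units; collecting the Φ(d) units of each order d turns it
  -- into the divisor sum of the formula.
  ∑-over-orders : ∑ finite-Unit (λ u → 2 ^ ((2 * n) / ord u)) ≡ divisorTerm p
  ∑-over-orders = begin
    ∑ finite-Unit (λ u → 2 ^ ((2 * n) / ord u))                      ≡⟨ ∑-cong finite-Unit (λ u → cong (2 ^_) (/-congʳ {m = 2 * n} (sym (d-class u)))) ⟩
    ∑ finite-Unit (λ u → 2 ^ ((2 * n) / d (class u)))                ≡⟨ ∑-fibres finite-Unit class (λ i → 2 ^ ((2 * n) / d i)) ⟩
    sum (λ i → ψ i * 2 ^ ((2 * n) / d i))                            ≡⟨ sum-cong-≗ {n} term ⟩
    sum (λ (i : Fin n) → summand n (toℕ i))                            ≡⟨ sum-map-upTo (summand n) id n ⟨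
    List.sum (map (summand n) (upTo n))                                ≡⟨ cong (λ k → List.sum (map (summand k) (upTo k))) n≡p∸1 ⟩
    divisorTerm p                                                      ∎
    where
    open ≡-Reasoning
    summand : ℕ → ℕ → ℕ
    summand n k = if does (suc k ∣? n) then totient (suc k) * 2 ^ ((2 * n) / suc k) else 0
    n≡p∸1 : n ≡ p ∸ 1
    n≡p∸1 = cong (_∸ 1) suc-size-Unit
    term : ∀ i → ψ i * 2 ^ ((2 * n) / d i) ≡ summand n (toℕ i)
    term i = trans (cong (_* 2 ^ ((2 * n) / d i)) (ψ≡ i)) (by-cases (d i ∣? n))
      where
      by-cases : ∀ {A : Set} (A? : Dec A) → size (finite-T ⌊ A? ⌋) * totient (d i) * 2 ^ ((2 * n) / d i)
        ≡ (if does A? then totient (d i) * 2 ^ ((2 * n) / d i) else 0)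
      by-cases (yes _) = cong (_* 2 ^ ((2 * n) / d i)) (ℕ.+-identityʳ (totient (d i)))
      by-cases (no  _) = refl

-- Isomorphisms between Cayley digraphs of the dihedral group

module Dihedral (p : ℕ) .{{p≢0 : NonZero p}} (p-prime : Prime p) where

  open Field p p-prime

  D : Set
  D = Defs.D p

  finite-D : Finite D
  finite-D = finite-× (finite-Fin p) finite-Bool

  -- The value of `S` at h g⁻¹ in field operations. A reflection inverts rotations, so arcs within a
  -- layer depend on differences and arcs between layers on sums.
  arc : (D → Bool) → D → D → Bool
  arc S (i , false) (k , false) = S (k ⊕ ⊝ i , false)
  arc S (i , false) (k , true)  = S (k ⊕ i , true)
  arc S (i , true)  (k , false) = S (k ⊕ i , true)
  arc S (i , true)  (k , true)  = S (k ⊕ ⊝ i , false)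

  Arc≡arc : ∀ (S : Defs.ConnSet p) g h → Defs.Arc p S g h ≡ arc (proj₁ S) g h
  Arc≡arc (S , _) (i , false) (k , false) =
    cong (λ x → S (x , false)) (trans (sym (+-def k _)) (cong (k ⊕_) (sym (neg-def i))))
  Arc≡arc (S , _) (i , false) (k , true) = cong (λ x → S (x , true)) (begin
    [ toℕ k + (p ∸ toℕ [ p ∸ toℕ i ]) ]    ≡⟨ []-+ (toℕ k) _ ⟩
    [ toℕ k ] ⊕ [ p ∸ toℕ [ p ∸ toℕ i ] ]    ≡⟨ cong₂ _⊕_ ([]-toℕ k) (sym (neg-def _)) ⟩
    k ⊕ ⊝ [ p ∸ toℕ i ]                        ≡⟨ cong (λ x → k ⊕ ⊝ x) (sym (neg-def i)) ⟩
    k ⊕ ⊝ (⊝ i)                                  ≡⟨ solve 2 (λ k i → k :+ :- (:- i) := k :+ i) refl k i ⟩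
    k ⊕ i                                        ∎)
    where open ≡-Reasoning
  Arc≡arc (S , _) (i , true) (k , false) = cong (λ x → S (x , true)) (sym (+-def k i))
  Arc≡arc (S , _) (i , true) (k , true) = cong (λ x → S (x , false))
    (trans ([]-+ (toℕ k) _) (cong₂ _⊕_ ([]-toℕ k) (sym (neg-def i))))

  ⊝0≡0 : ⊝ 0F ≡ 0F
  ⊝0≡0 = trans (sym (+-identityˡ (⊝ 0F))) (-‿inverseʳ 0F)

  ⊝-injective : ∀ {a} → ⊝ a ≡ 0F → a ≡ 0F
  ⊝-injective {a} eq = trans (solve 1 (λ a → a := :- (:- a)) refl a) (trans (cong ⊝_ eq) ⊝0≡0)

  shift : F → F → D → D
  shift b c (i , false) = i ⊕ b , false
  shift b c (i , true)  = i ⊕ c , true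

  -- Right multiplication by τ^a, which leaves h g⁻¹ unchanged and is thus an automorphism of every
  -- Cayley digraph. Moving τ^a past σ gives the minus sign.
  rot : F → D → D
  rot a = shift a (⊝ a)

  shift-0 : ∀ x → shift 0F 0F x ≡ x
  shift-0 (i , false) = cong (_, false) (+-identityʳ i)
  shift-0 (i , true)  = cong (_, true) (+-identityʳ i)

  shift-+ : ∀ b c b′ c′ x → shift (b ⊕ b′) (c ⊕ c′) x ≡ shift b c (shift b′ c′ x)
  shift-+ b c b′ c′ (i , false) = cong (_, false) (solve 3 (λ i b b′ → i :+ (b :+ b′) := i :+ b′ :+ b) refl i b b′)
  shift-+ b c b′ c′ (i , true)  = cong (_, true) (solve 3 (λ i b b′ → i :+ (b :+ b′) := i :+ b′ :+ b) refl i c c′)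

  shift-comm : ∀ b c b′ c′ x → shift b c (shift b′ c′ x) ≡ shift b′ c′ (shift b c x)
  shift-comm b c b′ c′ x = trans (sym (shift-+ b c b′ c′ x))
    (trans (cong₂ (λ s t → shift s t x) (+-comm b b′) (+-comm c c′)) (shift-+ b′ c′ b c x))

  shift-inverse : ∀ b c x → shift (⊝ b) (⊝ c) (shift b c x) ≡ x
  shift-inverse b c x = trans (sym (shift-+ (⊝ b) (⊝ c) b c x))
    (trans (cong₂ (λ s t → shift s t x) (-‿inverseˡ b) (-‿inverseˡ c)) (shift-0 x))

  shift-injective : ∀ b c {x y} → shift b c x ≡ shift b c y → x ≡ y
  shift-injective b c {x} {y} eq = trans (sym (shift-inverse b c x)) (trans (cong (shift (⊝ b) (⊝ c)) eq) (shift-inverse b c y))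

  rot-+ : ∀ a a′ x → rot (a ⊕ a′) x ≡ rot a (rot a′ x)
  rot-+ a a′ x = trans (cong (λ y → shift (a ⊕ a′) y x) (solve 2 (λ a b → :- (a :+ b) := :- a :+ :- b) refl a a′))
    (shift-+ a (⊝ a) a′ (⊝ a′) x)

  rot-0 : ∀ x → rot 0F x ≡ x
  rot-0 x = trans (cong (λ y → shift 0F y x) ⊝0≡0) (shift-0 x)

  rot-inverse : ∀ a x → rot (⊝ a) (rot a x) ≡ x
  rot-inverse a x = trans (sym (rot-+ (⊝ a) a x)) (trans (cong (λ y → rot y x) (-‿inverseˡ a)) (rot-0 x))

  cancel-+ : ∀ {i b} → i ⊕ b ≡ i → b ≡ 0F
  cancel-+ {i} {b} eq = trans (solve 2 (λ i b → b := :- i :+ (i :+ b)) refl i b) (trans (cong (⊝ i ⊕_) eq) (-‿inverseˡ i))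

  rot-fixes : ∀ {a x} → rot a x ≡ x → a ≡ 0F
  rot-fixes {x = i , false} eq = cancel-+ (cong proj₁ eq)
  rot-fixes {x = i , true}  eq = ⊝-injective (cancel-+ (cong proj₁ eq))

  Preserves : (S T : D → Bool) → (D → D) → Set
  Preserves S T f = ∀ g h → arc S g h ≡ arc T (f g) (f h)

  Injective : (D → D) → Set
  Injective f = ∀ x y → f x ≡ f y → x ≡ y

  -- Injectivity already means bijectivity, `D` being finite.
  Iso : (S T : D → Bool) → (D → D) → Set
  Iso S T f = Injective f × Preserves S T f

  rot-preserves : ∀ S a → Preserves S S (rot a)
  rot-preserves S a (i , false) (k , false) = cong (λ x → S (x , false)) (solve 3 (λ a i k → k :+ :- i := k :+ a :+ :- (i :+ a)) refl a i k)
  rot-preserves S a (i , false) (k , true)  = cong (λ x → S (x , true)) (solve 3 (λ a i k → k :+ i := k :+ :- a :+ (i :+ a)) refl a i k)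
  rot-preserves S a (i , true)  (k , false) = cong (λ x → S (x , true)) (solve 3 (λ a i k → k :+ i := k :+ a :+ (i :+ :- a)) refl a i k)
  rot-preserves S a (i , true)  (k , true)  = cong (λ x → S (x , false)) (solve 3 (λ a i k → k :+ :- i := k :+ :- a :+ :- (i :+ :- a)) refl a i k)

  Constant : (D → Bool) → Set
  Constant S = ∀ i → S (i , true) ≡ S (0F , true)

  -- If all reflections or none lie in S, arcs between the layers do not depend on positions, and
  -- the layers may be translated independently.
  shift-preserves : ∀ {S} → Constant S → ∀ b c → Preserves S S (shift b c)
  shift-preserves {S} const b c (i , false) (k , false) = cong (λ x → S (x , false)) (solve 3 (λ a i k → k :+ :- i := k :+ a :+ :- (i :+ a)) refl b i k)
  shift-preserves {S} const b c (i , false) (k , true)  = trans (const _) (sym (const _))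
  shift-preserves {S} const b c (i , true)  (k , false) = trans (const _) (sym (const _))
  shift-preserves {S} const b c (i , true)  (k , true)  = cong (λ x → S (x , false)) (solve 3 (λ a i k → k :+ :- i := k :+ a :+ :- (i :+ a)) refl c i k)

  -- Slopes u, u′ and offsets v, w on the rotations and on the reflections; the flag records whether
  -- the layers are exchanged. Two slopes are allowed because for constant reflections they are
  -- independent.
  Params : Set
  Params = Unit × Unit × F × F × Bool

  finite-Params : Finite Params
  finite-Params = finite-× finite-Unit (finite-× finite-Unit (finite-× (finite-Fin p) (finite-× (finite-Fin p) finite-Bool)))

  layerMap : Params → D → D
  layerMap (u , u′ , v , w , l) (i , false) = val u ⊗ i ⊕ v , l
  layerMap (u , u′ , v , w , l) (i , true)  = val u′ ⊗ i ⊕ w , not l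

  Layered : (D → D) → Set
  Layered f = ∃ λ q → ∀ x → f x ≡ layerMap q x

  layered-shift : ∀ {f} b c → Layered f → Layered (f ∘ shift b c)
  layered-shift b c ((u , u′ , v , w , l) , f≗) = (u , u′ , val u ⊗ b ⊕ v , val u′ ⊗ c ⊕ w , l) , λ
    { (i , false) → trans (f≗ _) (cong (_, l) (solve 4 (λ u i b v → u :* (i :+ b) :+ v := u :* i :+ (u :* b :+ v)) refl (val u) i b v))
    ; (i , true)  → trans (f≗ _) (cong (_, not l) (solve 4 (λ u i b v → u :* (i :+ b) :+ v := u :* i :+ (u :* b :+ v)) refl (val u′) i c w)) }

  shift-layered : ∀ {f} b c → Layered f → Layered (shift b c ∘ f)
  shift-layered b c ((u , u′ , v , w , false) , f≗) = (u , u′ , v ⊕ b , w ⊕ c , false) , λ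
    { (i , false) → trans (cong (shift b c) (f≗ _)) (cong (_, false) (+-assoc _ v b))
    ; (i , true)  → trans (cong (shift b c) (f≗ _)) (cong (_, true) (+-assoc _ w c)) }
  shift-layered b c ((u , u′ , v , w , true) , f≗) = (u , u′ , v ⊕ c , w ⊕ b , true) , λ
    { (i , false) → trans (cong (shift b c) (f≗ _)) (cong (_, true) (+-assoc _ v c))
    ; (i , true)  → trans (cong (shift b c) (f≗ _)) (cong (_, false) (+-assoc _ w b)) }

  layered-resp : ∀ {f g} → (∀ x → f x ≡ g x) → Layered f → Layered g
  layered-resp f≗g (q , f≗) = q , λ x → trans (sym (f≗g x)) (f≗ x)

  -- If a ≠ 0 then b, c ≠ 0 too, so b and c generate the translations of the two layers,
  -- and f carries them to multiples of the rotation.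
  module Stabilised {f : D → D} (f-inj : Injective f) {a b c : F}
                    (stable : ∀ x → rot a (f (shift b c x)) ≡ f x) where

    -- With a = 0 the shift disappears under `f`, and `f` is injective.
    trivial-right : a ≡ 0F → b ≡ 0F × c ≡ 0F
    trivial-right refl = cancel-+ (cong proj₁ (fixed (0F , false))) , cancel-+ (cong proj₁ (fixed (0F , true)))
      where
      fixed : ∀ x → shift b c x ≡ x
      fixed x = f-inj _ _ (trans (sym (rot-0 _)) (stable x))

    private
      -- For b = 0 the shift fixes `(0F , false)`, so `rot a` fixes its image; nonzero rotations fix
      -- nothing. The argument for c is the same on the other layer.
      b≢0 : a ≢ 0F → b ≢ 0F
      b≢0 a≢0 refl = a≢0 (rot-fixes (trans (cong (rot a ∘ f) (cong (_, false) (sym (+-identityʳ 0F)))) (stable (0F , false))))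

      c≢0 : a ≢ 0F → c ≢ 0F
      c≢0 a≢0 refl = a≢0 (rot-fixes (trans (cong (rot a ∘ f) (cong (_, true) (sym (+-identityʳ 0F)))) (stable (0F , true))))

      step : ∀ x → f (shift b c x) ≡ rot (⊝ a) (f x)
      step x = trans (sym (rot-inverse a _)) (cong (rot (⊝ a)) (stable x))

      steps : ∀ n x → f (shift ([ n ] ⊗ b) ([ n ] ⊗ c) x) ≡ rot (⊝ ([ n ] ⊗ a)) (f x)
      steps zero x = trans (cong f (trans (cong₂ (λ s t → shift s t x) (zeroˡ b) (zeroˡ c)) (shift-0 x)))
        (sym (trans (cong (λ s → rot s (f x)) (solve 2 (λ a z → :- (z :* a) := :- a :* z) refl a 0F)) (trans (cong (λ s → rot s (f x)) (zeroʳ (⊝ a))) (rot-0 (f x)))))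
      steps (suc n) x = begin
        f (shift ([ suc n ] ⊗ b) ([ suc n ] ⊗ c) x)                    ≡⟨ cong f (trans (cong₂ (λ s t → shift s t x) (expand b) (expand c)) (shift-+ b c ([ n ] ⊗ b) ([ n ] ⊗ c) x)) ⟩
        f (shift b c (shift ([ n ] ⊗ b) ([ n ] ⊗ c) x))                ≡⟨ step _ ⟩
        rot (⊝ a) (f (shift ([ n ] ⊗ b) ([ n ] ⊗ c) x))                ≡⟨ cong (rot (⊝ a)) (steps n x) ⟩
        rot (⊝ a) (rot (⊝ ([ n ] ⊗ a)) (f x))                          ≡⟨ rot-+ _ _ _ ⟨
        rot (⊝ a ⊕ ⊝ ([ n ] ⊗ a)) (f x)                                ≡⟨ cong (λ s → rot s (f x)) (trans (solve 2 (λ a y → :- a :+ :- y := :- (a :+ y)) refl a ([ n ] ⊗ a)) (cong ⊝_ (sym (expand a)))) ⟩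
        rot (⊝ ([ suc n ] ⊗ a)) (f x)                                  ∎
        where
        open ≡-Reasoning
        expand : ∀ y → [ suc n ] ⊗ y ≡ y ⊕ [ n ] ⊗ y
        expand y = trans (cong (_⊗ y) ([]-+ 1 n)) (trans (distribʳ y 1F [ n ]) (cong (_⊕ [ n ] ⊗ y) (*-identityˡ y)))

      multiples : ∀ z x → f (shift (z ⊗ b) (z ⊗ c) x) ≡ rot (⊝ (z ⊗ a)) (f x)
      multiples z x = subst (λ z → f (shift (z ⊗ b) (z ⊗ c) x) ≡ rot (⊝ (z ⊗ a)) (f x)) ([]-toℕ z) (steps (toℕ z) x)

      -- A step of b before `f` becomes `rot (⊝ a)` after it, which subtracts a on rotations but
      -- adds a on reflections. Hence the sign depends on the layer of the image.
      slope : Unit → Unit → Bool → Unit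
      slope a b false = sub (⊝ (val (b ⁻¹ · a))) (holds (b ⁻¹ · a) ∘ ⊝-injective)
      slope a b true  = b ⁻¹ · a

      rot-slope : ∀ (α β : Unit) i v l → rot (⊝ ((i ⊗ val (β ⁻¹)) ⊗ val α)) (v , l) ≡ (val (slope α β l) ⊗ i ⊕ v , l)
      rot-slope α β i v false = cong (_, false) (solve 4 (λ i b a v → v :+ :- (i :* b :* a) := :- (b :* a) :* i :+ v) refl i (val (β ⁻¹)) (val α) v)
      rot-slope α β i v true  = cong (_, true) (solve 4 (λ i b a v → v :+ :- (:- (i :* b :* a)) := (b :* a) :* i :+ v) refl i (val (β ⁻¹)) (val α) v)

    layered : a ≢ 0F → Layered f
    layered a≢0 = assemble (proj₂ (f (0F , true)) Bool.≟ not l)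
      where
      α β γ : Unit
      α = sub a a≢0
      β = sub b (b≢0 a≢0)
      γ = sub c (c≢0 a≢0)
      v = proj₁ (f (0F , false))
      l = proj₂ (f (0F , false))
      w = proj₁ (f (0F , true))
      l′ = proj₂ (f (0F , true))
      translate : ∀ (β : Unit) i → 0F ⊕ (i ⊗ val (β ⁻¹)) ⊗ val β ≡ i
      translate β i = trans (+-identityˡ _) (trans (*-assoc i _ _) (trans (cong (i ⊗_) (⊗-inverseˡ β)) (*-identityʳ i)))
      on-false : ∀ i → f (i , false) ≡ (val (slope α β l) ⊗ i ⊕ v , l)
      on-false i = trans (cong f (cong (_, false) (sym (translate β i)))) (trans (multiples (i ⊗ val (β ⁻¹)) (0F , false)) (rot-slope α β i v l))
      on-true : ∀ i → f (i , true) ≡ (val (slope α γ l′) ⊗ i ⊕ w , l′)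
      on-true i = trans (cong f (cong (_, true) (sym (translate γ i)))) (trans (multiples (i ⊗ val (γ ⁻¹)) (0F , true)) (rot-slope α γ i w l′))
      assemble : Dec (l′ ≡ not l) → Layered f
      assemble (yes l′≡) = (slope α β l , slope α γ l′ , v , w , l) , λ { (i , false) → on-false i ; (i , true) → trans (on-true i) (cong (val (slope α γ l′) ⊗ i ⊕ w ,_) l′≡) }
      -- If both layers went to the same one, the rotations would already fill it: the solution z =
      -- (w - v)/u of u z + v = w has the same image as `(0F , true)`.
      assemble (no l′≢) = contradiction (cong proj₂ (f-inj _ _ collision)) λ ()
        where
        l′≡l : l′ ≡ l
        l′≡l = trans (Bool.¬-not l′≢) (Bool.not-involutive l)
        u = slope α β l
        collision : f (val (u ⁻¹) ⊗ (w ⊕ ⊝ v) , false) ≡ f (0F , true)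
        collision = trans (on-false _) (cong₂ _,_
          (trans (cong (_⊕ v) (trans (sym (*-assoc (val u) _ _)) (trans (cong (_⊗ (w ⊕ ⊝ v)) (⊗-inverseʳ u)) (*-identityˡ _))))
            (solve 2 (λ w v → w :+ :- v :+ v := w) refl w v))
          (sym l′≡l))

  -- Counting layered and wild (non-layered) isomorphisms.

  iso? : ∀ S T f → Dec (Iso S T f)
  iso? S T f =
    (forall? finite-D λ x → forall? finite-D λ y → equal? finite-D (f x) (f y) →-dec equal? finite-D x y)
    ×-dec (forall? finite-D λ g → forall? finite-D λ h → arc S g h Bool.≟ arc T (f g) (f h))

  layered? : ∀ f → Dec (Layered f)
  layered? f = exists? finite-Params λ q → forall? finite-D λ x → equal? finite-D (f x) (layerMap q x)

  Map : Set
  Map = Tab finite-D D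

  infixl 9 _$_
  _$_ : Map → D → D
  t $ x = app finite-D t x

  isoMap? : ∀ S T (t : Map) → Dec (Iso S T (t $_))
  isoMap? S T t = iso? S T (t $_)

  layeredIsoMap? : ∀ S T (t : Map) → Dec (Iso S T (t $_) × Layered (t $_))
  layeredIsoMap? S T t = isoMap? S T t ×-dec layered? (t $_)

  wildIsoMap? : ∀ S T (t : Map) → Dec (Iso S T (t $_) × ¬ Layered (t $_))
  wildIsoMap? S T t = isoMap? S T t ×-dec ¬? (layered? (t $_))

  finite-Map : Finite Map
  finite-Map = finite-Tab finite-D finite-D

  #Iso #LayeredIso #WildIso : (S T : D → Bool) → ℕ
  #Iso S T        = size (finite-Sub finite-Map (isoMap? S T))
  #LayeredIso S T = size (finite-Sub finite-Map (layeredIsoMap? S T))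
  #WildIso S T    = size (finite-Sub finite-Map (wildIsoMap? S T))

  #Iso-split : ∀ S T → #Iso S T ≡ #LayeredIso S T + #WildIso S T
  #Iso-split S T = trans (size-≡ (finite-Sub finite-Map (isoMap? S T))
      (finite-⊎ (finite-Sub finite-Map (layeredIsoMap? S T)) (finite-Sub finite-Map (wildIsoMap? S T))) to from from-to to-from)
    (size-⊎ _ _)
    where
    classify : (x : Sub (isoMap? S T)) → Dec (Layered (val x $_)) → Sub (layeredIsoMap? S T) ⊎ Sub (wildIsoMap? S T)
    classify x (yes l) = inj₁ (sub (val x) (holds x , l))
    classify x (no ¬l) = inj₂ (sub (val x) (holds x , ¬l))
    to : Sub (isoMap? S T) → Sub (layeredIsoMap? S T) ⊎ Sub (wildIsoMap? S T)
    to x = classify x (layered? (val x $_))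
    from : Sub (layeredIsoMap? S T) ⊎ Sub (wildIsoMap? S T) → Sub (isoMap? S T)
    from (inj₁ x) = sub (val x) (proj₁ (holds x))
    from (inj₂ x) = sub (val x) (proj₁ (holds x))
    from-classify : ∀ x l → from (classify x l) ≡ x
    from-classify x (yes _) = Sub-≡ refl
    from-classify x (no _)  = Sub-≡ refl
    from-to : ∀ x → from (to x) ≡ x
    from-to x = from-classify x (layered? (val x $_))
    classify-from : ∀ y l → classify (from y) l ≡ y
    classify-from (inj₁ y) (yes _) = cong inj₁ (Sub-≡ refl)
    classify-from (inj₁ y) (no ¬l) = ⊥-elim (¬l (proj₂ (holds y)))
    classify-from (inj₂ y) (yes l) = ⊥-elim (proj₂ (holds y) l)
    classify-from (inj₂ y) (no _)  = cong inj₂ (Sub-≡ refl)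
    to-from : ∀ y → to (from y) ≡ y
    to-from y = classify-from y (layered? (val (from y) $_))

  -- Composition with the injective `f` loses nothing. Applied in both directions, it equates the
  -- number of isomorphisms S → T with that of automorphisms of S.
  #Iso-≤ : ∀ {S T U} f → Iso T U f → #Iso S T ≤ #Iso S U
  #Iso-≤ {S} {T} {U} f (f-inj , f-pres) = size-≤ (finite-Sub finite-Map (isoMap? S T)) (finite-Sub finite-Map (isoMap? S U)) to to-inj
    where
    compose : Map → Map
    compose t = tab finite-D (λ x → f (t $ x))
    compose-$ : ∀ t x → compose t $ x ≡ f (t $ x)
    compose-$ t x = app-tab finite-D _ x
    to : Sub (isoMap? S T) → Sub (isoMap? S U)
    to x = sub (compose (val x))
      ( (λ y z eq → proj₁ (holds x) y z (f-inj _ _ (trans (sym (compose-$ (val x) y)) (trans eq (compose-$ (val x) z)))))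
      , (λ g h → trans (proj₂ (holds x) g h) (trans (f-pres _ _) (sym (cong₂ (arc U) (compose-$ (val x) g) (compose-$ (val x) h))))))
    to-inj : ∀ {x y} → to x ≡ to y → x ≡ y
    to-inj {x} {y} eq = Sub-≡ (tab-ext finite-D λ d → f-inj _ _
      (trans (sym (compose-$ (val x) d)) (trans (cong (_$ d) (cong val eq)) (compose-$ (val y) d))))

  additive³ : FiniteGroup (F × F × F)
  additive³ = additive ×-group additive ×-group additive

  -- The components of φ act through rotations on the left and layer translations on the right.
  module WildAction {G : Set} (𝓖 : FiniteGroup G) (φ : G → F × F × F)
    (φ-∙ : ∀ g h → φ (FiniteGroup._∙_ 𝓖 g h) ≡ FiniteGroup._∙_ additive³ (φ g) (φ h))
    (φ-ε : φ (FiniteGroup.ε 𝓖) ≡ FiniteGroup.ε additive³)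
    (faithful : ∀ g → φ g ≡ FiniteGroup.ε additive³ → g ≡ FiniteGroup.ε 𝓖)
    (S T : D → Bool) (preserves : ∀ g → Preserves S S (shift (proj₁ (proj₂ (φ g))) (proj₂ (proj₂ (φ g))))) where

    open FiniteGroup 𝓖 using (_∙_; ε; order)

    private
      α β γ : G → F
      α g = proj₁ (φ g)
      β g = proj₁ (proj₂ (φ g))
      γ g = proj₂ (proj₂ (φ g))

      Wild : Set
      Wild = Sub (wildIsoMap? S T)

      move : G → (D → D) → D → D
      move g f x = rot (α g) (f (shift (β g) (γ g) x))

      moveMap : G → Map → Map
      moveMap g t = tab finite-D (move g (t $_))

      moveMap-$ : ∀ g t x → moveMap g t $ x ≡ move g (t $_) x
      moveMap-$ g t x = app-tab finite-D _ x

      -- Composition with shifts keeps maps layered; if the moved map were layered, moving it back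
      -- would make `t` layered.
      wild-move : ∀ g t → Iso S T (t $_) × ¬ Layered (t $_) → Iso S T (moveMap g t $_) × ¬ Layered (moveMap g t $_)
      wild-move g t ((inj , pres) , wild) = (inj′ , pres′) , λ l → wild (layered-resp undo (shift-layered (⊝ α g) (⊝ (⊝ α g)) (layered-shift (⊝ β g) (⊝ γ g) l)))
        where
        inj′ : Injective (moveMap g t $_)
        inj′ x y eq = shift-injective (β g) (γ g) (inj _ _ (shift-injective (α g) (⊝ α g)
          (trans (sym (moveMap-$ g t x)) (trans eq (moveMap-$ g t y)))))
        pres′ : Preserves S T (moveMap g t $_)
        pres′ x y = trans (preserves g x y) (trans (pres (shift (β g) (γ g) x) (shift (β g) (γ g) y))
          (trans (rot-preserves T (α g) (t $ shift (β g) (γ g) x) (t $ shift (β g) (γ g) y))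
          (sym (cong₂ (arc T) (moveMap-$ g t x) (moveMap-$ g t y)))))
        undo : ∀ x → rot (⊝ α g) (moveMap g t $ shift (⊝ β g) (⊝ γ g) x) ≡ t $ x
        undo x = trans (cong (rot (⊝ α g)) (moveMap-$ g t _)) (trans (rot-inverse (α g) _)
          (cong (t $_) (trans (shift-comm (β g) (γ g) (⊝ β g) (⊝ γ g) x) (shift-inverse (β g) (γ g) x))))

      action : Action 𝓖 Wild
      action = record
        { act   = λ g x → sub (moveMap g (val x)) (wild-move g (val x) (holds x))
        ; act-ε = λ x → Sub-≡ (tab-ext finite-D λ d → trans (moveMap-$ ε (val x) d) (trans (cong₂ (λ a e → rot a (val x $ e)) (cong proj₁ φ-ε)
            (trans (cong₂ (λ b c → shift b c d) (cong (proj₁ ∘ proj₂) φ-ε) (cong (proj₂ ∘ proj₂) φ-ε)) (shift-0 d))) (rot-0 _)))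
        ; act-∙ = λ g h x → Sub-≡ (tab-ext finite-D λ d → begin
            moveMap (g ∙ h) (val x) $ d                                                         ≡⟨ moveMap-$ (g ∙ h) (val x) d ⟩
            rot (α (g ∙ h)) (val x $ shift (β (g ∙ h)) (γ (g ∙ h)) d)                           ≡⟨ cong₂ (λ a e → rot a (val x $ e)) (cong proj₁ (φ-∙ g h))
                                                                                                     (trans (cong₂ (λ b c → shift b c d) (cong (proj₁ ∘ proj₂) (φ-∙ g h)) (cong (proj₂ ∘ proj₂) (φ-∙ g h))) (shift-+ (β g) (γ g) (β h) (γ h) d)) ⟩
            rot (α g ⊕ α h) (val x $ shift (β g) (γ g) (shift (β h) (γ h) d))                   ≡⟨ rot-+ (α g) (α h) _ ⟩
            -- Precomposition reverses the order of the factors; as shifts commute, a left action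
            -- results all the same.
            rot (α g) (rot (α h) (val x $ shift (β g) (γ g) (shift (β h) (γ h) d)))             ≡⟨ cong (λ e → rot (α g) (rot (α h) (val x $ e))) (shift-comm (β g) (γ g) (β h) (γ h) d) ⟩
            rot (α g) (move h (val x $_) (shift (β g) (γ g) d))                                 ≡⟨ cong (rot (α g)) (moveMap-$ h (val x) _) ⟨
            move g (moveMap h (val x) $_) d                                                     ≡⟨ moveMap-$ g (moveMap h (val x)) d ⟨
            moveMap g (moveMap h (val x)) $ d                                                   ∎)
        }
        where open ≡-Reasoning

      -- A fixed map is in the situation of `Stabilised`: a nonzero rotation on the left would make
      -- it layered, and a zero one forces the shifts on the right to vanish.
      free : ∀ g (x : Wild) → Action.act action g x ≡ x → g ≡ ε
      free g x eq = by-cases (α g Fin.≟ 0F)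
        where
        open Stabilised {f = val x $_} (proj₁ (proj₁ (holds x))) {α g} {β g} {γ g}
          (λ d → trans (sym (moveMap-$ g (val x) d)) (cong (_$ d) (cong val eq)))
        by-cases : Dec (α g ≡ 0F) → g ≡ ε
        by-cases (yes α≡0) = faithful g (cong₂ _,_ α≡0 (cong₂ _,_ (proj₁ (trivial-right α≡0)) (proj₂ (trivial-right α≡0))))
        by-cases (no  α≢0) = ⊥-elim (proj₂ (holds x) (layered α≢0))

    order-divides : order ∣ #WildIso S T
    order-divides = divides (size (Orbits.finite-Orbit finite-Wild action))
      (trans (Orbits.free-size finite-Wild action free) (ℕ.*-comm order _))
      where
      finite-Wild : Finite Wild
      finite-Wild = finite-Sub finite-Map (wildIsoMap? S T)

-- Rigidity

module Rigidity (p : ℕ) .{{p≢0 : NonZero p}} (p-prime : Prime p) where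

  open Field p p-prime
  open Dihedral p p-prime

  -- What it takes for a layer map to preserve arcs, with c the sum of its two offsets. Arcs within
  -- a layer do not see offsets, arcs between layers see only their sum, and exchanging the layers
  -- changes nothing.
  Valid : (S T : D → Bool) → Unit → Unit → F → Set
  Valid S T u u′ c =
    (∀ i → S (i , false) ≡ T (val u ⊗ i , false)) ×
    (∀ i → S (i , false) ≡ T (val u′ ⊗ i , false)) ×
    (∀ i k → S (k ⊕ i , true) ≡ T (val u′ ⊗ k ⊕ val u ⊗ i ⊕ c , true))

  valid? : ∀ S T u u′ c → Dec (Valid S T u u′ c)
  valid? S T u u′ c =
    (forall? (finite-Fin p) λ i → S (i , false) Bool.≟ T (val u ⊗ i , false)) ×-dec
    (forall? (finite-Fin p) λ i → S (i , false) Bool.≟ T (val u′ ⊗ i , false)) ×-dec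
    (forall? (finite-Fin p) λ i → forall? (finite-Fin p) λ k → S (k ⊕ i , true) Bool.≟ T (val u′ ⊗ k ⊕ val u ⊗ i ⊕ c , true))

  private
    same-layer : ∀ {S T : D → Bool} (u : Unit) v → (∀ i → S (i , false) ≡ T (val u ⊗ i , false)) →
      ∀ i k → S (k ⊕ ⊝ i , false) ≡ T (val u ⊗ k ⊕ v ⊕ ⊝ (val u ⊗ i ⊕ v) , false)
    same-layer {T = T} u v hyp i k = trans (hyp _) (cong (λ x → T (x , false))
      (solve 4 (λ u v i k → u :* (k :+ :- i) := u :* k :+ v :+ :- (u :* i :+ v)) refl (val u) v i k))

    cross₁ : ∀ {S T : D → Bool} (u u′ : Unit) v w → (∀ i k → S (k ⊕ i , true) ≡ T (val u′ ⊗ k ⊕ val u ⊗ i ⊕ (v ⊕ w) , true)) →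
      ∀ i k → S (k ⊕ i , true) ≡ T (val u′ ⊗ k ⊕ w ⊕ (val u ⊗ i ⊕ v) , true)
    cross₁ {T = T} u u′ v w hyp i k = trans (hyp i k) (cong (λ x → T (x , true))
      (solve 4 (λ x y v w → y :+ x :+ (v :+ w) := y :+ w :+ (x :+ v)) refl (val u ⊗ i) (val u′ ⊗ k) v w))

    cross₂ : ∀ {S T : D → Bool} (u u′ : Unit) v w → (∀ i k → S (k ⊕ i , true) ≡ T (val u′ ⊗ k ⊕ val u ⊗ i ⊕ (v ⊕ w) , true)) →
      ∀ i k → S (k ⊕ i , true) ≡ T (val u ⊗ k ⊕ v ⊕ (val u′ ⊗ i ⊕ w) , true)
    cross₂ {S} {T} u u′ v w hyp i k = trans (cong (λ x → S (x , true)) (+-comm k i)) (trans (hyp k i) (cong (λ x → T (x , true))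
      (solve 4 (λ x y v w → y :+ x :+ (v :+ w) := x :+ v :+ (y :+ w)) refl (val u ⊗ k) (val u′ ⊗ i) v w)))

  valid⇒preserves : ∀ {S T u u′ v w} l → Valid S T u u′ (v ⊕ w) → Preserves S T (layerMap (u , u′ , v , w , l))
  valid⇒preserves {S} {T} {u} {u′} {v} {w} false (A , A′ , B) (i , false) (k , false) = same-layer {S} {T} u v A i k
  valid⇒preserves {S} {T} {u} {u′} {v} {w} false (A , A′ , B) (i , false) (k , true)  = cross₁ {S} {T} u u′ v w B i k
  valid⇒preserves {S} {T} {u} {u′} {v} {w} false (A , A′ , B) (i , true)  (k , false) = cross₂ {S} {T} u u′ v w B i k
  valid⇒preserves {S} {T} {u} {u′} {v} {w} false (A , A′ , B) (i , true)  (k , true)  = same-layer {S} {T} u′ w A′ i k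
  valid⇒preserves {S} {T} {u} {u′} {v} {w} true  (A , A′ , B) (i , false) (k , false) = same-layer {S} {T} u v A i k
  valid⇒preserves {S} {T} {u} {u′} {v} {w} true  (A , A′ , B) (i , false) (k , true)  = cross₁ {S} {T} u u′ v w B i k
  valid⇒preserves {S} {T} {u} {u′} {v} {w} true  (A , A′ , B) (i , true)  (k , false) = cross₂ {S} {T} u u′ v w B i k
  valid⇒preserves {S} {T} {u} {u′} {v} {w} true  (A , A′ , B) (i , true)  (k , true)  = same-layer {S} {T} u′ w A′ i k

  private
    from-origin : ∀ {S T : D → Bool} (u : Unit) v → (∀ i → S (i ⊕ ⊝ 0F , false) ≡ T (val u ⊗ i ⊕ v ⊕ ⊝ (val u ⊗ 0F ⊕ v) , false)) →
      ∀ i → S (i , false) ≡ T (val u ⊗ i , false)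
    from-origin {S} {T} u v hyp i = trans (cong (λ x → S (x , false)) (solve 1 (λ i → i := i :+ :- con (ℤ.+ 0)) refl i))
      (trans (hyp i) (cong (λ x → T (x , false)) (solve 3 (λ u v i → u :* i :+ v :+ :- (u :* con (ℤ.+ 0) :+ v) := u :* i) refl (val u) v i)))

    from-cross : ∀ {S T : D → Bool} (u u′ : Unit) v w → (∀ i k → S (k ⊕ i , true) ≡ T (val u′ ⊗ k ⊕ w ⊕ (val u ⊗ i ⊕ v) , true)) →
      ∀ i k → S (k ⊕ i , true) ≡ T (val u′ ⊗ k ⊕ val u ⊗ i ⊕ (v ⊕ w) , true)
    from-cross {T = T} u u′ v w hyp i k = trans (hyp i k) (cong (λ x → T (x , true))
      (solve 4 (λ x y v w → y :+ w :+ (x :+ v) := y :+ x :+ (v :+ w)) refl (val u ⊗ i) (val u′ ⊗ k) v w))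

  preserves⇒valid : ∀ {S T u u′ v w} l → Preserves S T (layerMap (u , u′ , v , w , l)) → Valid S T u u′ (v ⊕ w)
  preserves⇒valid {S} {T} {u} {u′} {v} {w} false pres =
    from-origin {S} {T} u v (λ i → pres (0F , false) (i , false)) , from-origin {S} {T} u′ w (λ i → pres (0F , true) (i , true)) ,
    from-cross {S} {T} u u′ v w (λ i k → pres (i , false) (k , true))
  preserves⇒valid {S} {T} {u} {u′} {v} {w} true pres =
    from-origin {S} {T} u v (λ i → pres (0F , false) (i , false)) , from-origin {S} {T} u′ w (λ i → pres (0F , true) (i , true)) ,
    from-cross {S} {T} u u′ v w (λ i k → pres (i , false) (k , true))

  affine-injective : ∀ (u : Unit) {v i j} → val u ⊗ i ⊕ v ≡ val u ⊗ j ⊕ v → i ≡ j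
  affine-injective u {v} {i} {j} eq = ⊗-cancelˡ (holds u) (trans (solve 2 (λ x v → x := x :+ v :+ :- v) refl (val u ⊗ i) v)
    (trans (cong (_⊕ ⊝ v) eq) (solve 2 (λ x v → x :+ v :+ :- v := x) refl (val u ⊗ j) v)))

  layerMap-injective : ∀ q → Injective (layerMap q)
  layerMap-injective (u , u′ , v , w , l) (i , false) (j , false) eq = cong (_, false) (affine-injective u (cong proj₁ eq))
  layerMap-injective (u , u′ , v , w , l) (i , false) (j , true)  eq = ⊥-elim (Bool.not-¬ refl (cong proj₂ eq))
  layerMap-injective (u , u′ , v , w , l) (i , true)  (j , false) eq = ⊥-elim (Bool.not-¬ refl (sym (cong proj₂ eq)))
  layerMap-injective (u , u′ , v , w , l) (i , true)  (j , true)  eq = cong (_, true) (affine-injective u′ (cong proj₁ eq))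

  private
    affine-unique : ∀ {u u₁ : Unit} {v v₁} → (∀ i → val u ⊗ i ⊕ v ≡ val u₁ ⊗ i ⊕ v₁) → u ≡ u₁ × v ≡ v₁
    affine-unique {u} {u₁} {v} {v₁} eq = Sub-≡ u≡ , v≡
      where
      v≡ : v ≡ v₁
      v≡ = trans (solve 2 (λ u v → v := u :* con (ℤ.+ 0) :+ v) refl (val u) v)
        (trans (eq 0F) (solve 2 (λ u v → u :* con (ℤ.+ 0) :+ v := v) refl (val u₁) v₁))
      u≡ : val u ≡ val u₁
      u≡ = begin
        val u                            ≡⟨ *-identityʳ (val u) ⟨
        val u ⊗ 1F                       ≡⟨ solve 2 (λ x v → x := x :+ v :+ :- v) refl (val u ⊗ 1F) v ⟩
        val u ⊗ 1F ⊕ v ⊕ ⊝ v             ≡⟨ cong₂ (λ x y → x ⊕ ⊝ y) (eq 1F) v≡ ⟩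
        val u₁ ⊗ 1F ⊕ v₁ ⊕ ⊝ v₁          ≡⟨ solve 2 (λ x v → x :+ v :+ :- v := x) refl (val u₁ ⊗ 1F) v₁ ⟩
        val u₁ ⊗ 1F                      ≡⟨ *-identityʳ (val u₁) ⟩
        val u₁                           ∎
        where open ≡-Reasoning

  -- The values at 0 and 1 determine offset and slope of an affine map. Counting layered
  -- isomorphisms is therefore counting parameters.
  layerMap-unique : ∀ {q q′} → (∀ x → layerMap q x ≡ layerMap q′ x) → q ≡ q′
  layerMap-unique {u , u′ , v , w , l} {u₁ , u₁′ , v₁ , w₁ , l₁} eq =
    cong₂ _,_ (proj₁ first) (cong₂ _,_ (proj₁ second) (cong₂ _,_ (proj₂ first) (cong₂ _,_ (proj₂ second) (cong proj₂ (eq (0F , false))))))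
    where
    first : u ≡ u₁ × v ≡ v₁
    first = affine-unique (λ i → cong proj₁ (eq (i , false)))
    second : u′ ≡ u₁′ × w ≡ w₁
    second = affine-unique (λ i → cong proj₁ (eq (i , true)))

  ValidParams : (S T : D → Bool) → Params → Set
  ValidParams S T (u , u′ , v , w , l) = Valid S T u u′ (v ⊕ w)

  validParams? : ∀ S T q → Dec (ValidParams S T q)
  validParams? S T (u , u′ , v , w , l) = valid? S T u u′ (v ⊕ w)

  #LayeredIso≡ : ∀ S T → #LayeredIso S T ≡ size (finite-Sub finite-Params (validParams? S T))
  #LayeredIso≡ S T = size-≡ (finite-Sub finite-Map (layeredIsoMap? S T)) (finite-Sub finite-Params (validParams? S T)) to from from-to to-from
    where
    params : Sub (layeredIsoMap? S T) → Params
    params x = proj₁ (proj₂ (holds x))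
    is-layerMap : ∀ x d → val x $ d ≡ layerMap (params x) d
    is-layerMap x = proj₂ (proj₂ (holds x))
    to : Sub (layeredIsoMap? S T) → Sub (validParams? S T)
    to x = sub (params x) (preserves⇒valid (proj₂ (proj₂ (proj₂ (proj₂ (params x))))) λ g h →
      trans (proj₂ (proj₁ (holds x)) g h) (cong₂ (arc T) (is-layerMap x g) (is-layerMap x h)))
    table : Params → Map
    table q = tab finite-D (layerMap q)
    table-$ : ∀ q d → table q $ d ≡ layerMap q d
    table-$ q d = app-tab finite-D _ d
    from : Sub (validParams? S T) → Sub (layeredIsoMap? S T)
    from y = sub (table (val y))
      ( ( (λ d e eq → layerMap-injective (val y) d e (trans (sym (table-$ (val y) d)) (trans eq (table-$ (val y) e))))
        , (λ g h → trans (valid⇒preserves (proj₂ (proj₂ (proj₂ (proj₂ (val y))))) (holds y) g h) (sym (cong₂ (arc T) (table-$ (val y) g) (table-$ (val y) h)))) )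
      , (val y , table-$ (val y)) )
    from-to : ∀ x → from (to x) ≡ x
    from-to x = Sub-≡ (tab-ext finite-D λ d → trans (table-$ (params x) d) (sym (is-layerMap x d)))
    to-from : ∀ y → to (from y) ≡ y
    to-from y = Sub-≡ (layerMap-unique λ d → trans (sym (is-layerMap (from y) d)) (table-$ (val y) d))

  -- The number of layered automorphisms.

  module _ (S : D → Bool) (const : Constant S) where

    private
      stabilises? : (u : Unit) → Dec (∀ i → S (i , false) ≡ S (val u ⊗ i , false))
      stabilises? u = forall? (finite-Fin p) λ i → S (i , false) Bool.≟ S (val u ⊗ i , false)

      finite-K : Finite (Sub stabilises?)
      finite-K = finite-Sub finite-Unit stabilises?

      finite-Target : Finite (Sub stabilises? × Sub stabilises? × F × F × Bool)
      finite-Target = finite-× finite-K (finite-× finite-K (finite-× (finite-Fin p) (finite-× (finite-Fin p) finite-Bool)))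

      size-Target : size finite-Target ≡ size finite-K * (size finite-K * (p * (p * 2)))
      size-Target = trans (size-× _ _) (cong (size finite-K *_) (trans (size-× _ _) (cong (size finite-K *_)
        (trans (size-× _ _) (cong (p *_) (size-× _ _))))))

    -- The condition on reflections is vacuous, so u and u′ range independently over the k units
    -- stabilising the rotations in S, and both offsets and the flag are free. There are only p - 1
    -- units, whence k < p.
    #LayeredIso-constant : ∃ λ k → 0 < k × k < p × #LayeredIso S S ≡ k * (k * (p * (p * 2)))
    #LayeredIso-constant = size finite-K , ℕ.≤-<-trans z≤n (Fin.toℕ<n (index finite-K identity))
      , ℕ.≤-trans (s≤s (size-≤ finite-K finite-Unit val Sub-≡)) (ℕ.≤-reflexive suc-size-Unit)
      , trans (#LayeredIso≡ S S) (trans (size-≡ (finite-Sub finite-Params (validParams? S S)) finite-Target to from (λ _ → Sub-≡ refl) to-from) size-Target)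
      where
      identity : Sub stabilises?
      identity = sub one λ i → cong (λ x → S (x , false)) (sym (*-identityˡ i))
      to : Sub (validParams? S S) → Sub stabilises? × Sub stabilises? × F × F × Bool
      to x@((u , u′ , v , w , l) ⊢ _) = sub u (proj₁ (holds x)) , sub u′ (proj₁ (proj₂ (holds x))) , v , w , l
      from : Sub stabilises? × Sub stabilises? × F × F × Bool → Sub (validParams? S S)
      from (u , u′ , v , w , l) = sub (val u , val u′ , v , w , l) (holds u , holds u′ , λ i k → trans (const _) (sym (const _)))
      to-from : ∀ y → to (from y) ≡ y
      to-from (u , u′ , v , w , l) = cong₂ (λ a b → a , b , v , w , l) (Sub-≡ refl) (Sub-≡ refl)

  private
    difference : ∀ {x y : F} → x ≢ y → Unit
    difference {x} {y} x≢y = sub (x ⊕ ⊝ y) λ eq → x≢y (trans (solve 2 (λ x y → x := x :+ :- y :+ y) refl x y) (trans (cong (_⊕ y) eq) (+-identityˡ y)))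

    divide : ∀ (u : Unit) x → val u ⊗ (val (u ⁻¹) ⊗ x) ≡ x
    divide u x = trans (sym (*-assoc (val u) _ x)) (trans (cong (_⊗ x) (⊗-inverseʳ u)) (*-identityˡ x))

  module _ (S : D → Bool) (¬const : ¬ Constant S) where

    -- For i = -k the condition on reflections compares the value at 0 with the value at (u′ - u) k
    -- + c. If u′ ≠ u, this runs through all of ℤ/p, and S would be constant on reflections.
    equal-slopes : ∀ {u u′ c} → Valid S S u u′ c → u′ ≡ u
    equal-slopes {u} {u′} {c} (_ , _ , B) = by-cases (val u′ Fin.≟ val u)
      where
      by-cases : Dec (val u′ ≡ val u) → u′ ≡ u
      by-cases (yes eq) = Sub-≡ eq
      by-cases (no neq) = ⊥-elim (¬const λ x → let w = difference neq ; k = val (w ⁻¹) ⊗ (x ⊕ ⊝ c) in sym (begin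
        S (0F , true)                                          ≡⟨ cong (λ y → S (y , true)) (-‿inverseʳ k) ⟨
        S (k ⊕ ⊝ k , true)                                     ≡⟨ B (⊝ k) k ⟩
        S (val u′ ⊗ k ⊕ val u ⊗ ⊝ k ⊕ c , true)                ≡⟨ cong (λ y → S (y , true)) (solve 4 (λ u u′ k c → u′ :* k :+ u :* :- k :+ c := (u′ :+ :- u) :* k :+ c) refl (val u) (val u′) k c) ⟩
        S ((val u′ ⊕ ⊝ val u) ⊗ k ⊕ c , true)                  ≡⟨ cong (λ y → S (y ⊕ c , true)) (divide w (x ⊕ ⊝ c)) ⟩
        S (x ⊕ ⊝ c ⊕ c , true)                                 ≡⟨ cong (λ y → S (y , true)) (solve 2 (λ x c → x :+ :- c :+ c := x) refl x c) ⟩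
        S (x , true)                                           ∎))
        where open ≡-Reasoning

    -- A nonzero period generates ℤ/p, so x is reached from 0 in x/δ steps.
    aperiodic : ∀ δ → δ ≢ 0F → ¬ (∀ x → S (x ⊕ δ , true) ≡ S (x , true))
    aperiodic δ δ≢0 periodic = ¬const λ x → trans (cong (λ y → S (y , true)) (sym (begin
        0F ⊕ [ toℕ (x ⊗ val (u ⁻¹)) ] ⊗ δ        ≡⟨ +-identityˡ _ ⟩
        [ toℕ (x ⊗ val (u ⁻¹)) ] ⊗ δ             ≡⟨ cong (_⊗ δ) ([]-toℕ _) ⟩
        x ⊗ val (u ⁻¹) ⊗ δ                       ≡⟨ *-assoc x _ δ ⟩
        x ⊗ (val (u ⁻¹) ⊗ δ)                     ≡⟨ cong (x ⊗_) (⊗-inverseˡ u) ⟩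
        x ⊗ 1F                                   ≡⟨ *-identityʳ x ⟩
        x                                        ∎))) (multiple (toℕ (x ⊗ val (u ⁻¹))) 0F)
      where
      open ≡-Reasoning
      u : Unit
      u = sub δ δ≢0
      multiple : ∀ n x → S (x ⊕ [ n ] ⊗ δ , true) ≡ S (x , true)
      multiple zero x = cong (λ y → S (y , true)) (trans (cong (x ⊕_) (zeroˡ δ)) (+-identityʳ x))
      multiple (suc n) x = trans (cong (λ y → S (y , true)) (begin
          x ⊕ [ suc n ] ⊗ δ                      ≡⟨ cong (λ y → x ⊕ y ⊗ δ) ([]-+ 1 n) ⟩
          x ⊕ (1F ⊕ [ n ]) ⊗ δ                   ≡⟨ solve 4 (λ x o n d → x :+ (o :+ n) :* d := x :+ n :* d :+ o :* d) refl x 1F [ n ] δ ⟩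
          x ⊕ [ n ] ⊗ δ ⊕ 1F ⊗ δ                 ≡⟨ cong (x ⊕ [ n ] ⊗ δ ⊕_) (*-identityˡ δ) ⟩
          x ⊕ [ n ] ⊗ δ ⊕ δ                      ∎))
        (trans (periodic _) (multiple n x))

    -- Two offsets for one slope differ by a period of the reflections in S.
    unique-offset : ∀ {u c c′} → Valid S S u u c → Valid S S u u c′ → c ≡ c′
    unique-offset {u} {c} {c′} (_ , _ , B) (_ , _ , B′) = by-cases (c Fin.≟ c′)
      where
      open ≡-Reasoning
      k : F → F
      k x = val (u ⁻¹) ⊗ (x ⊕ ⊝ c′)
      target : ∀ x → val u ⊗ k x ⊕ val u ⊗ 0F ≡ x ⊕ ⊝ c′
      target x = trans (cong₂ _⊕_ (divide u (x ⊕ ⊝ c′)) (zeroʳ (val u))) (+-identityʳ (x ⊕ ⊝ c′))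
      periodic : ∀ x → S (x ⊕ (c ⊕ ⊝ c′) , true) ≡ S (x , true)
      periodic x = begin
        S (x ⊕ (c ⊕ ⊝ c′) , true)                       ≡⟨ cong (λ y → S (y , true)) (solve 3 (λ x c c′ → x :+ (c :+ :- c′) := x :+ :- c′ :+ c) refl x c c′) ⟩
        S (x ⊕ ⊝ c′ ⊕ c , true)                         ≡⟨ cong (λ y → S (y ⊕ c , true)) (target x) ⟨
        S (val u ⊗ k x ⊕ val u ⊗ 0F ⊕ c , true)         ≡⟨ B 0F (k x) ⟨
        S (k x ⊕ 0F , true)                             ≡⟨ B′ 0F (k x) ⟩
        S (val u ⊗ k x ⊕ val u ⊗ 0F ⊕ c′ , true)        ≡⟨ cong (λ y → S (y ⊕ c′ , true)) (target x) ⟩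
        S (x ⊕ ⊝ c′ ⊕ c′ , true)                        ≡⟨ cong (λ y → S (y , true)) (solve 2 (λ x c → x :+ :- c :+ c := x) refl x c′) ⟩
        S (x , true)                                    ∎
      by-cases : Dec (c ≡ c′) → c ≡ c′
      by-cases (yes eq) = eq
      by-cases (no neq) = ⊥-elim (aperiodic (c ⊕ ⊝ c′) (holds (difference neq)) periodic)

    private
      stabilises? : (u : Unit) → Dec (∃ λ c → Valid S S u u c)
      stabilises? u = exists? (finite-Fin p) λ c → valid? S S u u c

      finite-K : Finite (Sub stabilises?)
      finite-K = finite-Sub finite-Unit stabilises?

      finite-Target : Finite (Sub stabilises? × F × Bool)
      finite-Target = finite-× finite-K (finite-× (finite-Fin p) finite-Bool)

    -- Now u′ equals u, and u determines v + w. Only u, v and the flag remain to be chosen, which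
    -- leaves a single factor p.
    #LayeredIso-nonconstant : ∃ λ k → 0 < k × k < p × #LayeredIso S S ≡ k * (p * 2)
    #LayeredIso-nonconstant = size finite-K , ℕ.≤-<-trans z≤n (Fin.toℕ<n (index finite-K identity))
      , ℕ.≤-trans (s≤s (size-≤ finite-K finite-Unit val Sub-≡)) (ℕ.≤-reflexive suc-size-Unit)
      , trans (#LayeredIso≡ S S) (trans (size-≡ (finite-Sub finite-Params (validParams? S S)) finite-Target to from from-to to-from)
          (trans (size-× _ _) (cong (size finite-K *_) (size-× _ _))))
      where
      identity : Sub stabilises?
      identity = sub one (0F , fixes , fixes , λ i k → cong (λ x → S (x , true))
          (sym (trans (+-identityʳ _) (cong₂ _⊕_ (*-identityˡ k) (*-identityˡ i)))))
        where
        fixes : ∀ i → S (i , false) ≡ S (1F ⊗ i , false)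
        fixes i = cong (λ x → S (x , false)) (sym (*-identityˡ i))
      offset : Sub stabilises? → F
      offset u = proj₁ (holds u)
      valid-equal : ∀ {u u′ c} → u′ ≡ u → Valid S S u u′ c → Valid S S u u c
      valid-equal refl valid = valid
      balance : ∀ {v w c} → v ⊕ w ≡ c → w ≡ c ⊕ ⊝ v
      balance {v} {w} refl = solve 2 (λ v w → w := v :+ w :+ :- v) refl v w
      slopes : (x : Sub (validParams? S S)) → proj₁ (proj₂ (val x)) ≡ proj₁ (val x)
      slopes x@((u , u′ , v , w , l) ⊢ _) = equal-slopes {u} {u′} {v ⊕ w} (holds x)
      valid-to : (x : Sub (validParams? S S)) → let (u , u′ , v , w , l) = val x in Valid S S u u (v ⊕ w)
      valid-to x@((u , u′ , v , w , l) ⊢ _) = valid-equal {u} {u′} {v ⊕ w} (slopes x) (holds x)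
      to : Sub (validParams? S S) → Sub stabilises? × F × Bool
      to x@((u , u′ , v , w , l) ⊢ _) = sub u (v ⊕ w , valid-to x) , v , l
      from : Sub stabilises? × F × Bool → Sub (validParams? S S)
      from (u , v , l) = sub (val u , val u , v , offset u ⊕ ⊝ v , l)
        (subst (Valid S S (val u) (val u)) (solve 2 (λ c v → c := v :+ (c :+ :- v)) refl (offset u) v) (proj₂ (holds u)))
      from-to : ∀ x → from (to x) ≡ x
      from-to x@((u , u′ , v , w , l) ⊢ _) = Sub-≡ (cong₂ (λ a b → u , a , v , b , l) (sym (slopes x))
        (sym (balance (unique-offset {u} {v ⊕ w} {offset (proj₁ (to x))} (valid-to x) (proj₂ (holds (proj₁ (to x))))))))
      to-from : ∀ y → to (from y) ≡ y
      to-from (u , v , l) = cong (_, v , l) (Sub-≡ refl)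

  Affine : (S T : D → Bool) → Unit → F → Set
  Affine S T u c = (∀ i → S (i , false) ≡ T (val u ⊗ i , false)) × (∀ i → S (i , true) ≡ T (val u ⊗ i ⊕ c , true))

  -- Setting k = 0 eliminates u′: even when the slopes differ, u and c alone carry S to T.
  valid⇒affine : ∀ {S T u u′ c} → Valid S T u u′ c → Affine S T u c
  valid⇒affine {S} {T} {u} {u′} {c} (A , _ , B) = A , λ i → begin
    S (i , true)                                  ≡⟨ cong (λ x → S (x , true)) (+-identityˡ i) ⟨
    S (0F ⊕ i , true)                             ≡⟨ B i 0F ⟩
    T (val u′ ⊗ 0F ⊕ val u ⊗ i ⊕ c , true)        ≡⟨ cong (λ x → T (x ⊕ c , true)) (trans (cong (_⊕ val u ⊗ i) (zeroʳ (val u′))) (+-identityˡ _)) ⟩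
    T (val u ⊗ i ⊕ c , true)                      ∎
    where open ≡-Reasoning

  -- The shift on the right must preserve S. For arbitrary S only rotations are certain to do so;
  -- they are embedded as `(a , t , ⊝ t)`.
  p²∣#WildIso : ∀ S T → p * p ∣ #WildIso S T
  p²∣#WildIso S T = subst (_∣ #WildIso S T) (size-× (finite-Fin p) (finite-Fin p))
    (WildAction.order-divides (additive ×-group additive) (λ (a , t) → a , t , ⊝ t)
      (λ (a , t) (a′ , t′) → cong (λ x → a ⊕ a′ , t ⊕ t′ , x) (solve 2 (λ t t′ → :- (t :+ t′) := :- t :+ :- t′) refl t t′))
      (cong (λ x → 0F , 0F , x) ⊝0≡0)
      (λ _ eq → cong₂ _,_ (cong proj₁ eq) (cong (proj₁ ∘ proj₂) eq))
      S T (λ (a , t) → rot-preserves S t))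

  -- Here every shift preserves S, so the full group of triples acts.
  p³∣#WildIso : ∀ S T → Constant S → p * (p * p) ∣ #WildIso S T
  p³∣#WildIso S T const = subst (_∣ #WildIso S T) (trans (size-× (finite-Fin p) _) (cong (p *_) (size-× (finite-Fin p) (finite-Fin p))))
    (WildAction.order-divides additive³ id (λ _ _ → refl) refl (λ _ eq → eq)
      S T (λ (a , b , c) → shift-preserves const b c))

  -- The contradiction modulo powers of p.

  module _ (p-odd : p % 2 ≡ 1) where

    private
      -- The 2 in the number of layered automorphisms counts the choices of the flag exchanging the
      -- layers. Here the oddness of `p` enters.
      p∤2 : ¬ p ∣ 2
      p∤2 p∣2 = contradiction (trans (sym p-odd) (cong (_% 2) p≡2)) λ ()
        where
        p≡2 : p ≡ 2
        p≡2 = ℕ.≤-antisym (∣⇒≤ p∣2) (ℕ.nonTrivial⇒n>1 p {{prime⇒nonTrivial p-prime}})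

      p∤small : ∀ {k} → 0 < k → k < p → ¬ p ∣ k
      p∤small 0<k k<p p∣k = ℕ.<⇒≱ k<p (∣⇒≤ {{ℕ.>-nonZero 0<k}} p∣k)

      p²∤ : ∀ {k} → 0 < k → k < p → ¬ p * p ∣ k * (p * 2)
      p²∤ {k} 0<k k<p h = [ p∤small 0<k k<p , p∤2 ]′
        (euclidsLemma k 2 p-prime (*-cancelˡ-∣ p (subst (p * p ∣_) (swap k p 2) h)))
        where
        swap : ∀ k p m → k * (p * m) ≡ p * (k * m)
        swap = ℕSolver.solve-∀

      p³∤ : ∀ {k} → 0 < k → k < p → ¬ p * (p * p) ∣ k * (k * (p * (p * 2)))
      p³∤ {k} 0<k k<p h = [ p∤small 0<k k<p , (λ p∣2k → [ p∤small 0<k k<p , p∤2 ]′ (euclidsLemma k 2 p-prime p∣2k)) ]′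
        (euclidsLemma k (k * 2) p-prime (*-cancelˡ-∣ p (*-cancelˡ-∣ p (subst (p * (p * p) ∣_) (swap k p) h))))
        where
        swap : ∀ k p → k * (k * (p * (p * 2))) ≡ p * (p * (k * (k * 2)))
        swap = ℕSolver.solve-∀

    rigidity : ∀ {S T f g} → Iso S T f → Iso T S g → ∃₂ (Affine S T)
    rigidity {S} {T} {f} {g} f-iso g-iso = by-cases (exists? finite-Params (validParams? S T))
      where
      no-layered : ¬ (∃ λ q → ValidParams S T q) → #LayeredIso S T ≡ 0
      no-layered none = trans (#LayeredIso≡ S T) (ℕ.n≤0⇒n≡0 (size-≤ (finite-Sub finite-Params (validParams? S T)) (finite-Fin 0)
        (λ x → ⊥-elim (none (val x , holds x))) (λ {x} → ⊥-elim (none (val x , holds x)))))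
      same-number : #Iso S S ≡ #Iso S T
      same-number = ℕ.≤-antisym (#Iso-≤ f f-iso) (#Iso-≤ g g-iso)
      divides-layered : ∀ {m} → ¬ (∃ λ q → ValidParams S T q) → (∀ U → m ∣ #WildIso S U) → m ∣ #LayeredIso S S
      -- Without layered isomorphisms S → T, their number is `#WildIso S T`, and it is also the
      -- number of automorphisms of S. So m divides all automorphisms and the wild ones, hence the
      -- layered ones.
      divides-layered {m} none m∣ = ∣m+n∣m⇒∣n (subst (m ∣_) (begin
        #WildIso S T                              ≡⟨ cong (_+ #WildIso S T) (no-layered none) ⟨
        #LayeredIso S T + #WildIso S T          ≡⟨ #Iso-split S T ⟨
        #Iso S T                                  ≡⟨ same-number ⟨
        #Iso S S                                  ≡⟨ #Iso-split S S ⟩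
        #LayeredIso S S + #WildIso S S          ≡⟨ ℕ.+-comm (#LayeredIso S S) (#WildIso S S) ⟩
        #WildIso S S + #LayeredIso S S          ∎) (m∣ T)) (m∣ S)
        where open ≡-Reasoning
      impossible-constant : Constant S → (∃ λ k → 0 < k × k < p × #LayeredIso S S ≡ k * (k * (p * (p * 2)))) →
        ¬ (∃ λ q → ValidParams S T q) → ⊥
      impossible-constant const (k , 0<k , k<p , eq) none =
        p³∤ 0<k k<p (subst (p * (p * p) ∣_) eq (divides-layered none (λ U → p³∣#WildIso S U const)))
      impossible-nonconstant : (∃ λ k → 0 < k × k < p × #LayeredIso S S ≡ k * (p * 2)) → ¬ (∃ λ q → ValidParams S T q) → ⊥
      impossible-nonconstant (k , 0<k , k<p , eq) none =
        p²∤ 0<k k<p (subst (p * p ∣_) eq (divides-layered none (p²∣#WildIso S)))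
      impossible : ¬ (∃ λ q → ValidParams S T q) → Dec (Constant S) → ⊥
      impossible none (yes const) = impossible-constant const (#LayeredIso-constant S const) none
      impossible none (no ¬const) = impossible-nonconstant (#LayeredIso-nonconstant S ¬const) none
      by-cases : Dec (∃ λ q → ValidParams S T q) → ∃₂ (Affine S T)
      by-cases (yes ((u , u′ , v , w , l) , valid)) = u , v ⊕ w , valid⇒affine {S} {T} {u} {u′} valid
      by-cases (no none) = ⊥-elim (impossible none (forall? (finite-Fin p) λ i → S (i , true) Bool.≟ S (0F , true)))

-- Fixed subsets

∑-× : (fA : Finite A) (fB : Finite B) (f : A × B → ℕ) → ∑ (finite-× fA fB) f ≡ ∑ fA (λ a → ∑ fB (λ b → f (a , b)))
∑-× {A} {B} fA fB f = begin
  ∑ (finite-× fA fB) f                               ≡⟨ size-Σ (finite-× fA fB) (finite-Fin ∘ f) ⟨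
  size (finite-Σ (finite-× fA fB) (finite-Fin ∘ f))  ≡⟨ size-≡ (finite-Σ (finite-× fA fB) (finite-Fin ∘ f)) (finite-Σ fA inner)
                                                          (λ ((a , b) , x) → a , b , x) (λ (a , b , x) → (a , b) , x) (λ _ → refl) (λ _ → refl) ⟩
  size (finite-Σ fA inner)                           ≡⟨ size-Σ fA inner ⟩
  ∑ fA (size ∘ inner)                                ≡⟨ ∑-cong fA (λ a → size-Σ fB (λ b → finite-Fin (f (a , b)))) ⟩
  ∑ fA (λ a → ∑ fB (λ b → f (a , b)))                ∎
  where
  open ≡-Reasoning
  inner : ∀ a → Finite (Σ B (λ b → Fin (f (a , b))))
  inner a = finite-Σ fB (λ b → finite-Fin (f (a , b)))

∑-const : (fA : Finite A) (c : ℕ) → ∑ fA (λ _ → c) ≡ size fA * c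
∑-const fA c = sum-const (size fA) c

size-Sub-⇔ : {P Q : A → Set} (fA : Finite A) (P? : ∀ a → Dec (P a)) (Q? : ∀ a → Dec (Q a)) →
  (∀ a → P a → Q a) → (∀ a → Q a → P a) → size (finite-Sub fA P?) ≡ size (finite-Sub fA Q?)
size-Sub-⇔ fA P? Q? P⇒Q Q⇒P = size-≡ (finite-Sub fA P?) (finite-Sub fA Q?)
  (λ x → sub (val x) (P⇒Q _ (holds x))) (λ x → sub (val x) (Q⇒P _ (holds x))) (λ _ → Sub-≡ refl) (λ _ → Sub-≡ refl)

size-Sub-all : {P : A → Set} (fA : Finite A) (P? : ∀ a → Dec (P a)) → (∀ a → P a) → size (finite-Sub fA P?) ≡ size fA
size-Sub-all fA P? all = size-≡ (finite-Sub fA P?) fA val (λ a → sub a (all a)) (λ _ → Sub-≡ refl) (λ _ → refl)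

size-Sub-one : {P : A → Set} (fA : Finite A) (P? : ∀ a → Dec (P a)) (a₀ : A) → P a₀ → (∀ a → P a → a ≡ a₀) → size (finite-Sub fA P?) ≡ 1
size-Sub-one fA P? a₀ Pa₀ unique = size-≡ (finite-Sub fA P?) finite-⊤ (λ _ → tt) (λ _ → sub a₀ Pa₀)
  (λ x → Sub-≡ (sym (unique (val x) (holds x)))) (λ _ → refl)

-- Compares sums that agree off one point without subtracting. The exceptional points will be the
-- identity among the translations and 1 among the units.
∑-change-at : (fA : Finite A) (a₀ : A) (f g : A → ℕ) → (∀ a → a ≢ a₀ → f a ≡ g a) → ∑ fA f + g a₀ ≡ ∑ fA g + f a₀
∑-change-at fA a₀ f g agree = begin
  ∑ fA f + g a₀                           ≡⟨ cong (∑ fA f +_) (∑δ (g a₀)) ⟨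
  ∑ fA f + ∑ fA (λ a → g a₀ * δ a)        ≡⟨ ∑-+ fA f (λ a → g a₀ * δ a) ⟨
  ∑ fA (λ a → f a + g a₀ * δ a)           ≡⟨ ∑-cong fA (λ a → pointwise a (equal? fA a a₀)) ⟩
  ∑ fA (λ a → g a + f a₀ * δ a)           ≡⟨ ∑-+ fA g (λ a → f a₀ * δ a) ⟩
  ∑ fA g + ∑ fA (λ a → f a₀ * δ a)        ≡⟨ cong (∑ fA g +_) (∑δ (f a₀)) ⟩
  ∑ fA g + f a₀                           ∎
  where
  open ≡-Reasoning
  δ′ : ∀ {a} → Dec (a ≡ a₀) → ℕ
  δ′ a≟a₀ = size (finite-T ⌊ a≟a₀ ⌋)
  δ : _ → ℕ
  δ a = δ′ (equal? fA a a₀)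
  ∑δ : ∀ c → ∑ fA (λ a → c * δ a) ≡ c
  ∑δ c = trans (∑-*ˡ fA c δ) (trans (cong (c *_) (trans (sym (size-Sub fA (λ a → equal? fA a a₀)))
    (size-Sub-one fA (λ a → equal? fA a a₀) a₀ refl (λ _ eq → eq)))) (ℕ.*-identityʳ c))
  pointwise : ∀ a (a≟a₀ : Dec (a ≡ a₀)) → f a + g a₀ * δ′ a≟a₀ ≡ g a + f a₀ * δ′ a≟a₀
  pointwise a (yes refl) = trans (cong (f a +_) (ℕ.*-identityʳ (g a))) (trans (ℕ.+-comm (f a) (g a)) (cong (g a +_) (sym (ℕ.*-identityʳ (f a)))))
  pointwise a (no a≢a₀) = cong₂ _+_ (agree a a≢a₀) (trans (ℕ.*-zeroʳ (g a₀)) (sym (ℕ.*-zeroʳ (f a₀))))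

module SubsetAction {G Y : Set} {𝓖 : FiniteGroup G} (fY : Finite Y) (𝓐 : Action 𝓖 Y) where
  open FiniteGroup 𝓖
  open Action 𝓐

  private
    group : Group _ _
    group = record { isGroup = isGroup }

    translate : G → Tab fY Bool → Tab fY Bool
    translate g s = tab fY (λ y → app fY s (act (g ⁻¹) y))

    translate-app : ∀ g s y → app fY (translate g s) y ≡ app fY s (act (g ⁻¹) y)
    translate-app g s y = app-tab fY _ y

  subset-action : Action 𝓖 (Tab fY Bool)
  subset-action = record
    { act   = translate
    ; act-ε = λ s → tab-ext fY λ y → trans (translate-app ε s y) (cong (app fY s)
        (trans (cong (λ g → act g y) (Algebra.Properties.Group.ε⁻¹≈ε group)) (act-ε y)))
    ; act-∙ = λ g h s → tab-ext fY λ y → trans (translate-app (g ∙ h) s y) (trans (cong (app fY s)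
        (trans (cong (λ k → act k y) (Algebra.Properties.Group.⁻¹-anti-homo-∙ group g h)) (act-∙ (h ⁻¹) (g ⁻¹) y)))
        (sym (trans (translate-app g (translate h s) y) (translate-app h s _))))
    }

  -- Removes the inverse from the action on subsets, which gives it the shape of `Affine`.
  translate⇒ : ∀ {g s t} → translate g s ≡ t → ∀ y → app fY s y ≡ app fY t (act g y)
  translate⇒ {g} {s} refl y = sym (trans (translate-app g s _) (cong (app fY s) (Orbits.act-⁻¹ fY 𝓐 g refl)))

  ⇒translate : ∀ {g s t} → (∀ y → app fY s y ≡ app fY t (act g y)) → translate g s ≡ t
  ⇒translate {g} {s} {t} h = tab-ext fY λ y → trans (translate-app g s y) (trans (h (act (g ⁻¹) y))
    (cong (app fY t) (trans (sym (act-∙ g (g ⁻¹) y)) (trans (cong (λ k → act k y) (inverseʳ g)) (act-ε y)))))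

module Cycles {Y : Set} (fY : Finite Y) (m : ℕ) (f : Y → Y) (periodic : ∀ y → iter (suc m) f y ≡ y) where

  open Orbits fY (cyclic-action (suc m) f periodic)

  #cycles : ℕ
  #cycles = size finite-Orbit

  -- Burnside's lemma for the cyclic group of iterates of `f`: the identity fixes all of `Y`, and
  -- each of the m other exponents is assumed to fix c points.
  cycle-count : ∀ c → (∀ k → k < m → size (finite-Sub fY (λ y → equal? fY (iter (suc k) f y) y)) ≡ c) → suc m * #cycles ≡ size fY + m * c
  cycle-count c fixed = trans (sym burnside) (cong₂ _+_
    (size-Sub-all fY (λ y → equal? fY y y) (λ _ → refl))
    (trans (sum-cong-≗ {m} {y = λ _ → c} (λ i → fixed (toℕ i) (Fin.toℕ<n i))) (sum-const m c)))

  -- A subset fixed by `f` is fixed by all iterates, hence a union of cycles.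
  size-fixed-subsets : {P : Tab fY Bool → Set} (P? : ∀ s → Dec (P s)) →
    (∀ {s} → P s → ∀ y → app fY s y ≡ app fY s (f y)) → (∀ {s} → (∀ y → app fY s y ≡ app fY s (f y)) → P s) →
    size (finite-Sub (finite-Tab fY finite-Bool) P?) ≡ 2 ^ #cycles
  size-fixed-subsets P? P⇒ ⇒P = trans (size-Sub-⇔ (finite-Tab fY finite-Bool) P? invariant?
      (λ s Ps k y → iterate s (P⇒ Ps) (toℕ k) y) (λ s inv → ⇒P (λ y → sym (once s inv y)))) size-Invariant
    where
    iterate : ∀ s → (∀ y → app fY s y ≡ app fY s (f y)) → ∀ k y → app fY s (iter k f y) ≡ app fY s y
    iterate s h zero    y = refl
    iterate s h (suc k) y = trans (sym (h _)) (iterate s h k y)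
    once : ∀ s → Invariant s → ∀ y → app fY s (f y) ≡ app fY s y
    once s inv y = trans (cong (app fY s) (sym (trans (cong (λ n → iter n f y) (ℤ/.toℕ-[] (suc m) 1)) (iter-% (suc m) f periodic 1 y))))
      (inv (ℤ/.[_] (suc m) 1) y)

-- The affine group

module AffineGroup (p : ℕ) .{{p≢0 : NonZero p}} (p-prime : Prime p) where

  open Field p p-prime

  -- The pair (u , v) is the map x ↦ u x + v, and the product is composition.
  affine : FiniteGroup (Unit × F)
  affine = record
    { finite  = finite-× finite-Unit (finite-Fin p)
    ; _∙_     = _∙_
    ; ε       = one , 0F
    ; _⁻¹     = λ (u , v) → u ⁻¹ , ⊝ (val (u ⁻¹) ⊗ v)
    ; isGroup = record
      { isMonoid = record
        { isSemigroup = record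
          { isMagma = record { isEquivalence = isEquivalence ; ∙-cong = cong₂ _∙_ }
          ; assoc = λ (u , v) (u′ , v′) (u″ , v″) → cong₂ _,_ (Sub-≡ (*-assoc (val u) (val u′) (val u″)))
              (solve 5 (λ u v u′ v′ v″ → u :* u′ :* v″ :+ (u :* v′ :+ v) := u :* (u′ :* v″ :+ v′) :+ v) refl (val u) v (val u′) v′ v″)
          }
        ; identity = (λ (u , v) → cong₂ _,_ (Sub-≡ (*-identityˡ (val u))) (trans (+-identityʳ _) (*-identityˡ v)))
                   , (λ (u , v) → cong₂ _,_ (Sub-≡ (*-identityʳ (val u))) (trans (cong (_⊕ v) (zeroʳ (val u))) (+-identityˡ v)))
        }
      ; inverse = (λ (u , v) → cong₂ _,_ (Sub-≡ (⊗-inverseˡ u)) (-‿inverseʳ _))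
                , (λ (u , v) → cong₂ _,_ (Sub-≡ (⊗-inverseʳ u)) (begin
                    val u ⊗ ⊝ (val (u ⁻¹) ⊗ v) ⊕ v    ≡⟨ solve 3 (λ u w v → u :* :- (w :* v) :+ v := :- (u :* w :* v) :+ v) refl (val u) (val (u ⁻¹)) v ⟩
                    ⊝ (val u ⊗ val (u ⁻¹) ⊗ v) ⊕ v    ≡⟨ cong (λ x → ⊝ (x ⊗ v) ⊕ v) (⊗-inverseʳ u) ⟩
                    ⊝ (1F ⊗ v) ⊕ v                    ≡⟨ cong (λ x → ⊝ x ⊕ v) (*-identityˡ v) ⟩
                    ⊝ v ⊕ v                           ≡⟨ -‿inverseˡ v ⟩
                    0F                                ∎))
      ; ⁻¹-cong = cong λ (u , v) → u ⁻¹ , ⊝ (val (u ⁻¹) ⊗ v)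
      }
    }
    where
    open ≡-Reasoning
    _∙_ : Unit × F → Unit × F → Unit × F
    (u , v) ∙ (u′ , v′) = u · u′ , val u ⊗ v′ ⊕ v

  -- The nontrivial rotations τ^i and the reflections τ^i σ.
  Point : Set
  Point = Unit ⊎ F

  finite-Point : Finite Point
  finite-Point = finite-⊎ finite-Unit (finite-Fin p)

  -- The automorphism τ ↦ τ^u, σ ↦ τ^v σ on the non-identity elements.
  apply : Unit × F → Point → Point
  apply (u , v) (inj₁ w) = inj₁ (u · w)
  apply (u , v) (inj₂ j) = inj₂ (val u ⊗ j ⊕ v)

  point-action : Action affine Point
  point-action = record
    { act   = apply
    ; act-ε = λ { (inj₁ w) → cong inj₁ (Sub-≡ (*-identityˡ (val w)))
                ; (inj₂ j) → cong inj₂ (trans (+-identityʳ _) (*-identityˡ j)) }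
    ; act-∙ = λ { (u , v) (u′ , v′) (inj₁ w) → cong inj₁ (Sub-≡ (*-assoc (val u) (val u′) (val w)))
                ; (u , v) (u′ , v′) (inj₂ j) → cong inj₂ (solve 5 (λ u v u′ v′ j →
                    u :* u′ :* j :+ (u :* v′ :+ v) := u :* (u′ :* j :+ v′) :+ v) refl (val u) v (val u′) v′ j) }
    }

  open SubsetAction finite-Point point-action public

  Subset : Set
  Subset = Tab finite-Point Bool

  finite-Subset : Finite Subset
  finite-Subset = finite-Tab finite-Point finite-Bool

  module Subsets = Orbits finite-Subset subset-action

  n : ℕ
  n = size finite-Unit

  #fixed : Unit × F → ℕ
  #fixed g = size (Subsets.finite-Fix g)

  private
    size-Point : size finite-Point ≡ n + suc n
    size-Point = trans (size-⊎ finite-Unit (finite-Fin p)) (cong (n +_) (sym suc-size-Unit))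

    #fixed-cycles : ∀ g m (periodic : ∀ y → iter (suc m) (apply g) y ≡ y) →
      #fixed g ≡ 2 ^ Cycles.#cycles finite-Point m (apply g) periodic
    #fixed-cycles g m periodic = Cycles.size-fixed-subsets finite-Point m (apply g) periodic
      (λ s → equal? finite-Subset (Action.act subset-action g s) s) translate⇒ ⇒translate

    iter-unit : ∀ (u : Unit) v k w → ∃ λ w′ → iter k (apply (u , v)) (inj₁ w) ≡ inj₁ w′ × val w′ ≡ val u ↑ k ⊗ val w
    iter-unit u v zero    w = w , refl , sym (*-identityˡ (val w))
    iter-unit u v (suc k) w = let w′ , eq , val-eq = iter-unit u v k w in
      u · w′ , cong (apply (u , v)) eq , trans (cong (val u ⊗_) val-eq) (sym (*-assoc (val u) (val u ↑ k) (val w)))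

  private
    ⊝≡0⇒≡ : ∀ a b → a ⊕ ⊝ b ≡ 0F → a ≡ b
    ⊝≡0⇒≡ a b eq = trans (solve 2 (λ a b → a := a :+ :- b :+ b) refl a b) (trans (cong (_⊕ b) eq) (+-identityˡ b))

    -- The equation amounts to (x - 1)(j - c) = 0.
    dilation-fixes : ∀ x j c → x ⊗ (j ⊕ ⊝ c) ⊕ c ≡ j → x ≡ 1F ⊎ j ≡ c
    dilation-fixes x j c fixed = [ inj₁ ∘ ⊝≡0⇒≡ x 1F , inj₂ ∘ ⊝≡0⇒≡ j c ]′ (integral (x ⊕ ⊝ 1F) (j ⊕ ⊝ c) product≡0)
      where
      open ≡-Reasoning
      expand : ∀ x y o c → (x ⊕ ⊝ o) ⊗ y ≡ x ⊗ y ⊕ c ⊕ ⊝ (o ⊗ y ⊕ c)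
      expand = solve 4 (λ x y o c → (x :+ :- o) :* y := x :* y :+ c :+ :- (o :* y :+ c)) refl
      product≡0 : (x ⊕ ⊝ 1F) ⊗ (j ⊕ ⊝ c) ≡ 0F
      product≡0 = begin
        (x ⊕ ⊝ 1F) ⊗ (j ⊕ ⊝ c)                                   ≡⟨ expand x (j ⊕ ⊝ c) 1F c ⟩
        x ⊗ (j ⊕ ⊝ c) ⊕ c ⊕ ⊝ (1F ⊗ (j ⊕ ⊝ c) ⊕ c)               ≡⟨ cong₂ (λ a b → a ⊕ ⊝ (b ⊕ c)) fixed (*-identityˡ (j ⊕ ⊝ c)) ⟩
        j ⊕ ⊝ (j ⊕ ⊝ c ⊕ c)                                      ≡⟨ cong (λ y → j ⊕ ⊝ y) (solve 2 (λ j c → j :+ :- c :+ c := j) refl j c) ⟩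
        j ⊕ ⊝ j                                                  ≡⟨ -‿inverseʳ j ⟩
        0F                                                       ∎

  module _ (u : Unit) (v : F) (u≢1 : val u ≢ 1F) where
    open ≡-Reasoning
    private
      m : ℕ
      m = pred-ord u
      1-u : Unit
      1-u = sub (1F ⊕ ⊝ val u) λ eq → u≢1 (sym (trans (solve 2 (λ o u → o := o :+ :- u :+ u) refl 1F (val u)) (trans (cong (_⊕ val u) eq) (+-identityˡ (val u)))))
      -- The fixed point v/(1 - u) of the affine map; about it, the iterates are pure dilations.
      c : F
      c = val (1-u ⁻¹) ⊗ v
      center : val u ⊗ c ⊕ v ≡ c
      center = begin
        val u ⊗ c ⊕ v                          ≡⟨ cong (val u ⊗ c ⊕_) (trans (sym (*-identityˡ v)) (trans (cong (_⊗ v) (sym (⊗-inverseʳ 1-u))) (*-assoc _ _ v))) ⟩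
        val u ⊗ c ⊕ (1F ⊕ ⊝ val u) ⊗ c         ≡⟨ solve 3 (λ u c o → u :* c :+ (o :+ :- u) :* c := o :* c) refl (val u) c 1F ⟩
        1F ⊗ c                                 ≡⟨ *-identityˡ c ⟩
        c                                      ∎
      iter-reflection : ∀ k j → iter k (apply (u , v)) (inj₂ j) ≡ inj₂ (val u ↑ k ⊗ (j ⊕ ⊝ c) ⊕ c)
      iter-reflection zero j = cong inj₂ (sym (trans (cong (_⊕ c) (*-identityˡ _)) (solve 2 (λ j c → j :+ :- c :+ c := j) refl j c)))
      iter-reflection (suc k) j = trans (cong (apply (u , v)) (iter-reflection k j)) (cong inj₂ (begin
        val u ⊗ (x ⊗ y ⊕ c) ⊕ v               ≡⟨ solve 5 (λ u x y c v → u :* (x :* y :+ c) :+ v := u :* x :* y :+ (u :* c :+ v)) refl (val u) x y c v ⟩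
        val u ⊗ x ⊗ y ⊕ (val u ⊗ c ⊕ v)       ≡⟨ cong (val u ⊗ x ⊗ y ⊕_) center ⟩
        val u ⊗ x ⊗ y ⊕ c                     ∎))
        where
        x = val u ↑ k
        y = j ⊕ ⊝ c
      ^-period : val u ↑ suc m ≡ 1F
      ^-period = subst (λ d → val u ↑ d ≡ 1F) (ord-suc u) (^-ord u)
      periodic : ∀ y → iter (suc m) (apply (u , v)) y ≡ y
      periodic (inj₁ w) = let w′ , eq , val-eq = iter-unit u v (suc m) w in
        trans eq (cong inj₁ (Sub-≡ (trans val-eq (trans (cong (_⊗ val w) ^-period) (*-identityˡ (val w))))))
      periodic (inj₂ j) = trans (iter-reflection (suc m) j) (cong inj₂ (trans (cong (λ x → x ⊗ (j ⊕ ⊝ c) ⊕ c) ^-period)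
        (trans (cong (_⊕ c) (*-identityˡ _)) (solve 2 (λ j c → j :+ :- c :+ c := j) refl j c))))
      no-unit : ∀ k → k < m → ∀ w → iter (suc k) (apply (u , v)) (inj₁ w) ≢ inj₁ w
      no-unit k k<m w fixed = let w′ , eq , val-eq = iter-unit u v (suc k) w in
        ord-minimal u k (subst (suc k <_) (sym (ord-suc u)) (s≤s k<m)) (⊗-cancelˡ (holds w) (begin
          val w ⊗ val u ↑ suc k     ≡⟨ *-comm _ _ ⟩
          val u ↑ suc k ⊗ val w     ≡⟨ val-eq ⟨
          val w′                    ≡⟨ cong val (inj₁-injective (trans (sym eq) fixed)) ⟩
          val w                     ≡⟨ *-identityʳ (val w) ⟨
          val w ⊗ 1F                ∎))
      only-center : ∀ k → k < m → ∀ j → iter (suc k) (apply (u , v)) (inj₂ j) ≡ inj₂ j → j ≡ c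
      only-center k k<m j fixed = [ (λ eq → ⊥-elim (ord-minimal u k (subst (suc k <_) (sym (ord-suc u)) (s≤s k<m)) eq)) , id ]′
        (dilation-fixes (val u ↑ suc k) j c (inj₂-injective (trans (sym (iter-reflection (suc k) j)) fixed)))
      one-fixed : ∀ k → k < m → size (finite-Sub finite-Point (λ y → equal? finite-Point (iter (suc k) (apply (u , v)) y) y)) ≡ 1
      one-fixed k k<m = size-Sub-one finite-Point (λ y → equal? finite-Point (iter (suc k) (apply (u , v)) y) y) (inj₂ c)
        (trans (iter-reflection (suc k) c) (cong inj₂ (trans (cong (λ y → val u ↑ suc k ⊗ y ⊕ c) (-‿inverseʳ c)) (trans (cong (_⊕ c) (zeroʳ _)) (+-identityˡ c)))))
        (λ { (inj₁ w) fixed → ⊥-elim (no-unit k k<m w fixed) ; (inj₂ j) fixed → cong inj₂ (only-center k k<m j fixed) })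
      q : ℕ
      q = quotient (ord∣size-Unit u)
      n≡ : n ≡ q * suc m
      n≡ = trans (_∣_.equality (ord∣size-Unit u)) (cong (q *_) (ord-suc u))
      -- The center is a cycle by itself, and the other 2n points lie in cycles of full length
      -- `ord u`.
      cycles≡ : Cycles.#cycles finite-Point m (apply (u , v)) periodic ≡ suc ((2 * n) / ord u)
      cycles≡ = ℕ.*-cancelˡ-≡ _ _ (suc m) (begin
        suc m * Cycles.#cycles finite-Point m (apply (u , v)) periodic    ≡⟨ Cycles.cycle-count finite-Point m (apply (u , v)) periodic 1 one-fixed ⟩
        size finite-Point + m * 1                                         ≡⟨ cong (_+ m * 1) (trans size-Point (cong (λ x → x + suc x) n≡)) ⟩
        q * suc m + suc (q * suc m) + m * 1                               ≡⟨ arithmetic q m ⟩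
        suc m * suc (2 * q)                                               ≡⟨ cong (λ x → suc m * suc x) 2q≡ ⟩
        suc m * suc ((2 * n) / ord u)                                     ∎)
        where
        arithmetic : ∀ q m → q * suc m + suc (q * suc m) + m * 1 ≡ suc m * suc (2 * q)
        arithmetic = ℕSolver.solve-∀
        2q≡ : 2 * q ≡ (2 * n) / ord u
        2q≡ = sym (trans (cong (_/ ord u) (trans (cong (2 *_) (_∣_.equality (ord∣size-Unit u))) (sym (ℕ.*-assoc 2 q (ord u))))) (m*n/n≡m (2 * q) (ord u)))

    #fixed-dilation : #fixed (u , v) ≡ 2 * 2 ^ ((2 * n) / ord u)
    #fixed-dilation = trans (#fixed-cycles (u , v) m periodic) (cong (2 ^_) cycles≡)

  -- A nonzero translation fixes each of the p - 1 nontrivial rotations and moves the reflections in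
  -- a single cycle, which makes p cycles.
  #fixed-translation : ∀ v → v ≢ 0F → #fixed (one , v) ≡ 2 ^ p
  #fixed-translation v v≢0 = trans (#fixed-cycles (one , v) n periodic) (cong (2 ^_) cycles≡)
    where
    open ≡-Reasoning
    iter-rotation : ∀ k w → iter k (apply (one , v)) (inj₁ w) ≡ inj₁ w
    iter-rotation zero    w = refl
    iter-rotation (suc k) w = trans (cong (apply (one , v)) (iter-rotation k w)) (cong inj₁ (Sub-≡ (*-identityˡ (val w))))
    iter-reflection : ∀ k j → iter k (apply (one , v)) (inj₂ j) ≡ inj₂ (j ⊕ [ k ] ⊗ v)
    iter-reflection zero    j = cong inj₂ (sym (trans (cong (j ⊕_) (zeroˡ v)) (+-identityʳ j)))
    iter-reflection (suc k) j = trans (cong (apply (one , v)) (iter-reflection k j)) (cong inj₂ (begin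
      1F ⊗ (j ⊕ [ k ] ⊗ v) ⊕ v         ≡⟨ cong₂ _⊕_ (*-identityˡ _) (sym (*-identityˡ v)) ⟩
      j ⊕ [ k ] ⊗ v ⊕ 1F ⊗ v           ≡⟨ solve 4 (λ j k v o → j :+ k :* v :+ o :* v := j :+ (o :+ k) :* v) refl j [ k ] v 1F ⟩
      j ⊕ (1F ⊕ [ k ]) ⊗ v             ≡⟨ cong (λ x → j ⊕ x ⊗ v) ([]-+ 1 k) ⟨
      j ⊕ [ suc k ] ⊗ v                ∎))
    periodic : ∀ y → iter (suc n) (apply (one , v)) y ≡ y
    periodic (inj₁ w) = iter-rotation (suc n) w
    periodic (inj₂ j) = trans (iter-reflection (suc n) j) (cong inj₂ (trans (cong (λ x → j ⊕ x ⊗ v) (trans (cong [_] suc-size-Unit) [m]≡0))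
      (trans (cong (j ⊕_) (zeroˡ v)) (+-identityʳ j))))
    no-reflection : ∀ k → k < n → ∀ j → iter (suc k) (apply (one , v)) (inj₂ j) ≢ inj₂ j
    no-reflection k k<n j fixed = [ (λ eq → contradiction′ (trans (sym (toℕ-[] (suc k))) (trans (cong toℕ eq) (toℕ-[] 0)))) , v≢0 ]′
      (integral [ suc k ] v (begin
        [ suc k ] ⊗ v                       ≡⟨ solve 2 (λ j x → x := :- j :+ (j :+ x)) refl j ([ suc k ] ⊗ v) ⟩
        ⊝ j ⊕ (j ⊕ [ suc k ] ⊗ v)           ≡⟨ cong (⊝ j ⊕_) (inj₂-injective (trans (sym (iter-reflection (suc k) j)) fixed)) ⟩
        ⊝ j ⊕ j                             ≡⟨ -‿inverseˡ j ⟩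
        0F                                  ∎))
      where
      contradiction′ : suc k % p ≢ 0 % p
      contradiction′ eq = ℕ.1+n≢0 (trans (sym (m<n⇒m%n≡m (subst (suc k <_) suc-size-Unit (s≤s k<n)))) (trans eq (m<n⇒m%n≡m (ℕ.>-nonZero⁻¹ p))))
    rotations-fixed : ∀ k → k < n → size (finite-Sub finite-Point (λ y → equal? finite-Point (iter (suc k) (apply (one , v)) y) y)) ≡ n
    rotations-fixed k k<n = size-≡ (finite-Sub finite-Point fixed?) finite-Unit to from from-to (λ _ → refl)
      where
      fixed? : ∀ y → Dec (iter (suc k) (apply (one , v)) y ≡ y)
      fixed? y = equal? finite-Point (iter (suc k) (apply (one , v)) y) y
      to : Sub fixed? → Unit
      to (inj₁ w ⊢ _) = w
      to x@(inj₂ j ⊢ _) = ⊥-elim (no-reflection k k<n j (holds x))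
      from : Unit → Sub fixed?
      from w = sub (inj₁ w) (iter-rotation (suc k) w)
      from-to : ∀ x → from (to x) ≡ x
      from-to (inj₁ w ⊢ _) = Sub-≡ refl
      from-to x@(inj₂ j ⊢ _) = ⊥-elim (no-reflection k k<n j (holds x))
    cycles≡ : Cycles.#cycles finite-Point n (apply (one , v)) periodic ≡ p
    cycles≡ = trans (ℕ.*-cancelˡ-≡ _ (suc n) (suc n) (begin
      suc n * Cycles.#cycles finite-Point n (apply (one , v)) periodic    ≡⟨ Cycles.cycle-count finite-Point n (apply (one , v)) periodic n rotations-fixed ⟩
      size finite-Point + n * n                                           ≡⟨ cong (_+ n * n) size-Point ⟩
      n + suc n + n * n                                                   ≡⟨ arithmetic n ⟩
      suc n * suc n                                                       ∎)) suc-size-Unit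
      where
      arithmetic : ∀ n → n + suc n + n * n ≡ suc n * suc n
      arithmetic = ℕSolver.solve-∀

  #fixed-identity : #fixed (one , 0F) ≡ 2 ^ (n + suc n)
  #fixed-identity = trans (size-Sub-all finite-Subset _ (Action.act-ε subset-action))
    (trans (size-Tab finite-Point finite-Bool) (cong (2 ^_) size-Point))

  -- The Burnside sum over the affine group.

  #orbits : ℕ
  #orbits = size Subsets.finite-Orbit

  private
    row : Unit → ℕ
    row u = ∑ (finite-Fin p) (λ v → #fixed (u , v))

    weight : Unit → ℕ
    weight u = 2 ^ ((2 * n) / ord u)

    -- The row total for u ≠ 1, formally extended to u = 1, where it is not the row total. The
    -- extension completes the divisor sum, and the discrepancy at 1 becomes the first summand of
    -- the formula.
    bound : Unit → ℕ
    bound u = p * 2 * weight u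

    row-dilation : ∀ u → u ≢ one → row u ≡ bound u
    row-dilation u u≢1 = trans (∑-cong (finite-Fin p) (λ v → #fixed-dilation u v (u≢1 ∘ Sub-≡)))
      (trans (∑-const (finite-Fin p) _) (sym (ℕ.*-assoc p 2 _)))

    -- The p - 1 nonzero translations fix 2^p subsets each, and the identity fixes all 2^(2p - 1).
    row-one : row one + 2 ^ p ≡ p * 2 ^ p + 2 ^ (n + suc n)
    row-one = trans (∑-change-at (finite-Fin p) 0F (λ v → #fixed (one , v)) (λ _ → 2 ^ p) #fixed-translation)
      (cong₂ _+_ (∑-const (finite-Fin p) (2 ^ p)) #fixed-identity)

    bound-one : bound one ≡ p * 2 * 2 ^ (2 * n)
    bound-one = cong (λ k → p * 2 * 2 ^ k) (trans (/-congʳ {m = 2 * n} (∣1⇒≡1 (ord-divides one (*-identityˡ 1F)))) (n/1≡n (2 * n)))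

    burnside-total : ∑ (FiniteGroup.finite affine) #fixed ≡ FiniteGroup.order affine * #orbits
    burnside-total = Subsets.burnside

    order-affine : FiniteGroup.order affine ≡ n * p
    order-affine = size-× finite-Unit (finite-Fin p)

    total : ∑ (FiniteGroup.finite affine) #fixed ≡ n * p * #orbits
    total = trans burnside-total (cong (_* #orbits) order-affine)

    by-rows : (f : Unit × F → ℕ) → ∑ (FiniteGroup.finite affine) f ≡ ∑ finite-Unit (λ u → ∑ (finite-Fin p) (λ v → f (u , v)))
    by-rows f = ∑-× finite-Unit (finite-Fin p) f

    total-rows : ∑ (FiniteGroup.finite affine) #fixed ≡ ∑ finite-Unit row
    total-rows = by-rows #fixed

    ∑-weight : ∑ finite-Unit weight ≡ divisorTerm p
    ∑-weight = ∑-over-orders p {{p≢0}} p-prime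

    ∑-bound : ∑ finite-Unit bound ≡ p * 2 * ∑ finite-Unit weight
    ∑-bound = ∑-*ˡ finite-Unit (p * 2) weight

    change-row : ∑ finite-Unit row + bound one ≡ ∑ finite-Unit bound + row one
    change-row = ∑-change-at finite-Unit one row bound row-dilation

    burnside-rows : n * p * #orbits + bound one ≡ p * 2 * divisorTerm p + row one
    burnside-rows = trans (cong (_+ bound one) (trans (sym total) total-rows)) (trans change-row (cong (_+ row one) (trans ∑-bound (cong (p * 2 *_) ∑-weight))))

  private
    -- Here q is 2^(p - 1), b is `bound one` and r is `row one`. To stay within ℕ, both sides are
    -- compared after adding 2q² + 2q.
    arithmetic : ∀ {p n N d q b r} → suc n ≡ p → b ≡ p * 2 * (q * q) → r + 2 * q ≡ p * (2 * q) + q * (2 * q) →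
      n * p * N + b ≡ p * 2 * d + r → p * n * N + n * (2 * q * q) ≡ n * (2 * q) + 2 * p * d
    arithmetic {p} {n} {N} {d} {q} {b} {r} refl refl r≡ eq = ℕ.+-cancelʳ-≡ (2 * (q * q) + 2 * q) _ _ (begin
      p * n * N + n * (2 * q * q) + (2 * (q * q) + 2 * q)           ≡⟨ left n N q ⟩
      n * p * N + p * 2 * (q * q) + 2 * q                           ≡⟨ cong (_+ 2 * q) eq ⟩
      p * 2 * d + r + 2 * q                                         ≡⟨ ℕ.+-assoc (p * 2 * d) r (2 * q) ⟩
      p * 2 * d + (r + 2 * q)                                       ≡⟨ cong (p * 2 * d +_) r≡ ⟩
      p * 2 * d + (p * (2 * q) + q * (2 * q))                       ≡⟨ right n d q ⟩
      n * (2 * q) + 2 * p * d + (2 * (q * q) + 2 * q)               ∎)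
      where
      open ≡-Reasoning
      left : ∀ n N q → suc n * n * N + n * (2 * q * q) + (2 * (q * q) + 2 * q) ≡ n * suc n * N + suc n * 2 * (q * q) + 2 * q
      left = ℕSolver.solve-∀
      right : ∀ n d q → suc n * 2 * d + (suc n * (2 * q) + q * (2 * q)) ≡ n * (2 * q) + 2 * suc n * d + (2 * (q * q) + 2 * q)
      right = ℕSolver.solve-∀

    2^p : 2 ^ p ≡ 2 * 2 ^ n
    2^p = cong (2 ^_) (sym suc-size-Unit)

    2^2n : 2 ^ (2 * n) ≡ 2 ^ n * 2 ^ n
    2^2n = trans (cong (λ k → 2 ^ (n + k)) (ℕ.+-identityʳ n)) (ℕ.^-distribˡ-+-* 2 n n)

  orbit-count : p * n * #orbits + n * (2 ^ p * 2 ^ n) ≡ n * 2 ^ p + 2 * p * divisorTerm p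
  orbit-count = subst (λ y → p * n * #orbits + n * (y * 2 ^ n) ≡ n * y + 2 * p * divisorTerm p) (sym 2^p)
    (arithmetic {p} {n} {#orbits} {divisorTerm p} {2 ^ n} {bound one} {row one} suc-size-Unit (trans bound-one (cong (p * 2 *_) 2^2n))
      (subst (λ y → row one + y ≡ p * y + 2 ^ n * (2 * 2 ^ n)) 2^p (trans row-one (cong (p * 2 ^ p +_) (ℕ.^-distribˡ-+-* 2 n (suc n)))))
      burnside-rows)

-- Classification

open import Defs
open import Data.Nat using (ℕ; _*_; _∸_; _^_; _%_; NonZero)
open import Data.Nat.Primality using (Prime)
open import Data.Integer using (ℤ; +_; _-_)
open import Data.Integer using () renaming (_*_ to _*ℤ_; _+_ to _+ℤ_)
open import Data.Product using (Σ; _×_)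
open import Relation.Binary.PropositionalEquality using (_≡_)

module Classification (p : ℕ) .{{p≢0 : NonZero p}} (p-prime : Prime p) (p-odd : p % 2 ≡ 1) where

  open Field p p-prime using (F; 0F; 1≢0; Unit; one; _⊕_; ⊝_; _⊗_; +-comm; +-identityʳ; +-identityˡ; zeroʳ; solve; _:=_; _:+_; _:*_)
  open Dihedral p p-prime using (finite-D; arc; Arc≡arc; Iso; Preserves; Injective; layerMap)
  open Rigidity p p-prime using (Valid; Affine; rigidity; valid⇒preserves; layerMap-injective)
  open AffineGroup p p-prime

  decode′ : Subset → (i : F) → Dec (i ≡ 0F) → Bool
  decode′ s i (yes _)   = false
  decode′ s i (no i≢0) = app finite-Point s (inj₁ (sub i i≢0))

  decode : Subset → D p → Bool
  decode s (i , false) = decode′ s i (i Fin.≟ 0F)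
  decode s (i , true)  = app finite-Point s (inj₂ i)

  decode-e : ∀ s → decode s (e p) ≡ false
  decode-e s = at-zero (0F Fin.≟ 0F)
    where
    at-zero : ∀ d → decode′ s 0F d ≡ false
    at-zero (yes _)   = refl
    at-zero (no 0≢0) = ⊥-elim (0≢0 refl)

  decode-unit : ∀ s (u : Unit) → decode s (val u , false) ≡ app finite-Point s (inj₁ u)
  decode-unit s u = at-unit (val u Fin.≟ 0F)
    where
    at-unit : ∀ d → decode′ s (val u) d ≡ app finite-Point s (inj₁ u)
    at-unit (yes u≡0) = ⊥-elim (holds u u≡0)
    at-unit (no _)    = cong (app finite-Point s ∘ inj₁) (Sub-≡ refl)

  connSet : Subset → ConnSet p
  connSet s = decode s , decode-e s

  encode : (D p → Bool) → Subset
  encode S = tab finite-Point λ { (inj₁ u) → S (val u , false) ; (inj₂ i) → S (i , true) }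

  decode-encode : ∀ (S : ConnSet p) x → proj₁ S x ≡ decode (encode (proj₁ S)) x
  decode-encode (S , S-e) (i , true) = sym (app-tab finite-Point _ (inj₂ i))
  decode-encode (S , S-e) (i , false) = by-cases (i Fin.≟ 0F)
    where
    by-cases : ∀ d → S (i , false) ≡ decode′ (encode S) i d
    by-cases (yes refl) = S-e
    by-cases (no i≢0)  = sym (app-tab finite-Point _ (inj₁ (sub i i≢0)))

  affine⇒related : ∀ {s t} u c → Affine (decode s) (decode t) u c → Subsets.Related s t
  affine⇒related {s} {t} u c (A , B) = (u , c) , ⇒translate {u , c} {s} {t} λ
    { (inj₁ w) → trans (sym (decode-unit s w)) (trans (A (val w)) (decode-unit t _))
    ; (inj₂ i) → B i }

  related⇒affine : ∀ {s t} → Subsets.Related s t → ∃₂ (Affine (decode s) (decode t))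
  related⇒affine {s} {t} ((u , c) , eq) = u , c , (λ i → on-rotations i (i Fin.≟ 0F)) , λ i → translate⇒ {u , c} {s} {t} eq (inj₂ i)
    where
    on-rotations : ∀ i → Dec (i ≡ 0F) → decode s (i , false) ≡ decode t (val u ⊗ i , false)
    on-rotations i (yes refl) = trans (decode-e s) (sym (trans (cong (λ x → decode t (x , false)) (zeroʳ (val u))) (decode-e t)))
    on-rotations i (no i≢0) = trans (decode-unit s w) (trans (translate⇒ {u , c} {s} {t} eq (inj₁ w)) (sym (decode-unit t _)))
      where
      w : Unit
      w = sub i i≢0

  cayIso⇒related : ∀ {s t} → CayIso p (connSet s) (connSet t) → Subsets.Related s t
  cayIso⇒related {s} {t} (f , pres) = let u , c , aff = rigidity p-odd {decode s} {decode t} to-iso from-iso in affine⇒related u c aff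
    where
    open Inverse f using (to; from)
    to-from : ∀ x → to (from x) ≡ x
    to-from x = Inverse.inverseˡ f refl
    from-to : ∀ x → from (to x) ≡ x
    from-to x = Inverse.inverseʳ f refl
    to-pres : Preserves (decode s) (decode t) to
    to-pres g h = trans (sym (Arc≡arc (connSet s) g h)) (trans (pres g h) (Arc≡arc (connSet t) (to g) (to h)))
    to-iso : Iso (decode s) (decode t) to
    to-iso = (λ x y eq → trans (sym (from-to x)) (trans (cong from eq) (from-to y))) , to-pres
    from-iso : Iso (decode t) (decode s) from
    from-iso = (λ x y eq → trans (sym (to-from x)) (trans (cong to eq) (to-from y)))
      , λ g h → sym (trans (to-pres (from g) (from h)) (cong₂ (arc (decode t)) (to-from g) (to-from h)))

  bijection : ∀ (f : D p → D p) → Injective f → D p ↔ D p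
  bijection f f-inj = mk↔ₛ′ f (proj₁ ∘ preimage) (proj₂ ∘ preimage) (λ x → f-inj _ _ (proj₂ (preimage (f x))))
    where
    preimage : ∀ y → ∃ λ x → f x ≡ y
    preimage = injective⇒surjective finite-D finite-D f (λ {x} {y} → f-inj x y) ℕ.≤-refl

  affine⇒cayIso : ∀ (S T : ConnSet p) u c → Affine (proj₁ S) (proj₁ T) u c → CayIso p S T
  affine⇒cayIso S T u c (A , B) = bijection (layerMap q) (layerMap-injective q) , λ g h →
      trans (Arc≡arc S g h) (trans (valid⇒preserves {proj₁ S} {proj₁ T} {u} {u} {0F} {c} false valid g h) (sym (Arc≡arc T (layerMap q g) (layerMap q h))))
    where
    -- The group automorphism τ ↦ τ^u, σ ↦ τ^c σ as a layer map.
    q = u , u , 0F , c , false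
    valid : Valid (proj₁ S) (proj₁ T) u u (0F ⊕ c)
    valid = A , A , λ i k → trans (B (k ⊕ i)) (cong (λ x → proj₁ T (x , true))
      (trans (solve 4 (λ u k i c → u :* (k :+ i) :+ c := u :* k :+ u :* i :+ c) refl (val u) k i c) (cong (val u ⊗ k ⊕ val u ⊗ i ⊕_) (sym (+-identityˡ c)))))

  affine-respˡ : ∀ {S S′ T u c} → (∀ x → S x ≡ S′ x) → Affine S′ T u c → Affine S T u c
  affine-respˡ S≗S′ (A , B) = (λ i → trans (S≗S′ _) (A i)) , (λ i → trans (S≗S′ _) (B i))

  classes : NumCayleyDigraphClasses p #orbits
  classes = representative , distinct , exhaustive
    where
    fO : Finite Subsets.Orbit
    fO = Subsets.finite-Orbit
    representative : Fin #orbits → ConnSet p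
    representative i = connSet (val (elem fO i))
    distinct : ∀ i j → CayIso p (representative i) (representative j) → i ≡ j
    distinct i j iso = trans (sym (index-elem fO i)) (trans (cong (index fO) same) (index-elem fO j))
      where
      same : elem fO i ≡ elem fO j
      same = trans (sym (Subsets.orbit-rep (elem fO i))) (trans (Subsets.orbit-cong (cayIso⇒related iso)) (Subsets.orbit-rep (elem fO j)))
    exhaustive : ∀ S → ∃ λ i → CayIso p S (representative i)
    exhaustive S = index fO o , subst (λ x → CayIso p S (connSet (val x))) (sym (elem-index fO o)) iso
      where
      s : Subset
      s = encode (proj₁ S)
      o : Subsets.Orbit
      o = Subsets.orbit s
      iso : CayIso p S (connSet (val o))
      iso = let u , c , aff = related⇒affine (Subsets.related-sym (Subsets.rep-related s)) in
        affine⇒cayIso S (connSet (val o)) u c (affine-respˡ {proj₁ S} {decode s} {decode (val o)} {u} {c} (decode-encode S) aff)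

-- For n = p - 1, x = 2^p and y = 2^(p - 1) this is the formula multiplied by p(p - 1), which clears
-- the denominators. The factor 1 - y is negative, so the term n x y is moved across in ℤ.
integer-form : ∀ {p n N x y d} → p * n * N + n * (x * y) ≡ n * x + 2 * p * d →
  + (p * n) *ℤ + N ≡ (+ n *ℤ + x) *ℤ (+ 1 - + y) +ℤ + (2 * p * d)
integer-form {p} {n} {N} {x} {y} {d} eq = begin
  + (p * n) *ℤ + N                                                      ≡⟨ ℤ.pos-* (p * n) N ⟨
  + (p * n * N)                                                         ≡⟨ shift (+ (p * n * N)) (+ n) (+ x) (+ y) ⟩
  + (p * n * N) +ℤ + n *ℤ (+ x *ℤ + y) +ℤ ℤ.- (+ n *ℤ (+ x *ℤ + y))     ≡⟨ cong (_+ℤ ℤ.- (+ n *ℤ (+ x *ℤ + y))) cast ⟩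
  + n *ℤ + x +ℤ + (2 * p * d) +ℤ ℤ.- (+ n *ℤ (+ x *ℤ + y))              ≡⟨ collect (+ (2 * p * d)) (+ n) (+ x) (+ y) ⟩
  (+ n *ℤ + x) *ℤ (+ 1 - + y) +ℤ + (2 * p * d)                          ∎
  where
  open ≡-Reasoning
  shift : ∀ a n x y → a ≡ a +ℤ n *ℤ (x *ℤ y) +ℤ ℤ.- (n *ℤ (x *ℤ y))
  shift = ℤSolver.solve-∀
  collect : ∀ a n x y → n *ℤ x +ℤ a +ℤ ℤ.- (n *ℤ (x *ℤ y)) ≡ (n *ℤ x) *ℤ (+ 1 - y) +ℤ a
  collect = ℤSolver.solve-∀
  cast : + (p * n * N) +ℤ + n *ℤ (+ x *ℤ + y) ≡ + n *ℤ + x +ℤ + (2 * p * d)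
  cast = begin
    + (p * n * N) +ℤ + n *ℤ (+ x *ℤ + y)       ≡⟨ cong (λ z → + (p * n * N) +ℤ + n *ℤ z) (ℤ.pos-* x y) ⟨
    + (p * n * N) +ℤ + n *ℤ + (x * y)          ≡⟨ cong (λ z → + (p * n * N) +ℤ z) (ℤ.pos-* n (x * y)) ⟨
    + (p * n * N + n * (x * y))              ≡⟨ cong +_ eq ⟩
    + (n * x) +ℤ + (2 * p * d)                 ≡⟨ cong (_+ℤ + (2 * p * d)) (ℤ.pos-* n x) ⟩
    + n *ℤ + x +ℤ + (2 * p * d)                ∎

theorem3p3 : (p : ℕ) .{{_ : NonZero p}} → Prime p → p % 2 ≡ 1 →
    Σ ℕ λ N → NumCayleyDigraphClasses p N ×
    (+ (p * (p ∸ 1)) *ℤ + N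
    ≡ (+ (p ∸ 1) *ℤ + (2 ^ p)) *ℤ (+ 1 - + (2 ^ (p ∸ 1)))
    +ℤ + (2 * p * divisorTerm p))
theorem3p3 p {{p≢0}} p-prime p-odd = #orbits , Classification.classes p {{p≢0}} p-prime p-odd ,
    integer-form {p} {p ∸ 1} {#orbits} {2 ^ p} {2 ^ (p ∸ 1)} {divisorTerm p}
      (subst (λ k → p * k * #orbits + k * (2 ^ p * 2 ^ k) ≡ k * 2 ^ p + 2 * p * divisorTerm p) (cong (_∸ 1) (Field.suc-size-Unit p {{p≢0}} p-prime)) orbit-count)
  where open AffineGroup p {{p≢0}} p-prime using (#orbits; orbit-count)
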